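{- For every $n\ge1$, $[\mathrm{UVAL}_n]=[\mathrm{USAT}_n]\cap[\overline{\mathrm{USAT}}_n]$.
   Context: $\Sigma=\{0,1\}$, $\Sigma^*$ the finite nonempty binary strings; for $x\in\Sigma^m$, $\pi_1(x)=x_1$. $\mathbb{P}_+\Sigma=\{\{0\},\{1\},\Sigma\}$. A promise problem is $\phi:\Sigma^*\to\mathbb{P}_+\Sigma$. $\phi_1\propto\phi_2$ means there is a polynomial-time computable $\mu:\Sigma^*\to\Sigma^*$ with $\phi_1(x)\supseteq\phi_2(\mu(x))$ for all $x$; $[\phi]=\{\phi_1:\phi_1\propto\phi\}$. Level-$n$ problems: the input encodes (e.g. dimensions in binary plus a Boolean formula) $f:\Sigma^{m_1}\times\dots\times\Sigma^{m_n}\to\Sigma$, written $f(x,y^{(1)},\dots,y^{(n-1)})$ with $x\in\Sigma^{m_1}$; $f_x$ is $f$ with $x$ fixed. For a constant $c$, $\mathrm{SAT}_0(c)=\overline{\mathrm{SAT}}_0(c)=c$; for $n\ge1$, $\mathrm{SAT}_n(f)=1\iff\exists x:\overline{\mathrm{SAT}}_{n-1}(f_x)=1$, $\overline{\mathrm{SAT}}_n(f)=1\iff\forall x,\ \mathrm{SAT}_{n-1}(f_x)=1$; $\mathrm{USAT}_n(f)=\{\mathrm{SAT}_n(f)\}$ if $|\{x:\overline{\mathrm{SAT}}_{n-1}(f_x)=1\}|\le1$, else $\Sigma$; $\overline{\mathrm{USAT}}_n(f)=\{\overline{\mathrm{SAT}}_n(f)\}$ if $|\{x:\mathrm{SAT}_{n-1}(f_x)=0\}|\le1$,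 else $\Sigma$; $\mathrm{UVAL}_n(f)=\{\pi_1x:\overline{\mathrm{SAT}}_{n-1}(f_x)=1\}$ if there is exactly one $x$ with $\overline{\mathrm{SAT}}_{n-1}(f_x)=1$, else $\Sigma$. -}

module Defs where

open import Data.Bool.Base using (Bool; true; false; not; _∧_; _∨_; if_then_else_)
open import Data.Bool.ListAction using (any; all)
open import Data.Fin.Base using (Fin; toℕ; fromℕ<)
import Data.Fin.Properties as Fin
open import Data.List.Base using (List; []; _∷_; _++_; map; length; filterᵇ)
open import Data.List.NonEmpty.Base as List⁺ using (List⁺; toList)
open import Data.Maybe.Base using (Maybe; just; nothing; _>>=_)
open import Data.Nat.Base using (ℕ; zero; suc; _+_; _*_; _^_; _≤_; _<_; _≤ᵇ_; NonZero)
open import Data.Nat.Properties using (_≟_; _<?_; nonZero?)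
open import Data.Product.Base using (Σ-syntax; ∃-syntax; _×_; _,_)
open import Data.Unit.Base using (⊤; tt)
open import Data.Vec.Base as Vec using (Vec; []; _∷_; lookup; replicate; zipWith)
open import Data.Vec.Relation.Unary.All as All using (All; []; _∷_)
open import Data.Vec.Relation.Unary.All.Properties using (lookup⁺)
open import Level using (0ℓ)
open import Relation.Binary.PropositionalEquality.Core using (_≡_)
open import Relation.Nullary.Decidable using (Dec; yes; no; _×-dec_)
open import Relation.Unary using (Pred)

------------------------------------------------------------------------
-- Multi-tape Turing machines over the tape alphabet {blank, 0, 1}

Cell : Set
Cell = Maybe Bool                       -- nothing is the blank

data Move : Set where
  left stay right : Move

-- A two-way infinite tape.  The cells on either side of the head are
-- listed starting from the one nearest to it; those not listed are blank.
record Tape : Set where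
  constructor tape
  field
    before : List Cell
    head   : Cell
    after  : List Cell

act : Cell × Move → Tape → Tape
act (c , left)  (tape []       _ rs)       = tape []       nothing (c ∷ rs)
act (c , left)  (tape (l ∷ ls) _ rs)       = tape ls       l       (c ∷ rs)
act (c , stay)  (tape ls       _ rs)       = tape ls       c       rs
act (c , right) (tape ls       _ [])       = tape (c ∷ ls) nothing []
act (c , right) (tape ls       _ (r ∷ rs)) = tape (c ∷ ls) r       rs

blankTape : Tape
blankTape = tape [] nothing []

inputTape : List⁺ Bool → Tape
inputTape (b List⁺.∷ bs) = tape [] (just b) (map just bs)

-- The word from the head rightwards up to the first blank.
untilBlank : List Cell → List Bool
untilBlank []             = []
untilBlank (nothing ∷ _)  = []
untilBlank (just b ∷ cs)  = b ∷ untilBlank cs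

outputWord : Tape → List Bool
outputWord (tape _ c rs) = untilBlank (c ∷ rs)

-- The machine halts when δ yields nothing.  The first tape carries both
-- the input and the output.
record TM : Set where
  field
    extraTapes : ℕ
    states     : ℕ
    start      : Fin states

  tapes : ℕ
  tapes = suc extraTapes

  field
    δ : Fin states → Vec Cell tapes → Maybe (Fin states × Vec (Cell × Move) tapes)

  Config : Set
  Config = Fin states × Vec Tape tapes

  init : List⁺ Bool → Config
  init x = start , inputTape x ∷ replicate extraTapes blankTape

  output : Config → List Bool
  output (_ , t ∷ _) = outputWord t

  step : Config → Maybe Config
  step (q , ts) = δ q (Vec.map Tape.head ts) >>= λ where
    (q′ , as) → just (q′ , zipWith act as ts)

  -- c ⇓[ t ] d : started in c, the machine halts in d after t steps.
  data _⇓[_]_ : Config → ℕ → Config → Set where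
    halted : ∀ {c} → step c ≡ nothing → c ⇓[ 0 ] c
    next   : ∀ {c c′ d t} → step c ≡ just c′ → c′ ⇓[ t ] d → c ⇓[ suc t ] d

-- Inputs are nonempty, so every polynomial in the input length is bounded
-- by some a * length ^ k.
PolyTime : (List⁺ Bool → List⁺ Bool) → Set
PolyTime μ =
  Σ[ M ∈ TM ] ∃[ a ] ∃[ k ] ∀ x → let open TM M in
    ∃[ t ] ∃[ d ] t ≤ a * List⁺.length x ^ k × init x ⇓[ t ] d × output d ≡ toList (μ x)

------------------------------------------------------------------------
-- Promise problems

-- The nonempty subsets of {0,1}.
data ℙ₊ : Set where
  ｛_｝ : Bool → ℙ₊
  full : ℙ₊

_∈_ : Bool → ℙ₊ → Set
b ∈ ｛ c ｝ = b ≡ c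
b ∈ full   = ⊤

_⊇_ : ℙ₊ → ℙ₊ → Set
A ⊇ B = ∀ b → b ∈ B → b ∈ A

PromiseProblem : Set
PromiseProblem = List⁺ Bool → ℙ₊

_∝_ : PromiseProblem → PromiseProblem → Set
φ₁ ∝ φ₂ = Σ[ μ ∈ (List⁺ Bool → List⁺ Bool) ] PolyTime μ × (∀ x → φ₁ x ⊇ φ₂ (μ x))

[_] : PromiseProblem → Pred PromiseProblem 0ℓ
[ φ ] φ₁ = φ₁ ∝ φ

------------------------------------------------------------------------
-- The level-n problems on functions Σ^{m₁} × … × Σ^{mₙ} → Σ

-- Elements of Σ^{m₁} × … × Σ^{mₙ}.
Blocks : ∀ {n} → Vec ℕ n → Set
Blocks ms = All (Vec Bool) ms

BoolFun : ∀ {n} → Vec ℕ n → Set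
BoolFun ms = Blocks ms → Bool

fix : ∀ {n m} {ms : Vec ℕ n} → BoolFun (m ∷ ms) → Vec Bool m → BoolFun ms
fix f x ys = f (x ∷ ys)

-- All elements of Σ^m, each listed once.
words : ∀ m → List (Vec Bool m)
words zero    = [] ∷ []
words (suc m) = map (false ∷_) (words m) ++ map (true ∷_) (words m)

mutual
  SAT : ∀ {n} {ms : Vec ℕ n} → BoolFun ms → Bool
  SAT {ms = []}     f = f []
  SAT {ms = m ∷ ms} f = any (λ x → coSAT (fix f x)) (words m)

  coSAT : ∀ {n} {ms : Vec ℕ n} → BoolFun ms → Bool
  coSAT {ms = []}     f = f []
  coSAT {ms = m ∷ ms} f = all (λ x → SAT (fix f x)) (words m)

-- The x with coSAT f_x = 1, and those with SAT f_x = 0.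
witnesses : ∀ {n m} {ms : Vec ℕ n} → BoolFun (m ∷ ms) → List (Vec Bool m)
witnesses {m = m} f = filterᵇ (λ x → coSAT (fix f x)) (words m)

counterexamples : ∀ {n m} {ms : Vec ℕ n} → BoolFun (m ∷ ms) → List (Vec Bool m)
counterexamples {m = m} f = filterᵇ (λ x → not (SAT (fix f x))) (words m)

π₁ : ∀ {m} .{{_ : NonZero m}} → Vec Bool m → Bool
π₁ (b ∷ _) = b

usat : ∀ {n m} {ms : Vec ℕ n} → BoolFun (m ∷ ms) → ℙ₊
usat f = if length (witnesses f) ≤ᵇ 1 then ｛ SAT f ｝ else full

cousat : ∀ {n m} {ms : Vec ℕ n} → BoolFun (m ∷ ms) → ℙ₊
cousat f = if length (counterexamples f) ≤ᵇ 1 then ｛ coSAT f ｝ else full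

uval : ∀ {n m} {ms : Vec ℕ n} .{{_ : NonZero m}} → BoolFun (m ∷ ms) → ℙ₊
uval f with witnesses f
... | x ∷ [] = ｛ π₁ x ｝
... | _      = full

------------------------------------------------------------------------
-- Boolean formulas

-- var i j is bit j of block i, both counted from 0.
data Formula : Set where
  var     : ℕ → ℕ → Formula
  bot     : Formula
  neg     : Formula → Formula
  and or  : Formula → Formula → Formula

InScope : ∀ {n} → Vec ℕ n → Formula → Set
InScope ms (var i j) = ∃[ b ] toℕ b ≡ i × j < lookup ms b
InScope ms bot       = ⊤
InScope ms (neg φ)   = InScope ms φ
InScope ms (and φ ψ) = InScope ms φ × InScope ms ψ
InScope ms (or φ ψ)  = InScope ms φ × InScope ms ψ

inScope? : ∀ {n} (ms : Vec ℕ n) φ → Dec (InScope ms φ)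
inScope? ms (var i j) = Fin.any? λ b → toℕ b ≟ i ×-dec j <? lookup ms b
inScope? ms bot       = yes tt
inScope? ms (neg φ)   = inScope? ms φ
inScope? ms (and φ ψ) = inScope? ms φ ×-dec inScope? ms ψ
inScope? ms (or φ ψ)  = inScope? ms φ ×-dec inScope? ms ψ

eval : ∀ {n} {ms : Vec ℕ n} φ → InScope ms φ → BoolFun ms
eval (var i j) (b , _ , j<m) xs = lookup (lookup⁺ xs b) (fromℕ< j<m)
eval bot       _             xs = false
eval (neg φ)   p             xs = not (eval φ p xs)
eval (and φ ψ) (p , q)       xs = eval φ p xs ∧ eval ψ q xs
eval (or φ ψ)  (p , q)       xs = eval φ p xs ∨ eval ψ q xs

record Instance (n : ℕ) : Set where
  field
    dims     : Vec ℕ n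
    positive : All NonZero dims
    formula  : Formula
    scoped   : InScope dims formula

------------------------------------------------------------------------
-- The encoding of instances
--
--   instance ::= formula number … number           (the n dimensions)
--   formula  ::= `x number number | `⊥ | `¬ formula
--              | `∧ formula formula | `∨ formula formula
--   number   ::= `# | `0 number | `1 number        (binary, least significant
--                                                   digit first)
--
-- Each symbol takes three bits.  The word is read from its right end,
-- keeping the list of numbers and formulas that follow the current position.

data Symbol : Set where
  `0 `1 `# `x `⊥ `¬ `∧ `∨ : Symbol

symbol : Bool → Bool → Bool → Symbol
symbol false false false = `0
symbol false false true  = `1
symbol false true  false = `#
symbol false true  true  = `x
symbol true  false false = `⊥
symbol true  false true  = `¬
symbol true  true  false = `∧
symbol true  true  true  = `∨

data Item : Set where
  num : ℕ → Item
  fml : Formula → Item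

push : Symbol → List Item → Maybe (List Item)
push `# st                     = just (num 0 ∷ st)
push `0 (num k ∷ st)           = just (num (2 * k) ∷ st)
push `1 (num k ∷ st)           = just (num (1 + 2 * k) ∷ st)
push `x (num i ∷ num j ∷ st)   = just (fml (var i j) ∷ st)
push `⊥ st                     = just (fml bot ∷ st)
push `¬ (fml φ ∷ st)           = just (fml (neg φ) ∷ st)
push `∧ (fml φ ∷ fml ψ ∷ st)   = just (fml (and φ ψ) ∷ st)
push `∨ (fml φ ∷ fml ψ ∷ st)   = just (fml (or φ ψ) ∷ st)
push _ _                       = nothing

parse : List Bool → Maybe (List Item)
parse []              = just []
parse (a ∷ b ∷ c ∷ w) = parse w >>= push (symbol a b c)
parse _               = nothing

numbers : ∀ n → List Item → Maybe (Vec ℕ n)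
numbers zero    []           = just []
numbers (suc n) (num k ∷ st) = numbers n st >>= λ ks → just (k ∷ ks)
numbers _       _            = nothing

build : ∀ {n} → Formula → Vec ℕ n → Maybe (Instance n)
build φ ms with All.all? nonZero? ms | inScope? ms φ
... | yes pos | yes sc = just record { dims = ms ; positive = pos ; formula = φ ; scoped = sc }
... | _       | _      = nothing

assemble : ∀ n → List Item → Maybe (Instance n)
assemble n (fml φ ∷ st) = numbers n st >>= build φ
assemble _ _            = nothing

decode : ∀ n → List⁺ Bool → Maybe (Instance n)
decode n w = parse (toList w) >>= assemble n

------------------------------------------------------------------------
-- USAT, its dual and UVAL as promise problems; nothing is promised about
-- words that do not encode an instance.

onInstances : ∀ {n} → (Instance n → ℙ₊) → Maybe (Instance n) → ℙ₊
onInstances F nothing  = full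
onInstances F (just I) = F I

usatI cousatI uvalI : ∀ {n} → Instance (suc n) → ℙ₊
usatI   record { dims = _ ∷ _ ; formula = φ ; scoped = sc } = usat (eval φ sc)
cousatI record { dims = _ ∷ _ ; formula = φ ; scoped = sc } = cousat (eval φ sc)
uvalI   record { dims = _ ∷ _ ; positive = m≢0 ∷ _ ; formula = φ ; scoped = sc } =
  uval {{m≢0}} (eval φ sc)

USAT coUSAT UVAL : ∀ n .{{_ : NonZero n}} → PromiseProblem
USAT   (suc n) w = onInstances usatI   (decode (suc n) w)
coUSAT (suc n) w = onInstances cousatI (decode (suc n) w)
UVAL   (suc n) w = onInstances uvalI   (decode (suc n) w)

{-# OPTIONS --safe #-}

-- UVAL reduces to USAT through x₁ ∧ f and to its dual through x₁ ∨ ¬ f: on a unique witness x of f,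
-- the first has a witness, and the second lacks a counterexample, exactly when x₁ = 1.  As formulas
-- are written in prefix notation, both reductions put a constant word in front of the input.
--
-- Conversely, let f = μ x be an instance of USAT and g = ν x one of its dual.  The instance
-- h (b x, y) = if b then f (x, y) else ¬ g (x, y) has one witness, and b is its answer, provided that
-- the bits of the first block that are not passed on are forced, here to equal b.  The bits of f and g
-- are placed at the odd positions, which in the encoding amounts to inserting a digit before every bit
-- index.  The first block of h has 2 s bits, where s is the number of symbols of f and g.  If the first
-- block of f has more than s bits, then one of them does not occur in f, so that f does not have
-- exactly one witness and the answer is 0; likewise for g, and then h is replaced by a constant instance.

module Submission where

open import Defs
open import Data.Nat.Base using (ℕ; NonZero)
open import Relation.Unary using (_≐_; _∩_)

open import Data.Bool.Base using (Bool; true; false; if_then_else_; not; _∧_; _∨_; _xor_; T)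
open import Data.Bool.ListAction using (any; all) renaming (and to and′; or to or′)
open import Data.Bool.Properties as Bool using (∧-identityʳ; ∧-zeroʳ; ∨-identityʳ; ∨-zeroʳ; not-¬; ¬-not; not-involutive; T-≡; T?)
open import Data.Empty using (⊥; ⊥-elim)
open import Data.Fin.Base as Fin using (Fin; toℕ; fromℕ<)
open import Data.Fin.Properties as Fin using (splitAt-join; remQuot-combine; toℕ<n; pigeonhole)
open import Data.List.Base as List using (List; []; _∷_; _++_; map; length; replicate; null; filterᵇ; _ʳ++_)
import Data.Nat.Properties
open import Data.List.Membership.DecPropositional Data.Nat.Properties._≟_ using (_∈?_)
open import Data.List.Membership.Propositional using (lose) renaming (_∈_ to _∈ˡ_)
open import Data.List.Membership.Propositional.Properties using (∈-++⁺ˡ; ∈-++⁺ʳ; ∈-map⁺; ∈-map⁻; ∈-filter⁺; ∈-filter⁻)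
open import Data.List.NonEmpty.Base as List⁺ using (List⁺; toList)
open import Data.List.Properties using (++-assoc; ++-identityʳ; ++-ʳ++; ʳ++-defn; ʳ++-ʳ++; length-++; length-map; length-replicate; length-ʳ++; map-++; map-cong; map-∘; map-ʳ++)
open import Data.List.Relation.Unary.All as All using (All; []; _∷_)
open import Data.List.Relation.Unary.All.Properties using (all⁺; all⁻)
open import Data.List.Relation.Unary.AllPairs using ([]; _∷_)
open import Data.List.Relation.Unary.Any as Any using (here)
open import Data.List.Relation.Unary.Any.Properties using (any⁺; any⁻; lookup-index)
open import Data.List.Relation.Unary.Unique.Propositional using (Unique)
import Data.List.Relation.Unary.Unique.Propositional.Properties as Unique
open import Data.Maybe.Base as Maybe using (Maybe; just; nothing; maybe′; is-just; _>>=_)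
open import Data.Nat.Base using (zero; suc; _+_; _*_; _^_; _≤_; _<_; z≤n; s≤s; s≤s⁻¹; z<s; s<s; _≤ᵇ_; nonZero; >-nonZero; >-nonZero⁻¹)
open import Data.Nat.Properties hiding (_≟_)
open import Data.Product.Base as Product using (∃-syntax; _×_; _,_; proj₁; proj₂)
open import Data.Sum.Base as Sum using (_⊎_; inj₁; inj₂)
open import Data.Unit.Base using (⊤; tt)
open import Data.Vec.Base as Vec using (Vec; []; _∷_; zipWith; lookup)
open import Data.Vec.Properties using (lookup-zipWith)
open import Data.Vec.Relation.Binary.Pointwise.Inductive using (Pointwise; []; _∷_)
open import Data.Vec.Relation.Unary.All as VAll using ([]; _∷_)
open import Data.Vec.Relation.Unary.All.Properties using (lookup⁺)
open import Function.Base using (_∘_; case_of_)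
open import Function.Bundles using (Equivalence)
open import Relation.Binary.PropositionalEquality using (_≡_; _≢_; refl; sym; trans; cong; cong₂; subst; subst₂; module ≡-Reasoning)
open import Relation.Nullary using (¬_; ¬?; yes; no; contradiction)
open import Relation.Nullary.Decidable using (decidable-stable)


-- Programs

-- Dimensions are written in binary, so a first block may have exponentially many bits, while every
-- forced bit costs clauses of its own; hence the cut at s. Later blocks are not forced: surplus
-- bits of a quantified block do not change the quantifier, so all these blocks get a numeral of s
-- ones as their dimension. Odd positions are chosen because numerals start with the least
-- significant digit: `1 + 2 * j` is the numeral of `j` with a 1 in front, a local change that takes
-- no arithmetic and leaves bit 0 free for b. Nor is s computed as a number: one row of s zeros is
-- the fuel of the loop, another its counter.
--
-- With the common answer 1, f has exactly one witness and g no counterexample; with 0, g has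
-- exactly one counterexample and f no witness. So h has one witness either way.
--
-- Much of the length is due to `PolyTime`, which asks for machines with three tape symbols. They
-- are compiled from programs over a larger alphabet, with sequencing, loops and branching, one
-- machine step for each program step.

record Finite (A : Set) : Set where
  field
    size          : ℕ
    index         : A → Fin size
    element       : Fin size → A
    element-index : ∀ a → element (index a) ≡ a

open Finite

Fin-finite : ∀ {n} → Finite (Fin n)
Fin-finite = record { index = λ i → i ; element = λ i → i ; element-index = λ _ → refl }

⊤-finite : Finite ⊤
⊤-finite = record { index = λ _ → Fin.zero {0} ; element = λ _ → tt ; element-index = λ _ → refl }

Bool-finite : Finite Bool
Bool-finite = record
  { size = 2
  ; index = λ { false → Fin.zero ; true → Fin.suc Fin.zero }
  ; element = λ { Fin.zero → false ; (Fin.suc Fin.zero) → true }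
  ; element-index = λ { false → refl ; true → refl }
  }

Maybe-finite : ∀ {A} → Finite A → Finite (Maybe A)
Maybe-finite F = record
  { size = suc (size F)
  ; index = maybe′ (Fin.suc ∘ index F) Fin.zero
  ; element = λ { Fin.zero → nothing ; (Fin.suc i) → just (element F i) }
  ; element-index = λ { nothing → refl ; (just a) → cong just (element-index F a) }
  }

⊎-finite : ∀ {A B} → Finite A → Finite B → Finite (A ⊎ B)
⊎-finite F G = record
  { size = size F + size G
  ; index = Fin.join _ _ ∘ Sum.map (index F) (index G)
  ; element = Sum.map (element F) (element G) ∘ Fin.splitAt (size F)
  ; element-index = λ a → trans (cong (Sum.map (element F) (element G)) (splitAt-join (size F) (size G) (Sum.map (index F) (index G) a))) (back a)
  }
  where
  back : ∀ a → Sum.map (element F) (element G) (Sum.map (index F) (index G) a) ≡ a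
  back (inj₁ a) = cong inj₁ (element-index F a)
  back (inj₂ b) = cong inj₂ (element-index G b)

-- Two inks let one tape hold a row of symbols directly followed by a row of bits, as when `strip`
-- leaves a formula followed by the digits of its first dimension; a head recognises the border by
-- the kind of cell.
data Ink : Set where
  digit  : Bool → Ink
  letter : Symbol → Ink

Γ : Set
Γ = Maybe Ink

pattern blank = nothing
pattern dig b = just (digit b)
pattern ltr σ = just (letter σ)

-- The cells left of the head, nearest first, and those from the head rightwards.  Moves do not
-- record blanks at the far ends, so that a tape is restored up to _≡_ when the head returns.
record Band : Set where
  constructor _⟨_
  field
    behind ahead : List Γ

open Band public

infix  4 _⟨_
infixr 5 _◂_

_◂_ : Γ → List Γ → List Γ
blank  ◂ []       = []
blank  ◂ (d ∷ cs) = blank ∷ d ∷ cs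
just i ◂ cs       = just i ∷ cs

hd : List Γ → Γ
hd []      = blank
hd (c ∷ _) = c

tl : List Γ → List Γ
tl []       = []
tl (_ ∷ cs) = cs

hd-◂ : ∀ c cs → hd (c ◂ cs) ≡ c
hd-◂ blank []      = refl
hd-◂ blank (_ ∷ _) = refl
hd-◂ (just _) _    = refl

tl-◂ : ∀ c cs → tl (c ◂ cs) ≡ cs
tl-◂ blank []      = refl
tl-◂ blank (_ ∷ _) = refl
tl-◂ (just _) _    = refl

-- `keep` does not name the scanned cell, so an idle tape need not be read, and
-- `perform (keep stay)` is the identity by computation, on which `merge-perform` relies.
data Action : Set where
  keep  : Move → Action
  write : Γ → Move → Action

move : Move → Band → Band
move left  (l ⟨ r) = tl l ⟨ hd l ◂ r
move stay  T       = T
move right (l ⟨ r) = hd r ◂ l ⟨ tl r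

perform : Action → Band → Band
perform (keep m)    T       = move m T
perform (write c m) (l ⟨ r) = move m (l ⟨ c ◂ tl r)

scan : Band → Γ
scan T = hd (ahead T)

record Machine (k : ℕ) : Set₁ where
  field
    State  : Set
    finite : Finite State
    start  : State
    δ      : State → Vec Γ k → Maybe (State × Vec Action k)

open Machine public

-- From state q, the machine halts within b steps.
infix 3 _⊢_▸_⇓[_]_
data _⊢_▸_⇓[_]_ {k} (M : Machine k) (q : State M) (Ts : Vec Band k) : ℕ → Vec Band k → Set where
  halt : ∀ {b} → δ M q (Vec.map scan Ts) ≡ nothing → M ⊢ q ▸ Ts ⇓[ b ] Ts
  next : ∀ {q′ as b Us} → δ M q (Vec.map scan Ts) ≡ just (q′ , as) →
         M ⊢ q′ ▸ zipWith perform as Ts ⇓[ b ] Us → M ⊢ q ▸ Ts ⇓[ suc b ] Us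

infix 3 _⊢_⇓[_]_
_⊢_⇓[_]_ : ∀ {k} → Machine k → Vec Band k → ℕ → Vec Band k → Set
M ⊢ Ts ⇓[ b ] Us = M ⊢ start M ▸ Ts ⇓[ b ] Us

module _ {k} {M : Machine k} where

  weaken : ∀ {q Ts Us b c} → b ≤ c → M ⊢ q ▸ Ts ⇓[ b ] Us → M ⊢ q ▸ Ts ⇓[ c ] Us
  weaken _         (halt e)   = halt e
  weaken (s≤s b≤c) (next e h) = next e (weaken b≤c h)

-- Sequencing, loops and branching

once : ∀ {k} → (Vec Γ k → Vec Action k) → Machine k
once f = record
  { State  = Bool
  ; finite = Bool-finite
  ; start  = true
  ; δ      = λ { true hs → just (false , f hs) ; false _ → nothing }
  }

once-run : ∀ {k} (f : Vec Γ k → Vec Action k) Ts →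
           once f ⊢ Ts ⇓[ 1 ] zipWith perform (f (Vec.map scan Ts)) Ts
once-run f Ts = next refl (halt refl)

module _ {k} (M N : Machine k) where

  -- The first move of N is made in the halting configuration of M.
  seqδ : State M ⊎ State N → Vec Γ k → Maybe ((State M ⊎ State N) × Vec Action k)
  seqδ (inj₁ q) hs with δ M q hs
  ... | just (q′ , as) = just (inj₁ q′ , as)
  ... | nothing        = Maybe.map (Product.map₁ inj₂) (δ N (start N) hs)
  seqδ (inj₂ q) hs = Maybe.map (Product.map₁ inj₂) (δ N q hs)

  infixr 6 _⨟_
  _⨟_ : Machine k
  _⨟_ = record
    { State  = State M ⊎ State N
    ; finite = ⊎-finite (finite M) (finite N)
    ; start  = inj₁ (start M)
    ; δ      = seqδ
    }

module _ {k} {M N : Machine k} where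

  private
    second : ∀ {q Ts Us b} → N ⊢ q ▸ Ts ⇓[ b ] Us → (M ⨟ N) ⊢ inj₂ q ▸ Ts ⇓[ b ] Us
    second (halt e)   = halt (cong (Maybe.map _) e)
    second (next e h) = next (cong (Maybe.map _) e) (second h)

    junction : ∀ {q Ts} → δ M q (Vec.map scan Ts) ≡ nothing →
               δ (M ⨟ N) (inj₁ q) (Vec.map scan Ts) ≡ δ (M ⨟ N) (inj₂ (start N)) (Vec.map scan Ts)
    junction {q} {Ts} e with δ M q (Vec.map scan Ts)
    junction refl | nothing = refl

    first : ∀ {q q′ Ts as} → δ M q (Vec.map scan Ts) ≡ just (q′ , as) →
            δ (M ⨟ N) (inj₁ q) (Vec.map scan Ts) ≡ just (inj₁ q′ , as)
    first {q} {Ts = Ts} e with δ M q (Vec.map scan Ts)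
    first refl | just _ = refl

    -- In a halting configuration of `M` the states `inj₁ q` and `inj₂ (start N)` have the same
    -- transition, so only the first step of the run is relabelled. The hand-over costs no step,
    -- whence the bound `a + b` in `_then_`.
    from-junction : ∀ {q Ts Us b} → δ M q (Vec.map scan Ts) ≡ nothing →
                    (M ⨟ N) ⊢ inj₂ (start N) ▸ Ts ⇓[ b ] Us → (M ⨟ N) ⊢ inj₁ q ▸ Ts ⇓[ b ] Us
    from-junction {Ts = Ts} e (halt e′)   = halt (trans (junction {Ts = Ts} e) e′)
    from-junction {Ts = Ts} e (next e′ h) = next (trans (junction {Ts = Ts} e) e′) h

    through : ∀ {q Ts Us Vs a b} → M ⊢ q ▸ Ts ⇓[ a ] Us → N ⊢ Us ⇓[ b ] Vs →
              (M ⨟ N) ⊢ inj₁ q ▸ Ts ⇓[ a + b ] Vs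
    through {Ts = Ts} {a = a} {b} (halt e) h = weaken (m≤n+m b a) (from-junction {Ts = Ts} e (second h))
    through {Ts = Ts} (next e h₁) h₂ = next (first {Ts = Ts} e) (through h₁ h₂)

  infixr 6 _then_
  _then_ : ∀ {Ts Us Vs a b} → M ⊢ Ts ⇓[ a ] Us → N ⊢ Us ⇓[ b ] Vs → (M ⨟ N) ⊢ Ts ⇓[ a + b ] Vs
  _then_ = through

module _ {k} (c : Vec Γ k → Bool) (M : Machine k) where

  -- The test is part of the first move of the body, at the start and again whenever the body halts,
  -- so that a loop costs no steps besides those of its bodies.
  testδ : Vec Γ k → Maybe (Maybe (State M) × Vec Action k)
  testδ hs = if c hs then Maybe.map (Product.map₁ just) (δ M (start M) hs) else nothing

  whileδ : Maybe (State M) → Vec Γ k → Maybe (Maybe (State M) × Vec Action k)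
  whileδ nothing  hs = testδ hs
  whileδ (just q) hs with δ M q hs
  ... | just (q′ , as) = just (just q′ , as)
  ... | nothing        = testδ hs

  while : Machine k
  while = record
    { State  = Maybe (State M)
    ; finite = Maybe-finite (finite M)
    ; start  = nothing
    ; δ      = whileδ
    }

module _ {k} {c : Vec Γ k → Bool} {M : Machine k} where

  while-stop : ∀ {Ts b} → c (Vec.map scan Ts) ≡ false → while c M ⊢ Ts ⇓[ b ] Ts
  while-stop {Ts} e = halt (cong (λ v → if v then Maybe.map (Product.map₁ just) (δ M (start M) (Vec.map scan Ts)) else nothing) e)

  private
    again : ∀ {q Ts} → δ M q (Vec.map scan Ts) ≡ nothing →
            δ (while c M) (just q) (Vec.map scan Ts) ≡ δ (while c M) nothing (Vec.map scan Ts)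
    again {q} {Ts} e with δ M q (Vec.map scan Ts)
    again refl | nothing = refl

    inside : ∀ {q q′ Ts as} → δ M q (Vec.map scan Ts) ≡ just (q′ , as) →
             δ (while c M) (just q) (Vec.map scan Ts) ≡ just (just q′ , as)
    inside {q} {Ts = Ts} e with δ M q (Vec.map scan Ts)
    inside refl | just _ = refl

    body : ∀ {q Ts Us Vs a b} → M ⊢ q ▸ Ts ⇓[ a ] Us → while c M ⊢ Us ⇓[ b ] Vs →
           while c M ⊢ just q ▸ Ts ⇓[ a + b ] Vs
    body {Ts = Ts} {a = a} (halt e) (halt e′)   = halt (trans (again {Ts = Ts} e) e′)
    body {Ts = Ts} {a = a} (halt e) h@(next {b = b} e′ h′) =
      weaken (m≤n+m (suc b) a) (next (trans (again {Ts = Ts} e) e′) h′)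
    body {Ts = Ts} (next e h₁) h₂ = next (inside {Ts = Ts} e) (body h₁ h₂)

    enter : ∀ {Ts} → c (Vec.map scan Ts) ≡ true →
            δ (while c M) nothing (Vec.map scan Ts) ≡ Maybe.map (Product.map₁ just) (δ M (start M) (Vec.map scan Ts))
    enter {Ts} e = cong (λ v → if v then Maybe.map (Product.map₁ just) (δ M (start M) (Vec.map scan Ts)) else nothing) e

  while-next : ∀ {Ts Us Vs a b} → c (Vec.map scan Ts) ≡ true →
               M ⊢ Ts ⇓[ a ] Us → while c M ⊢ Us ⇓[ b ] Vs → while c M ⊢ Ts ⇓[ a + b ] Vs
  -- A body without a move leaves `Us` equal to `Ts`, and then the remaining run is already the one
  -- claimed.
  while-next {a = a} {b} _ (halt _) h = weaken (m≤n+m b a) h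
  while-next {Ts} e (next e′ h₁) h₂ = next (trans (enter {Ts} e) (cong (Maybe.map _) e′)) (body h₁ h₂)

module _ {k} (c : Vec Γ k → Bool) (M N : Machine k) where

  choose : Vec Γ k → Maybe (Maybe (State M ⊎ State N) × Vec Action k)
  choose hs = if c hs then Maybe.map (Product.map₁ (just ∘ inj₁)) (δ M (start M) hs)
              else Maybe.map (Product.map₁ (just ∘ inj₂)) (δ N (start N) hs)

  branch : Machine k
  branch = record
    { State  = Maybe (State M ⊎ State N)
    ; finite = Maybe-finite (⊎-finite (finite M) (finite N))
    ; start  = nothing
    ; δ      = λ where
        nothing         hs → choose hs
        (just (inj₁ q)) hs → Maybe.map (Product.map₁ (just ∘ inj₁)) (δ M q hs)
        (just (inj₂ q)) hs → Maybe.map (Product.map₁ (just ∘ inj₂)) (δ N q hs)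
    }

module _ {k} {c : Vec Γ k → Bool} {M N : Machine k} where

  private
    in₁ : ∀ {q Ts Us b} → M ⊢ q ▸ Ts ⇓[ b ] Us → branch c M N ⊢ just (inj₁ q) ▸ Ts ⇓[ b ] Us
    in₁ (halt e)   = halt (cong (Maybe.map _) e)
    in₁ (next e h) = next (cong (Maybe.map _) e) (in₁ h)

    in₂ : ∀ {q Ts Us b} → N ⊢ q ▸ Ts ⇓[ b ] Us → branch c M N ⊢ just (inj₂ q) ▸ Ts ⇓[ b ] Us
    in₂ (halt e)   = halt (cong (Maybe.map _) e)
    in₂ (next e h) = next (cong (Maybe.map _) e) (in₂ h)

    pick : ∀ hs {v} → c hs ≡ v → choose c M N hs ≡
           (if v then Maybe.map (Product.map₁ (just ∘ inj₁)) (δ M (start M) hs)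
            else Maybe.map (Product.map₁ (just ∘ inj₂)) (δ N (start N) hs))
    pick hs e = cong (λ v → if v then _ else _) e

  branch-true : ∀ {Ts Us b} → c (Vec.map scan Ts) ≡ true → M ⊢ Ts ⇓[ b ] Us → branch c M N ⊢ Ts ⇓[ b ] Us
  branch-true {Ts} e (halt e′)   = halt (trans (pick _ e) (cong (Maybe.map _) e′))
  branch-true {Ts} e (next e′ h) = next (trans (pick _ e) (cong (Maybe.map _) e′)) (in₁ h)

  branch-false : ∀ {Ts Us b} → c (Vec.map scan Ts) ≡ false → N ⊢ Ts ⇓[ b ] Us → branch c M N ⊢ Ts ⇓[ b ] Us
  branch-false {Ts} e (halt e′)   = halt (trans (pick _ e) (cong (Maybe.map _) e′))
  branch-false {Ts} e (next e′ h) = next (trans (pick _ e) (cong (Maybe.map _) e′)) (in₂ h)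

-- Running a program on a selection of the tapes

infix 4 _⊑_
data _⊑_ : ℕ → ℕ → Set where
  done : 0 ⊑ 0
  use  : ∀ {m n} → m ⊑ n → suc m ⊑ suc n
  skip : ∀ {m n} → m ⊑ n → m ⊑ suc n

select : ∀ {A : Set} {m n} → m ⊑ n → Vec A n → Vec A m
select done     []       = []
select (use θ)  (x ∷ xs) = x ∷ select θ xs
select (skip θ) (x ∷ xs) = select θ xs

merge : ∀ {A : Set} {m n} → m ⊑ n → Vec A m → Vec A n → Vec A n
merge done     _        _        = []
merge (use θ)  (y ∷ ys) (_ ∷ xs) = y ∷ merge θ ys xs
merge (skip θ) ys       (x ∷ xs) = x ∷ merge θ ys xs

module _ {m n} (θ : m ⊑ n) where

  idle : ∀ {n} → Vec Action n
  idle = Vec.replicate _ (keep stay)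

  lift : Machine m → Machine n
  lift M = record
    { State  = State M
    ; finite = finite M
    ; start  = start M
    ; δ      = λ q hs → Maybe.map (Product.map₂ (λ as → merge θ as idle)) (δ M q (select θ hs))
    }

select-map : ∀ {A B : Set} {m n} (f : A → B) (θ : m ⊑ n) xs → select θ (Vec.map f xs) ≡ Vec.map f (select θ xs)
select-map f done     []       = refl
select-map f (use θ)  (x ∷ xs) = cong (f x ∷_) (select-map f θ xs)
select-map f (skip θ) (x ∷ xs) = select-map f θ xs

select-perform : ∀ {m n} (θ : m ⊑ n) as (Ts : Vec Band n) →
                 select θ (zipWith perform (merge θ as (Vec.replicate _ (keep stay))) Ts) ≡ zipWith perform as (select θ Ts)
select-perform done     []       []       = refl
select-perform (use θ)  (a ∷ as) (T ∷ Ts) = cong (perform a T ∷_) (select-perform θ as Ts)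
select-perform (skip θ) as       (T ∷ Ts) = select-perform θ as Ts

merge-perform : ∀ {m n} (θ : m ⊑ n) as Us (Ts : Vec Band n) →
                merge θ Us (zipWith perform (merge θ as (Vec.replicate _ (keep stay))) Ts) ≡ merge θ Us Ts
merge-perform done     _        _        []       = refl
merge-perform (use θ)  (a ∷ as) (U ∷ Us) (T ∷ Ts) = cong (U ∷_) (merge-perform θ as Us Ts)
merge-perform (skip θ) as       Us       (T ∷ Ts) = cong (T ∷_) (merge-perform θ as Us Ts)

merge-select : ∀ {A : Set} {m n} (θ : m ⊑ n) (Ts : Vec A n) → merge θ (select θ Ts) Ts ≡ Ts
merge-select done     []       = refl
merge-select (use θ)  (T ∷ Ts) = cong (T ∷_) (merge-select θ Ts)
merge-select (skip θ) (T ∷ Ts) = cong (T ∷_) (merge-select θ Ts)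

module _ {m n} (θ : m ⊑ n) {M : Machine m} where

  lift-run : ∀ {q Us b} Ts → M ⊢ q ▸ select θ Ts ⇓[ b ] Us → lift θ M ⊢ q ▸ Ts ⇓[ b ] merge θ Us Ts
  -- The index `select θ Ts` is replaced by a variable with an equation, because after a step the
  -- selected tapes are the selection of the new ones only up to `select-perform`.
  lift-run Ts h = go Ts h refl
    where
    go : ∀ {q Us b Ss} Ts → M ⊢ q ▸ Ss ⇓[ b ] Us → Ss ≡ select θ Ts → lift θ M ⊢ q ▸ Ts ⇓[ b ] merge θ Us Ts
    go {q} Ts (halt e) refl = subst (lift θ M ⊢ q ▸ Ts ⇓[ _ ]_) (sym (merge-select θ Ts))
      (halt (cong (Maybe.map _) (trans (cong (δ M q) (select-map scan θ Ts)) e)))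
    go {q} {Us} Ts (next {as = as} e h) refl =
      next (cong (Maybe.map _) (trans (cong (δ M q) (select-map scan θ Ts)) e))
        (subst (lift θ M ⊢ _ ▸ _ ⇓[ _ ]_) (merge-perform θ as Us Ts)
          (go _ h (sym (select-perform θ as Ts))))

-- Programs and Turing machines

nth : {A : Set} → A → List A → ℕ → A
nth d []       _       = d
nth d (x ∷ xs) zero    = x
nth d (x ∷ xs) (suc i) = nth d xs i

nth-◂ : ∀ c cs i → nth blank (c ◂ cs) i ≡ nth blank (c ∷ cs) i
nth-◂ blank    []      zero    = refl
nth-◂ blank    []      (suc i) = refl
nth-◂ blank    (_ ∷ _) _       = refl
nth-◂ (just _) _       _       = refl

nth-tl : ∀ cs i → nth blank (tl cs) i ≡ nth blank cs (suc i)
nth-tl []      i = refl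
nth-tl (_ ∷ _) i = refl

nth-hd : ∀ cs → hd cs ≡ nth blank cs 0
nth-hd []      = refl
nth-hd (_ ∷ _) = refl

-- Cells are compared position by position with blank as the default, because a `Tape` lists blanks
-- that a `Band` omits, so that the two lists may differ in length. The relation is a parameter: it
-- serves for each of the three tracks and for `Copy`.
module Similarity (_∼_ : Γ → Cell → Set) (blank∼ : blank ∼ nothing) where

  infix 4 _≋_ _≈_
  record _≋_ (cs : List Γ) (ds : List Cell) : Set where
    constructor cellwise
    field
      cell : ∀ i → nth blank cs i ∼ nth nothing ds i

  open _≋_ public

  record _≈_ (T : Band) (t : Tape) : Set where
    constructor _﹠_
    field
      behind≋ : behind T ≋ Tape.before t
      ahead≋  : ahead T ≋ Tape.head t ∷ Tape.after t

  open _≈_ public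

  private
    tl≋ : ∀ {cs d ds} → cs ≋ d ∷ ds → tl cs ≋ ds
    tl≋ {cs} p .cell i = subst (_∼ _) (sym (nth-tl cs i)) (cell p (suc i))

    ◂≋ : ∀ {c d cs ds} → c ∼ d → cs ≋ ds → c ◂ cs ≋ d ∷ ds
    ◂≋ {c} {cs = cs} p q .cell zero    = subst (_∼ _) (sym (nth-◂ c cs 0)) p
    ◂≋ {c} {cs = cs} p q .cell (suc i) = subst (_∼ _) (sym (nth-◂ c cs (suc i))) (q .cell i)

    hd∼ : ∀ {cs d ds} → cs ≋ d ∷ ds → hd cs ∼ d
    hd∼ {cs} p = subst (_∼ _) (sym (nth-hd cs)) (cell p 0)

    explicit : ∀ {cs} → cs ≋ [] → cs ≋ nothing ∷ []
    explicit p .cell zero    = cell p 0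
    explicit p .cell (suc i) = cell p (suc i)

  scan∼head : ∀ {T t} → T ≈ t → scan T ∼ Tape.head t
  scan∼head p = hd∼ (ahead≋ p)

  move-act : ∀ m {l r ls h d rs} → l ≋ ls → r ≋ d ∷ rs → move m (l ⟨ r) ≈ act (d , m) (tape ls h rs)
  move-act left  {ls = []}    p q = tl≋ (explicit p) ﹠ ◂≋ (hd∼ (explicit p)) q
  move-act left  {ls = _ ∷ _} p q = tl≋ p ﹠ ◂≋ (hd∼ p) q
  move-act stay  p q = p ﹠ q
  move-act right {rs = []}    p q = ◂≋ (hd∼ q) p ﹠ explicit (tl≋ q)
  move-act right {rs = _ ∷ _} p q = ◂≋ (hd∼ q) p ﹠ tl≋ q

  keep≈ : ∀ m {T t} → T ≈ t → perform (keep m) T ≈ act (Tape.head t , m) t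
  keep≈ m (p ﹠ q) = move-act m p q

  write≈ : ∀ m {c d T t} → c ∼ d → T ≈ t → perform (write c m) T ≈ act (d , m) t
  write≈ m c∼d (p ﹠ q) = move-act m p (◂≋ c∼d (tl≋ q))

-- A cell of a program is stored in three cells: a bit only in the first of them.
bitsOf : Symbol → Bool × Bool × Bool
bitsOf `0 = false , false , false
bitsOf `1 = false , false , true
bitsOf `# = false , true  , false
bitsOf `x = false , true  , true
bitsOf `⊥ = true  , false , false
bitsOf `¬ = true  , false , true
bitsOf `∧ = true  , true  , false
bitsOf `∨ = true  , true  , true

symbol-bitsOf : ∀ σ → let a , b , c = bitsOf σ in symbol a b c ≡ σ
symbol-bitsOf `0 = refl
symbol-bitsOf `1 = refl
symbol-bitsOf `# = refl
symbol-bitsOf `x = refl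
symbol-bitsOf `⊥ = refl
symbol-bitsOf `¬ = refl
symbol-bitsOf `∧ = refl
symbol-bitsOf `∨ = refl

-- A digit uses the first track only, so that the input and output tape of the compiled machine
-- holds the plain word. A letter fills all three tracks, which is how `decodeCell` tells the two
-- apart.
encode : Γ → Cell × Cell × Cell
encode blank   = nothing , nothing , nothing
encode (dig b) = just b , nothing , nothing
encode (ltr σ) = let a , b , c = bitsOf σ in just a , just b , just c

decodeCell : Cell × Cell × Cell → Γ
decodeCell (just a , just b , just c) = ltr (symbol a b c)
decodeCell (just a , _)               = dig a
decodeCell (nothing , _)              = blank

decode-encode : ∀ c → decodeCell (encode c) ≡ c
decode-encode blank   = refl
decode-encode (dig b) = refl
decode-encode (ltr σ) = cong (λ σ → ltr σ) (symbol-bitsOf σ)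

track₁ track₂ track₃ : Γ → Cell
track₁ = proj₁ ∘ encode
track₂ = proj₁ ∘ proj₂ ∘ encode
track₃ = proj₂ ∘ proj₂ ∘ encode

module Track₁ = Similarity (λ c d → track₁ c ≡ d) refl
module Track₂ = Similarity (λ c d → track₂ c ≡ d) refl
module Track₃ = Similarity (λ c d → track₃ c ≡ d) refl

data Tracks : ∀ {k} → Vec Band k → Vec Tape (k * 3) → Set where
  []  : Tracks [] []
  _∷_ : ∀ {k T t₁ t₂ t₃ Ts ts} → T Track₁.≈ t₁ × T Track₂.≈ t₂ × T Track₃.≈ t₃ →
        Tracks {k} Ts ts → Tracks (T ∷ Ts) (t₁ ∷ t₂ ∷ t₃ ∷ ts)

decodeAll : ∀ {k} → Vec Cell (k * 3) → Vec Γ k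
decodeAll {zero}  []               = []
decodeAll {suc k} (a ∷ b ∷ c ∷ cs) = decodeCell (a , b , c) ∷ decodeAll cs

encodeAll : ∀ {k} → Vec Action k → Vec Cell (k * 3) → Vec (Cell × Move) (k * 3)
encodeAll []               []               = []
encodeAll (keep m    ∷ as) (a ∷ b ∷ c ∷ cs) = (a , m) ∷ (b , m) ∷ (c , m) ∷ encodeAll as cs
encodeAll (write g m ∷ as) (_ ∷ _ ∷ _ ∷ cs) =
  (track₁ g , m) ∷ (track₂ g , m) ∷ (track₃ g , m) ∷ encodeAll as cs

decodeAll-heads : ∀ {k} {Ts : Vec Band k} {ts} → Tracks Ts ts →
                  decodeAll (Vec.map Tape.head ts) ≡ Vec.map scan Ts
decodeAll-heads [] = refl
decodeAll-heads {Ts = T ∷ _} ((p₁ , p₂ , p₃) ∷ ps) = cong₂ _∷_ cell≡ (decodeAll-heads ps)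
  where
  cell≡ = trans (cong decodeCell (cong₂ _,_ (sym (Track₁.scan∼head p₁))
           (cong₂ _,_ (sym (Track₂.scan∼head p₂)) (sym (Track₃.scan∼head p₃)))))
           (decode-encode (scan T))

Tracks-act : ∀ {k} (as : Vec Action k) {Ts ts} → Tracks Ts ts →
             Tracks (zipWith perform as Ts) (zipWith act (encodeAll as (Vec.map Tape.head ts)) ts)
Tracks-act [] [] = []
Tracks-act (keep m ∷ as) {T ∷ _} ((p₁ , p₂ , p₃) ∷ ps) =
  (Track₁.keep≈ m p₁ , Track₂.keep≈ m p₂ , Track₃.keep≈ m p₃) ∷ Tracks-act as ps
Tracks-act (write g m ∷ as) {T ∷ _} ((p₁ , p₂ , p₃) ∷ ps) =
  (Track₁.write≈ m {g} refl p₁ , Track₂.write≈ m {g} refl p₂ , Track₃.write≈ m {g} refl p₃)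
    ∷ Tracks-act as ps

module _ {k} (M : Machine (suc k)) where

  compile : TM
  compile = record
    { extraTapes = 2 + k * 3
    ; states     = size (finite M)
    ; start      = index (finite M) (start M)
    ; δ          = λ q cs →
        Maybe.map (λ { (q′ , as) → index (finite M) q′ , encodeAll as cs })
          (δ M (element (finite M) q) (decodeAll {suc k} cs))
    }

  private module C = TM compile

  compile-δ : ∀ q {Ts} {ts} → Tracks Ts ts →
              C.δ (index (finite M) q) (Vec.map Tape.head ts) ≡
              Maybe.map (λ { (q′ , as) → index (finite M) q′ , encodeAll as (Vec.map Tape.head ts) })
                (δ M q (Vec.map scan Ts))
  compile-δ q {Ts} {ts} ps = cong (Maybe.map _)
    (cong₂ (δ M) (element-index (finite M) q) (decodeAll-heads ps))

  compile-run : ∀ {q Ts b Us ts} → M ⊢ q ▸ Ts ⇓[ b ] Us → Tracks Ts ts →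
                ∃[ t ] ∃[ q′ ] ∃[ us ] t ≤ b × (index (finite M) q , ts) C.⇓[ t ] (q′ , us) × Tracks Us us
  compile-run {q} {ts = ts} (halt e) ps =
    0 , index (finite M) q , ts , z≤n ,
    TM.halted (cong (_>>= _) (trans (compile-δ q ps) (cong (Maybe.map _) e))) , ps
  compile-run {q} {ts = ts} (next {as = as} e h) ps =
    let t , q′ , us , t≤b , run , qs = compile-run h (Tracks-act as ps) in
    suc t , q′ , us , s≤s t≤b ,
    TM.next (cong (_>>= _) (trans (compile-δ q ps) (cong (Maybe.map _) e))) run , qs

digits : List Bool → List Γ
digits = map (λ b → dig b)

untilBlank-digits : ∀ w {rest cs} → hd rest ≡ blank → digits w ++ rest Track₁.≋ cs → untilBlank cs ≡ w
untilBlank-digits []      {rest} {[]}           e p = refl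
untilBlank-digits []      {rest} {nothing ∷ _}  e p = refl
untilBlank-digits []      {rest} {just _ ∷ _}   e p =
  case trans (cong track₁ (sym e)) (trans (cong track₁ (nth-hd rest)) (Track₁.cell p 0)) of λ ()
untilBlank-digits (b ∷ w) {cs = []}          e p = case Track₁.cell p 0 of λ ()
untilBlank-digits (b ∷ w) {cs = nothing ∷ _} e p = case Track₁.cell p 0 of λ ()
untilBlank-digits (b ∷ w) {cs = just _ ∷ _}  e p with refl ← Track₁.cell p 0 =
  cong (b ∷_) (untilBlank-digits w e (Track₁.cellwise λ i → Track₁.cell p (suc i)))

emptyBand : Band
emptyBand = [] ⟨ []

Tracks-init : ∀ (x : List⁺ Bool) k →
              Tracks (([] ⟨ digits (toList x)) ∷ Vec.replicate k emptyBand) (inputTape x ∷ Vec.replicate (2 + k * 3) blankTape)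
Tracks-init (b List⁺.∷ bs) k =
  ((Track₁.cellwise (λ _ → refl) Track₁.﹠ Track₁.cellwise λ { zero → refl ; (suc i) → first bs i })
  , (Track₂.cellwise (λ _ → refl) Track₂.﹠ Track₂.cellwise λ { zero → refl ; (suc i) → second bs i })
  , (Track₃.cellwise (λ _ → refl) Track₃.﹠ Track₃.cellwise λ { zero → refl ; (suc i) → third bs i }))
  ∷ blanks k
  where
  none : ∀ i → nth nothing (nothing ∷ []) i ≡ nothing {A = Bool}
  none zero    = refl
  none (suc i) = refl
  first : ∀ bs i → track₁ (nth blank (digits bs) i) ≡ nth nothing (map just bs) i
  first []       i       = refl
  first (b ∷ bs) zero    = refl
  first (b ∷ bs) (suc i) = first bs i
  second : ∀ bs i → track₂ (nth blank (digits bs) i) ≡ nothing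
  second []       i       = refl
  second (b ∷ bs) zero    = refl
  second (b ∷ bs) (suc i) = second bs i
  third : ∀ bs i → track₃ (nth blank (digits bs) i) ≡ nothing
  third []       i       = refl
  third (b ∷ bs) zero    = refl
  third (b ∷ bs) (suc i) = third bs i
  empty : ∀ i → nothing ≡ nth nothing (nothing {A = Bool} ∷ []) i
  empty i = sym (none i)
  blanks : ∀ k → Tracks (Vec.replicate k emptyBand) (Vec.replicate (k * 3) blankTape)
  blanks zero    = []
  blanks (suc k) = ((Track₁.cellwise (λ _ → refl) Track₁.﹠ Track₁.cellwise empty) , (Track₂.cellwise (λ _ → refl) Track₂.﹠ Track₂.cellwise empty) , (Track₃.cellwise (λ _ → refl) Track₃.﹠ Track₃.cellwise empty)) ∷ blanks k

-- Polynomial bounds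

Poly : (ℕ → ℕ) → Set
Poly f = ∃[ a ] ∃[ k ] ∀ n .{{_ : NonZero n}} → f n ≤ a * n ^ k

poly-const : ∀ c → Poly (λ _ → c)
poly-const c = c , 0 , λ n → ≤-reflexive (sym (*-identityʳ c))

poly-id : Poly (λ n → n)
poly-id = 1 , 1 , λ n → ≤-reflexive (sym (trans (*-identityˡ (n ^ 1)) (*-identityʳ n)))

poly-^ : ∀ a k → Poly (λ n → a * n ^ k)
poly-^ a k = a , k , λ n → ≤-refl

infixl 6 _⊹_
-- Both terms are raised to the exponent `k + l`, which is monotone because `n` is nonzero.
_⊹_ : ∀ {f g} → Poly f → Poly g → Poly (λ n → f n + g n)
_⊹_ {f} {g} (a , k , p) (b , l , q) = a + b , k + l , λ n → begin
  f n + g n                         ≤⟨ +-mono-≤ (p n) (q n) ⟩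
  a * n ^ k + b * n ^ l             ≤⟨ +-mono-≤ (*-monoʳ-≤ a (^-monoʳ-≤ n (m≤m+n k l))) (*-monoʳ-≤ b (^-monoʳ-≤ n (m≤n+m l k))) ⟩
  a * n ^ (k + l) + b * n ^ (k + l) ≡⟨ *-distribʳ-+ (n ^ (k + l)) a b ⟨
  (a + b) * n ^ (k + l)             ∎
  where open ≤-Reasoning

infixl 7 _⊗_
_⊗_ : ∀ {f g} → Poly f → Poly g → Poly (λ n → f n * g n)
_⊗_ {f} {g} (a , k , p) (b , l , q) = a * b , k + l , λ n → begin
  f n * g n                   ≤⟨ *-mono-≤ (p n) (q n) ⟩
  (a * n ^ k) * (b * n ^ l)   ≡⟨ [m*n]*[o*p]≡[m*o]*[n*p] a (n ^ k) b (n ^ l) ⟩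
  (a * b) * (n ^ k * n ^ l)   ≡⟨ cong (a * b *_) (^-distribˡ-+-* n k l) ⟨
  (a * b) * n ^ (k + l)       ∎
  where open ≤-Reasoning

-- The cells after the output may hold remnants of the work, provided that a blank comes first:
-- there the output of a `TM` ends.
Computes : ∀ {k} → Machine (suc k) → (ℕ → ℕ) → (List⁺ Bool → List⁺ Bool) → Set
Computes {k} M B μ = ∀ x → ∃[ l ] ∃[ rest ] ∃[ Us ] hd rest ≡ blank ×
  M ⊢ ([] ⟨ digits (toList x)) ∷ Vec.replicate k emptyBand ⇓[ B (List⁺.length x) ]
      (l ⟨ digits (toList (μ x)) ++ rest) ∷ Us

polyTime : ∀ {k} {M : Machine (suc k)} {B μ} → Poly B → Computes M B μ → PolyTime μ
polyTime {k} {M} {B} {μ} (a , e , bound) run = compile M , a , e , result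
  where
  result : ∀ x → let open TM (compile M) in
           ∃[ t ] ∃[ d ] t ≤ a * List⁺.length x ^ e × init x ⇓[ t ] d × output d ≡ toList (μ x)
  result x with run x
  ... | l , rest , Us , blank-rest , h with compile-run M h (Tracks-init x k)
  ...   | t , q , t₁ ∷ us , t≤ , run′ , ((p₁ , _) ∷ ps) =
    t , (q , t₁ ∷ us) , ≤-trans t≤ (bound (List⁺.length x)) , run′ ,
    untilBlank-digits (toList (μ x)) {cs = Tape.head t₁ ∷ Tape.after t₁} blank-rest (Track₁.ahead≋ p₁)

-- Turing machines as programs

ι : Cell → Γ
ι nothing  = blank
ι (just b) = dig b

reading : Γ → Cell
reading (dig b) = just b
reading _       = nothing

reading-ι : ∀ c → reading (ι c) ≡ c
reading-ι nothing  = refl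
reading-ι (just b) = refl

module Copy = Similarity (λ c d → c ≡ ι d) refl

data Copies : ∀ {k} → Vec Band k → Vec Tape k → Set where
  []  : Copies [] []
  _∷_ : ∀ {k T t Ts ts} → T Copy.≈ t → Copies {k} Ts ts → Copies (T ∷ Ts) (t ∷ ts)

imitate : Cell × Move → Action
imitate (c , m) = write (ι c) m

Copies-act : ∀ {k} (as : Vec (Cell × Move) k) {Ts ts} → Copies Ts ts →
             Copies (zipWith perform (Vec.map imitate as) Ts) (zipWith act as ts)
Copies-act []             []               = []
Copies-act ((c , m) ∷ as) (p ∷ ps) = Copy.write≈ m refl p ∷ Copies-act as ps

Copies-heads : ∀ {k} {Ts : Vec Band k} {ts} → Copies Ts ts → Vec.map reading (Vec.map scan Ts) ≡ Vec.map Tape.head ts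
Copies-heads []                 = refl
Copies-heads (p ∷ ps) =
  cong₂ _∷_ (trans (cong reading (Copy.scan∼head p)) (reading-ι _)) (Copies-heads ps)

module _ (M : TM) where
  private module M = TM M

  embed : Machine M.tapes
  embed = record
    { finite = Fin-finite
    ; start  = M.start
    ; δ      = λ q cs → Maybe.map (Product.map₂ (Vec.map imitate)) (M.δ q (Vec.map reading cs))
    }

  private
    unstep : ∀ q ts {c} → M.step (q , ts) ≡ just c →
             ∃[ q′ ] ∃[ as ] M.δ q (Vec.map Tape.head ts) ≡ just (q′ , as) × c ≡ (q′ , zipWith act as ts)
    unstep q ts e with M.δ q (Vec.map Tape.head ts)
    unstep q ts refl | just (q′ , as) = q′ , as , refl , refl

    unhalt : ∀ q ts → M.step (q , ts) ≡ nothing → M.δ q (Vec.map Tape.head ts) ≡ nothing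
    unhalt q ts e with M.δ q (Vec.map Tape.head ts)
    ... | nothing = refl

  embed-run : ∀ {q ts t q′ us Ts} → (q , ts) M.⇓[ t ] (q′ , us) → Copies Ts ts →
              ∃[ Us ] embed ⊢ q ▸ Ts ⇓[ t ] Us × Copies Us us
  embed-run {q} {ts} {Ts = Ts} (TM.halted e) ps =
    Ts , halt (cong (Maybe.map _) (trans (cong (M.δ q) (Copies-heads ps)) (unhalt q ts e))) , ps
  embed-run {q} {ts} (TM.next e h) ps with unstep q ts e
  ... | q′ , as , e′ , refl with embed-run h (Copies-act as ps)
  ...   | Us , run , qs = Us , next (cong (Maybe.map _) (trans (cong (M.δ q) (Copies-heads ps)) e′)) run , qs

Copies-init : ∀ (x : List⁺ Bool) k →
              Copies (([] ⟨ digits (toList x)) ∷ Vec.replicate k emptyBand) (inputTape x ∷ Vec.replicate k blankTape)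
Copies-init (b List⁺.∷ bs) k =
  (Copy.cellwise (λ _ → refl) Copy.﹠ Copy.cellwise λ { zero → refl ; (suc i) → first bs i }) ∷ blanks k
  where
  first : ∀ bs i → nth blank (digits bs) i ≡ ι (nth nothing (map just bs) i)
  first []       i       = refl
  first (b ∷ bs) zero    = refl
  first (b ∷ bs) (suc i) = first bs i
  blanks : ∀ k → Copies (Vec.replicate k emptyBand) (Vec.replicate k blankTape)
  blanks zero    = []
  blanks (suc k) = (Copy.cellwise (λ _ → refl) Copy.﹠ Copy.cellwise λ { zero → refl ; (suc i) → refl }) ∷ blanks k

ahead-output : ∀ cs {ds} → cs Copy.≋ ds → ∃[ rest ] hd rest ≡ blank × cs ≡ digits (untilBlank ds) ++ rest
ahead-output cs       {[]}         p = cs , trans (nth-hd cs) (Copy.cell p 0) , refl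
ahead-output cs       {nothing ∷ _} p = cs , trans (nth-hd cs) (Copy.cell p 0) , refl
ahead-output []       {just _ ∷ _} p = case Copy.cell p 0 of λ ()
ahead-output (c ∷ cs) {just b ∷ ds} p with rest , e , e′ ← ahead-output cs {ds} (Copy.cellwise λ i → Copy.cell p (suc i)) =
  rest , e , cong₂ _∷_ (Copy.cell p 0) e′

-- The space a program can use

extent : Band → ℕ
extent T = length (behind T) + length (ahead T)

private
  length-◂ : ∀ c cs → length (c ◂ cs) ≤ suc (length cs)
  length-◂ blank    []      = z≤n
  length-◂ blank    (_ ∷ _) = ≤-refl
  length-◂ (just _) cs      = ≤-refl

  length-tl : ∀ (cs : List Γ) → length (tl cs) ≤ length cs
  length-tl []       = z≤n
  length-tl (_ ∷ cs) = n≤1+n _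

extent-move : ∀ m T → extent (move m T) ≤ suc (extent T)
extent-move left (l ⟨ r) = begin
  length (tl l) + length (hd l ◂ r) ≤⟨ +-mono-≤ (length-tl l) (length-◂ (hd l) r) ⟩
  length l + suc (length r)         ≡⟨ +-suc (length l) (length r) ⟩
  suc (length l + length r)         ∎
  where open ≤-Reasoning
extent-move stay  T       = n≤1+n _
extent-move right (l ⟨ r) = +-mono-≤ (length-◂ (hd r) l) (length-tl r)

extent-perform : ∀ a T → extent (perform a T) ≤ 2 + extent T
extent-perform (keep m)    T       = m≤n⇒m≤1+n (extent-move m T)
extent-perform (write c m) (l ⟨ r) = ≤-trans (extent-move m (l ⟨ c ◂ tl r)) (s≤s (begin
  length l + length (c ◂ tl r) ≤⟨ +-monoʳ-≤ (length l) (≤-trans (length-◂ c (tl r)) (s≤s (length-tl r))) ⟩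
  length l + suc (length r)    ≡⟨ +-suc (length l) (length r) ⟩
  suc (length l + length r)    ∎))
  where open ≤-Reasoning

-- A step lengthens a tape by at most 2, one cell for writing and one for moving. This bounds the
-- words returned by simulated machines, and later the combined word, by the time spent on them.
extent-run : ∀ {k} {M : Machine k} {q Ts b Us} → M ⊢ q ▸ Ts ⇓[ b ] Us →
             ∀ i → extent (Vec.lookup Us i) ≤ extent (Vec.lookup Ts i) + 2 * b
extent-run (halt _) i = m≤m+n _ _
extent-run {Ts = Ts} {Us = Us} (next {as = as} {b = b} e h) i = begin
  extent (Vec.lookup Us i)                             ≤⟨ extent-run h i ⟩
  extent (Vec.lookup (zipWith perform as Ts) i) + 2 * b ≡⟨ cong (λ S → extent S + 2 * b) (lookup-zipWith perform i as Ts) ⟩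
  extent (perform (Vec.lookup as i) S) + 2 * b         ≤⟨ +-monoˡ-≤ (2 * b) (extent-perform (Vec.lookup as i) S) ⟩
  2 + extent S + 2 * b                                 ≡⟨ cong (_+ 2 * b) (+-comm 2 (extent S)) ⟩
  extent S + 2 + 2 * b                                 ≡⟨ +-assoc (extent S) 2 (2 * b) ⟩
  extent S + (2 + 2 * b)                               ≡⟨ cong (extent S +_) (*-distribˡ-+ 2 1 b) ⟨
  extent S + 2 * suc b                                 ∎
  where
  open ≤-Reasoning
  S = Vec.lookup Ts i

-- Elementary programs

×-finite : ∀ {A B} → Finite A → Finite B → Finite (A × B)
×-finite F G = record
  { size = size F * size G
  ; index = λ (a , b) → Fin.combine (index F a) (index G b)
  ; element = Product.map (element F) (element G) ∘ Fin.remQuot (size G)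
  ; element-index = λ (a , b) → trans
      (cong (Product.map (element F) (element G)) (remQuot-combine (index F a) (index G b)))
      (cong₂ _,_ (element-index F a) (element-index G b))
  }

stop : ∀ {k} → Machine k
stop = record { State = ⊤ ; finite = ⊤-finite ; start = tt ; δ = λ _ _ → nothing }

memoryless : ∀ {k} → (Vec Γ k → Maybe (Vec Action k)) → Machine k
memoryless f = record
  { State = ⊤ ; finite = ⊤-finite ; start = tt ; δ = λ _ hs → Maybe.map (tt ,_) (f hs) }

letters : List Symbol → List Γ
letters = map (λ σ → ltr σ)

Inked : List Γ → Set
Inked = All (λ c → is-just c ≡ true)

digits-inked : ∀ bs → Inked (digits bs)
digits-inked []       = []
digits-inked (b ∷ bs) = refl ∷ digits-inked bs

letters-inked : ∀ σs → Inked (letters σs)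
letters-inked []       = []
letters-inked (σ ∷ σs) = refl ∷ letters-inked σs

ʳ++-inked : ∀ {xs ys} → Inked xs → Inked ys → Inked (xs ʳ++ ys)
ʳ++-inked []       q = q
ʳ++-inked (p ∷ ps) q = ʳ++-inked ps (p ∷ q)

-- The head stands on the first cell of ρ, which lists cells leftwards; r lies right of it.
standing : List Γ → List Γ → Band
standing ρ r = tl ρ ⟨ hd ρ ◂ r

right-standing : ∀ ρ r → perform (keep right) (standing ρ r) ≡ (hd ρ ◂ tl ρ ⟨ r)
right-standing ρ r rewrite hd-◂ (hd ρ) r | tl-◂ (hd ρ) r = refl

comeHome : Machine 1
comeHome = record
  { State = Bool ; finite = Bool-finite ; start = true
  ; δ = λ { true (just _ ∷ _) → just (true , keep left ∷ [])
          ; true (blank ∷ _)  → just (false , keep right ∷ [])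
          ; false _           → nothing }
  }

comeHome-run : ∀ {ρ} r → Inked ρ → comeHome ⊢ standing ρ r ∷ [] ⇓[ suc (length ρ) ] ([] ⟨ ρ ʳ++ r) ∷ []
comeHome-run []      []                       = next refl (halt refl)
comeHome-run (_ ∷ _) []                       = next refl (halt refl)
comeHome-run r       (_∷_ {x = just _} p ps) = next refl (comeHome-run (_ ∷ r) ps)

home : Machine 1
home = once (λ _ → keep left ∷ []) ⨟ comeHome

home-run : ∀ {ρ} r → Inked ρ → home ⊢ (ρ ⟨ r) ∷ [] ⇓[ 2 + length ρ ] ([] ⟨ ρ ʳ++ r) ∷ []
home-run r ps = once-run _ _ then comeHome-run r ps

copy : Machine 2
copy = memoryless λ { (dig b ∷ _) → just (keep right ∷ write (dig b) right ∷ []) ; _ → nothing }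

copy-run : ∀ x l l′ → copy ⊢ (l ⟨ digits x) ∷ (l′ ⟨ []) ∷ [] ⇓[ length x ] (digits x ʳ++ l ⟨ []) ∷ (digits x ʳ++ l′ ⟨ []) ∷ []
copy-run []      l l′ = halt refl
copy-run (b ∷ x) l l′ = next refl (copy-run x (dig b ∷ l) (dig b ∷ l′))

-- Defined on every word, although `parse` accepts only lengths divisible by three: a machine has to
-- produce something on words that encode nothing, where there is no promise to keep.
chunk : List Bool → List Symbol
chunk (a ∷ b ∷ c ∷ w) = symbol a b c ∷ chunk w
chunk _               = []

zeros : ℕ → List Bool
zeros k = replicate k false

-- Besides its letter, each triple leaves one zero on two further tapes. After both words have been
-- read these hold s zeros each, the fuel and the initial counter of the loop.
chunker : Machine 4
chunker = record
  { State = Maybe (Bool × Maybe Bool)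
  ; finite = Maybe-finite (×-finite Bool-finite (Maybe-finite Bool-finite)) ; start = nothing
  ; δ = λ where
      nothing             (dig a ∷ _) → just (just (a , nothing) , keep right ∷ keep stay ∷ keep stay ∷ keep stay ∷ [])
      (just (a , nothing)) (dig b ∷ _) → just (just (a , just b) , keep right ∷ keep stay ∷ keep stay ∷ keep stay ∷ [])
      (just (a , just b)) (dig c ∷ _) →
        just (nothing , keep right ∷ write (ltr (symbol a b c)) right ∷ write (dig false) right ∷ write (dig false) right ∷ [])
      _ _ → nothing
  }

chunker-run : ∀ w {l s e c rest} → hd rest ≡ blank →
  chunker ⊢ (l ⟨ digits w ++ rest) ∷ (s ⟨ []) ∷ (e ⟨ []) ∷ (c ⟨ []) ∷ [] ⇓[ length w ]
    (digits w ʳ++ l ⟨ rest) ∷ (letters (chunk w) ʳ++ s ⟨ []) ∷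
    (digits (zeros (length (chunk w))) ʳ++ e ⟨ []) ∷ (digits (zeros (length (chunk w))) ʳ++ c ⟨ []) ∷ []
chunker-run []              e = halt (cong (λ h → δ chunker nothing (h ∷ _)) e)
chunker-run (a ∷ [])        e = next refl (halt (cong (λ h → δ chunker (just (a , nothing)) (h ∷ _)) e))
chunker-run (a ∷ b ∷ [])    e = next refl (next refl (halt (cong (λ h → δ chunker (just (a , just b)) (h ∷ _)) e)))
chunker-run (a ∷ b ∷ c ∷ w) e = next refl (next refl (next refl (chunker-run w e)))

isHash : Symbol → Bool
isHash `# = true
isHash _  = false

dropNumber : List Symbol → List Symbol
dropNumber []      = []
dropNumber (σ ∷ ρ) = if isHash σ then ρ else dropNumber ρ

-- The symbols come in reverse, so `dropNumber` stops just after a hash, with the digits of that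
-- number still to come; the next call removes them along with the following hash. With as many
-- calls as dimensions, what is left begins with the digits of the first dimension, followed by the
-- reversed formula.
dropNumbers : ℕ → List Symbol → List Symbol
dropNumbers zero    ρ = ρ
dropNumbers (suc n) ρ = dropNumber (dropNumbers n ρ)

eraseNumber : Machine 1
eraseNumber = record
  { State = Bool ; finite = Bool-finite ; start = true
  ; δ = λ { true (ltr σ ∷ _) → just (not (isHash σ) , write blank left ∷ []) ; _ _ → nothing }
  }

eraseNumber-run : ∀ ρ → eraseNumber ⊢ standing (letters ρ) [] ∷ [] ⇓[ length ρ ] standing (letters (dropNumber ρ)) [] ∷ []
eraseNumber-run []      = halt refl
eraseNumber-run (σ ∷ ρ) with isHash σ in e
... | true  = next (cong (λ b → just (not b , _)) e) (halt refl)
... | false = next (cong (λ b → just (not b , _)) e) (eraseNumber-run ρ)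

length-dropNumber : ∀ ρ → length (dropNumber ρ) ≤ length ρ
length-dropNumber []      = z≤n
length-dropNumber (σ ∷ ρ) with isHash σ
... | true  = n≤1+n _
... | false = m≤n⇒m≤1+n (length-dropNumber ρ)

length-dropNumbers : ∀ n ρ → length (dropNumbers n ρ) ≤ length ρ
length-dropNumbers zero    ρ = ≤-refl
length-dropNumbers (suc n) ρ = ≤-trans (length-dropNumber (dropNumbers n ρ)) (length-dropNumbers n ρ)

eraseNumbers : ℕ → Machine 1
eraseNumbers zero    = stop
eraseNumbers (suc n) = eraseNumbers n ⨟ eraseNumber

eraseNumbers-run : ∀ n ρ → eraseNumbers n ⊢ standing (letters ρ) [] ∷ [] ⇓[ n * length ρ ] standing (letters (dropNumbers n ρ)) [] ∷ []
eraseNumbers-run zero    ρ = halt refl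
eraseNumbers-run (suc n) ρ = weaken (≤-reflexive (+-comm (n * length ρ) (length ρ)))
  (eraseNumbers-run n ρ then weaken (length-dropNumbers n ρ) (eraseNumber-run (dropNumbers n ρ)))

digitOf : Symbol → Maybe Bool
digitOf `0 = just false
digitOf `1 = just true
digitOf _  = nothing

takeDigits : List Symbol → List Bool → List Symbol × List Bool
takeDigits []      ds = [] , ds
takeDigits (σ ∷ ρ) ds with digitOf σ
... | just b  = takeDigits ρ (b ∷ ds)
... | nothing = σ ∷ ρ , ds

markDigits : Machine 1
markDigits = memoryless λ { (ltr σ ∷ _) → Maybe.map (λ b → write (dig b) left ∷ []) (digitOf σ) ; _ → nothing }

markDigits-run : ∀ ρ ds → let ρ′ , ds′ = takeDigits ρ ds in
  markDigits ⊢ standing (letters ρ) (digits ds) ∷ [] ⇓[ length ρ ] standing (letters ρ′) (digits ds′) ∷ []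
markDigits-run []      []      = halt refl
markDigits-run []      (_ ∷ _) = halt refl
markDigits-run (σ ∷ ρ) ds with digitOf σ in e
... | just b  = next (cong (Maybe.map (tt ,_) ∘ Maybe.map (λ b → write (dig b) left ∷ [])) e) (markDigits-run ρ (b ∷ ds))
... | nothing = halt (cong (Maybe.map (tt ,_) ∘ Maybe.map (λ b → write (dig b) left ∷ [])) e)

length-takeDigits : ∀ ρ ds → length (proj₁ (takeDigits ρ ds)) ≤ length ρ
length-takeDigits []      ds = z≤n
length-takeDigits (σ ∷ ρ) ds with digitOf σ
... | just b  = m≤n⇒m≤1+n (length-takeDigits ρ (b ∷ ds))
... | nothing = ≤-refl

-- The formula of an instance with n dimensions, and the digits of its first dimension.
formulaPart : ℕ → List Symbol → List Symbol
formulaPart n σs = proj₁ (takeDigits (dropNumbers n (σs ʳ++ [])) []) ʳ++ []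

firstDimension : ℕ → List Symbol → List Bool
firstDimension n σs = proj₂ (takeDigits (dropNumbers n (σs ʳ++ [])) [])

strip : ℕ → Machine 1
strip n = once (λ _ → keep left ∷ []) ⨟ eraseNumbers n ⨟ markDigits ⨟ comeHome

strip-run : ∀ n σs {N} → length σs ≤ N →
  strip n ⊢ (letters σs ʳ++ [] ⟨ []) ∷ [] ⇓[ 1 + (n * N + (N + suc N)) ]
    ([] ⟨ letters (formulaPart n σs) ++ digits (firstDimension n σs)) ∷ []
strip-run n σs {N} σs≤N =
  subst₂ (λ l r → strip n ⊢ (l ⟨ []) ∷ [] ⇓[ 1 + (n * N + (N + suc N)) ] ([] ⟨ r) ∷ []) (map-ʳ++ (λ σ → ltr σ) σs) shape
    (once-run _ _ then weaken (*-monoʳ-≤ n ρ≤N) (eraseNumbers-run n ρ)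
      then weaken ρ′≤N (markDigits-run (dropNumbers n ρ) [])
      then weaken (s≤s (≤-trans (≤-reflexive (length-map _ ρ″)) (≤-trans (length-takeDigits (dropNumbers n ρ) []) ρ′≤N)))
        (comeHome-run (digits (firstDimension n σs)) (letters-inked ρ″)))
  where
  ρ  = σs ʳ++ []
  ρ″ = proj₁ (takeDigits (dropNumbers n ρ) [])
  ρ≤N : length ρ ≤ N
  ρ≤N = ≤-trans (≤-reflexive (trans (length-ʳ++ σs) (+-identityʳ _))) σs≤N
  ρ′≤N = ≤-trans (length-dropNumbers n ρ) ρ≤N
  shape : letters ρ″ ʳ++ digits (firstDimension n σs) ≡ letters (ρ″ ʳ++ []) ++ digits (firstDimension n σs)
  shape = trans (ʳ++-defn′ (letters ρ″)) (cong (_++ digits (firstDimension n σs)) (sym (map-ʳ++ (λ σ → ltr σ) ρ″)))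
    where
    ʳ++-defn′ : ∀ xs {ys : List Γ} → xs ʳ++ ys ≡ (xs ʳ++ []) ++ ys
    ʳ++-defn′ xs {ys} = trans (ʳ++-defn xs) (cong (_++ ys) (sym (trans (ʳ++-defn xs) (++-identityʳ _))))

infixl 5 _⊲_
_⊲_ : List Γ → List Symbol → List Γ
o ⊲ σs = letters σs ʳ++ o

⊲-++ : ∀ o σs τs → o ⊲ (σs ++ τs) ≡ o ⊲ σs ⊲ τs
⊲-++ o σs τs = trans (cong (_ʳ++ o) (map-++ _ σs τs)) (++-ʳ++ (letters σs))

emit : List Symbol → Machine 1
emit []       = stop
emit (σ ∷ σs) = once (λ _ → write (ltr σ) right ∷ []) ⨟ emit σs

emit-run : ∀ σs o → emit σs ⊢ (o ⟨ []) ∷ [] ⇓[ length σs ] (o ⊲ σs ⟨ []) ∷ []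
emit-run []       o = halt refl
emit-run (σ ∷ σs) o = once-run _ _ then emit-run σs (ltr σ ∷ o)

-- Sends var i j to var i (1 + 2 * j); the flag says that the next number is the second of its pair.
double : Bool → List Symbol → List Symbol
double q []       = []
double q (σ ∷ σs) = σ ∷ (if isHash σ then (if q then double false σs else `1 ∷ double true σs) else double q σs)

-- The state `nothing` is entered after the first number of a pair: there the extra 1 is written, as
-- the new lowest digit of the bit index. Each symbol takes at most two steps.
doubler : Machine 2
doubler = record
  { State = Maybe Bool ; finite = Maybe-finite Bool-finite ; start = just false
  ; δ = λ where
      (just q) (ltr σ ∷ _) → just ((if isHash σ then (if q then just false else nothing) else just q)
                                  , keep right ∷ write (ltr σ) right ∷ [])
      nothing  _           → just (just true , keep stay ∷ write (ltr `1) right ∷ [])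
      _ _                  → nothing
  }

doubler-run : ∀ σs ds l o → doubler ⊢ (l ⟨ letters σs ++ digits ds) ∷ (o ⟨ []) ∷ [] ⇓[ length σs * 2 ]
                              (letters σs ʳ++ l ⟨ digits ds) ∷ (o ⊲ double false σs ⟨ []) ∷ []
doubler-run σs ds l o = go false σs l o
  where
  go : ∀ q σs l o → doubler ⊢ just q ▸ (l ⟨ letters σs ++ digits ds) ∷ (o ⟨ []) ∷ [] ⇓[ length σs * 2 ]
         (letters σs ʳ++ l ⟨ digits ds) ∷ (o ⊲ double q σs ⟨ []) ∷ []
  go q [] l o = halt (end ds)
    where
    end : ∀ ds {c} → δ doubler (just q) (hd (digits ds) ∷ c ∷ []) ≡ nothing
    end []      = refl
    end (_ ∷ _) = refl
  go q (σ ∷ σs) l o with isHash σ in e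
  go q     (σ ∷ σs) l o | false = next (cong (λ b → just ((if b then (if q then just false else nothing) else just q) , keep right ∷ write (ltr σ) right ∷ [])) e) (weaken (n≤1+n _) (go q σs _ _))
  go q@true  (σ ∷ σs) l o | true  = next (cong (λ b → just ((if b then (if q then just false else nothing) else just q) , keep right ∷ write (ltr σ) right ∷ [])) e) (weaken (n≤1+n _) (go false σs _ _))
  go q@false (σ ∷ σs) l o | true  = next (cong (λ b → just ((if b then (if q then just false else nothing) else just q) , keep right ∷ write (ltr σ) right ∷ [])) e) (next refl (go true σs _ _))

printRow : (Bool → Symbol) → Machine 2
printRow g = memoryless λ { (dig b ∷ _) → just (keep right ∷ write (ltr (g b)) right ∷ []) ; _ → nothing }

print : (Bool → Symbol) → Machine 2
print g = printRow g ⨟ lift (use (skip done)) home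

print-run : ∀ g c o {N} → length c ≤ N → print g ⊢ ([] ⟨ digits c) ∷ (o ⟨ []) ∷ [] ⇓[ N + (2 + N) ] ([] ⟨ digits c) ∷ (o ⊲ map g c ⟨ []) ∷ []
print-run g c o {N} c≤N =
  subst (λ C → print g ⊢ ([] ⟨ digits c) ∷ (o ⟨ []) ∷ [] ⇓[ N + (2 + N) ] ([] ⟨ C) ∷ (o ⊲ map g c ⟨ []) ∷ []) (trans (ʳ++-ʳ++ (digits c)) (++-identityʳ _))
    (weaken c≤N (go c [] o) then weaken (s≤s (s≤s ρ≤N)) (lift-run (use (skip done)) (_ ∷ _ ∷ []) (home-run [] (ʳ++-inked (digits-inked c) []))))
  where
  ρ≤N : length (digits c ʳ++ []) ≤ N
  ρ≤N = ≤-trans (≤-reflexive (trans (length-ʳ++ (digits c)) (trans (+-identityʳ _) (length-map _ c)))) c≤N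
  go : ∀ c l o → printRow g ⊢ (l ⟨ digits c) ∷ (o ⟨ []) ∷ [] ⇓[ length c ] (digits c ʳ++ l ⟨ []) ∷ (o ⊲ map g c ⟨ []) ∷ []
  go []      l o = halt refl
  go (b ∷ c) l o = next refl (go c (dig b ∷ l) (ltr (g b) ∷ o))

-- The loop writing the constraints, and the output

-- A blank counts as the digit 0: as the lowest digit comes first, a dimension shorter than the
-- counter is padded with zeros at its high end. Registers use the same convention for `false`.
value : Γ → Bool
value (dig b) = b
value _       = false

same : Bool → Γ → Bool
same x c = not (x xor value c)

eqDigits : Bool → List Bool → List Γ → Bool
eqDigits e []      r = e
eqDigits e (x ∷ c) r = eqDigits (e ∧ same x (hd r)) c (tl r)

-- `k` is the carry. The carry out of the last digit is dropped, which keeps the length fixed; hence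
-- the hypothesis of `val-increment`.
increment : Bool → List Bool → List Bool
increment k []      = []
increment k (x ∷ c) = (x xor k) ∷ increment (k ∧ x) c

length-increment : ∀ k c → length (increment k c) ≡ length c
length-increment k []      = refl
length-increment k (x ∷ c) = cong suc (length-increment (k ∧ x) c)

register : Bool → Band
register b = [] ⟨ (if b then dig true ∷ [] else [])

mark : Bool → Action
mark e = if e then write (dig true) stay else keep stay

mark-register : ∀ e b → perform (mark e) (register b) ≡ register (b ∨ e)
mark-register false false = refl
mark-register false true  = refl
mark-register true  false = refl
mark-register true  true  = refl

value-register : ∀ b → value (scan (register b)) ≡ b
value-register false = refl
value-register true  = refl

advance retreat : ℕ → Band → Band
advance zero    T = T
advance (suc k) T = advance k (move right T)
retreat zero    T = T
retreat (suc k) T = retreat k (move left T)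

retreat-left : ∀ k T → retreat k (move left T) ≡ move left (retreat k T)
retreat-left zero    T = refl
retreat-left (suc k) T = retreat-left k (move left T)

left-right : ∀ l ds → move left (move right (l ⟨ digits ds)) ≡ (l ⟨ digits ds)
left-right l []       rewrite hd-◂ blank l | tl-◂ blank l = refl
left-right l (d ∷ ds) = refl

retreat-advance : ∀ k l ds → retreat k (advance k (l ⟨ digits ds)) ≡ (l ⟨ digits ds)
retreat-advance zero    l ds       = refl
retreat-advance (suc k) l []       = trans (retreat-left k _)
  (trans (cong (move left) (retreat-advance k (blank ◂ l) [])) (left-right l []))
retreat-advance (suc k) l (d ∷ ds) = trans (retreat-left k _)
  (cong (move left) (retreat-advance k (dig d ∷ l) ds))

-- One sweep adds 1 to the counter, with carry `k`, and compares the new digits with both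
-- dimensions. A register once set stays set, so that it tells whether the counter has reached the
-- dimension.
compare : Machine 5
compare = record
  { State  = Maybe (Bool × Bool × Bool)
  ; finite = Maybe-finite (×-finite Bool-finite (×-finite Bool-finite Bool-finite))
  ; start  = just (true , true , true)
  ; δ      = λ where
      (just (k , e₁ , e₂)) (s₁ ∷ s₂ ∷ dig x ∷ _) →
        just (just (k ∧ x , e₁ ∧ same (x xor k) s₁ , e₂ ∧ same (x xor k) s₂)
             , keep right ∷ keep right ∷ write (dig (x xor k)) right ∷ keep stay ∷ keep stay ∷ [])
      (just (k , e₁ , e₂)) _ → just (nothing , keep stay ∷ keep stay ∷ keep stay ∷ mark e₁ ∷ mark e₂ ∷ [])
      nothing              _ → nothing
  }

compare-run : ∀ c {k e₁ e₂ S₁ S₂ l r₁ r₂} →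
  compare ⊢ just (k , e₁ , e₂) ▸ S₁ ∷ S₂ ∷ (l ⟨ digits c) ∷ register r₁ ∷ register r₂ ∷ [] ⇓[ suc (length c) ]
    advance (length c) S₁ ∷ advance (length c) S₂ ∷ (digits (increment k c) ʳ++ l ⟨ []) ∷
    register (r₁ ∨ eqDigits e₁ (increment k c) (ahead S₁)) ∷ register (r₂ ∨ eqDigits e₂ (increment k c) (ahead S₂)) ∷ []
compare-run [] {e₁ = e₁} {e₂} {r₁ = r₁} {r₂} = next refl
  (subst₂ (λ R₁ R₂ → compare ⊢ nothing ▸ _ ∷ _ ∷ _ ∷ R₁ ∷ R₂ ∷ [] ⇓[ 0 ] _ ∷ _ ∷ _ ∷ register (r₁ ∨ e₁) ∷ register (r₂ ∨ e₂) ∷ [])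
    (sym (mark-register e₁ r₁)) (sym (mark-register e₂ r₂)) (halt refl))
compare-run (x ∷ c) = next refl (compare-run c)

sweepBack : Machine 3
sweepBack = memoryless λ { (_ ∷ _ ∷ just _ ∷ []) → just (keep left ∷ keep left ∷ keep left ∷ []) ; _ → nothing }

sweepBack-run : ∀ {ρ} r S₁ S₂ → Inked ρ → sweepBack ⊢ S₁ ∷ S₂ ∷ standing ρ r ∷ [] ⇓[ length ρ ]
  retreat (length ρ) S₁ ∷ retreat (length ρ) S₂ ∷ standing [] (ρ ʳ++ r) ∷ []
sweepBack-run []      S₁ S₂ []                      = halt refl
sweepBack-run (_ ∷ _) S₁ S₂ []                      = halt refl
sweepBack-run r       S₁ S₂ (_∷_ {x = just _} p ps) = next refl (sweepBack-run (_ ∷ r) (move left S₁) (move left S₂) ps)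

back : Machine 3
back = once (λ _ → keep stay ∷ keep stay ∷ keep left ∷ []) ⨟ sweepBack ⨟ once (λ _ → keep stay ∷ keep stay ∷ keep right ∷ [])

back-run : ∀ {ρ} S₁ S₂ → Inked ρ → back ⊢ S₁ ∷ S₂ ∷ (ρ ⟨ []) ∷ [] ⇓[ 1 + (length ρ + 1) ]
  retreat (length ρ) S₁ ∷ retreat (length ρ) S₂ ∷ ([] ⟨ ρ ʳ++ []) ∷ []
back-run {ρ} S₁ S₂ ps =
  subst (λ C → back ⊢ S₁ ∷ S₂ ∷ (ρ ⟨ []) ∷ [] ⇓[ 1 + (length ρ + 1) ] retreat (length ρ) S₁ ∷ retreat (length ρ) S₂ ∷ C ∷ [])
    (right-standing [] (ρ ʳ++ []))
    (once-run _ _ then sweepBack-run [] S₁ S₂ ps then once-run _ _)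

tick : Machine 5
tick = compare ⨟ lift (use (use (use (skip (skip done))))) back

tick-run : ∀ c l₁ ds₁ l₂ ds₂ r₁ r₂ → let c′ = increment true c in
  tick ⊢ (l₁ ⟨ digits ds₁) ∷ (l₂ ⟨ digits ds₂) ∷ ([] ⟨ digits c) ∷ register r₁ ∷ register r₂ ∷ []
    ⇓[ suc (length c) + (1 + (length c + 1)) ]
    (l₁ ⟨ digits ds₁) ∷ (l₂ ⟨ digits ds₂) ∷ ([] ⟨ digits c′) ∷
    register (r₁ ∨ eqDigits true c′ (digits ds₁)) ∷ register (r₂ ∨ eqDigits true c′ (digits ds₂)) ∷ []
tick-run c l₁ ds₁ l₂ ds₂ r₁ r₂ = compare-run c then finish
  where
  c′  = increment true c
  ρ   = digits c′ ʳ++ []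
  len : length ρ ≡ length c
  len = trans (length-ʳ++ (digits c′)) (trans (+-identityʳ _) (trans (length-map _ c′) (length-increment true c)))
  R₁ = register (r₁ ∨ eqDigits true c′ (digits ds₁))
  R₂ = register (r₂ ∨ eqDigits true c′ (digits ds₂))
  θ : 3 ⊑ 5
  θ = use (use (use (skip (skip done))))
  A₁ = advance (length c) (l₁ ⟨ digits ds₁)
  A₂ = advance (length c) (l₂ ⟨ digits ds₂)
  raw : lift θ back ⊢ A₁ ∷ A₂ ∷ (ρ ⟨ []) ∷ R₁ ∷ R₂ ∷ [] ⇓[ 1 + (length ρ + 1) ]
          retreat (length ρ) A₁ ∷ retreat (length ρ) A₂ ∷ ([] ⟨ ρ ʳ++ []) ∷ R₁ ∷ R₂ ∷ []
  raw = lift-run θ (A₁ ∷ A₂ ∷ (ρ ⟨ []) ∷ R₁ ∷ R₂ ∷ []) (back-run A₁ A₂ (ʳ++-inked (digits-inked c′) []))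
  finish : lift θ back ⊢ A₁ ∷ A₂ ∷ (ρ ⟨ []) ∷ R₁ ∷ R₂ ∷ [] ⇓[ 1 + (length c + 1) ]
             (l₁ ⟨ digits ds₁) ∷ (l₂ ⟨ digits ds₂) ∷ ([] ⟨ digits c′) ∷ R₁ ∷ R₂ ∷ []
  finish with raw
  ... | h rewrite len | retreat-advance (length c) l₁ ds₁ | retreat-advance (length c) l₂ ds₂
                | ʳ++-ʳ++ (digits c′) {[]} {[]} | ++-identityʳ (digits c′) = h

digitSymbol : Bool → Symbol
digitSymbol false = `0
digitSymbol true  = `1

put : (Bool → Bool → Bool) → Machine 3
put g = once λ { (_ ∷ r₁ ∷ r₂ ∷ []) → write (ltr (digitSymbol (g (value r₁) (value r₂)))) right ∷ keep stay ∷ keep stay ∷ [] }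

put-run : ∀ g o r₁ r₂ → put g ⊢ (o ⟨ []) ∷ register r₁ ∷ register r₂ ∷ [] ⇓[ 1 ]
            (o ⊲ (digitSymbol (g r₁ r₂) ∷ []) ⟨ []) ∷ register r₁ ∷ register r₂ ∷ []
put-run g o r₁ r₂ = subst₂ (λ v₁ v₂ → put g ⊢ (o ⟨ []) ∷ register r₁ ∷ register r₂ ∷ [] ⇓[ 1 ]
    (o ⊲ (digitSymbol (g v₁ v₂) ∷ []) ⟨ []) ∷ register r₁ ∷ register r₂ ∷ [])
  (value-register r₁) (value-register r₂) (once-run _ _)

clauseWord : List Symbol → Bool → List Bool → List Symbol
clauseWord pre d c = pre ++ (digitSymbol d ∷ []) ++ map digitSymbol c ++ (`# ∷ [])

onPen : 1 ⊑ 4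
onPen = skip (use (skip (skip done)))

penRegisters : 3 ⊑ 4
penRegisters = skip (use (use (use done)))

counterPen : 2 ⊑ 4
counterPen = use (use (skip (skip done)))

clause : List Symbol → (Bool → Bool → Bool) → Machine 4
clause pre g = lift onPen (emit pre) ⨟ lift penRegisters (put g) ⨟
  lift counterPen (print digitSymbol) ⨟ lift onPen (emit (`# ∷ []))

clauseTime : ℕ → ℕ → ℕ
clauseTime k N = k + (1 + ((N + (2 + N)) + 1))

clause-run : ∀ pre g c o r₁ r₂ {N} → length c ≤ N →
  clause pre g ⊢ ([] ⟨ digits c) ∷ (o ⟨ []) ∷ register r₁ ∷ register r₂ ∷ [] ⇓[ clauseTime (length pre) N ]
    ([] ⟨ digits c) ∷ (o ⊲ clauseWord pre (g r₁ r₂) c ⟨ []) ∷ register r₁ ∷ register r₂ ∷ []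
clause-run pre g c o r₁ r₂ {N} c≤N =
  subst (λ p → clause pre g ⊢ ([] ⟨ digits c) ∷ (o ⟨ []) ∷ register r₁ ∷ register r₂ ∷ [] ⇓[ clauseTime (length pre) N ]
      ([] ⟨ digits c) ∷ (p ⟨ []) ∷ register r₁ ∷ register r₂ ∷ []) (sym shape)
    (lift-run onPen _ (emit-run pre o)
      then lift-run penRegisters _ (put-run g (o ⊲ pre) r₁ r₂)
      then lift-run counterPen _ (print-run digitSymbol c _ c≤N)
      then lift-run onPen _ (emit-run (`# ∷ []) _))
  where
  shape : o ⊲ clauseWord pre (g r₁ r₂) c ≡ o ⊲ pre ⊲ (digitSymbol (g r₁ r₂) ∷ []) ⊲ map digitSymbol c ⊲ (`# ∷ [])
  shape = trans (⊲-++ o pre _) (⊲-++ _ (map digitSymbol c) (`# ∷ []))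

-- The prefixes, up to the digits of k, of (b → xₖ) ∧ … and (¬ b → ¬ xₖ) ∧ …, where b is bit 0 of block 0.
positive negative : List Symbol
positive = `∧ ∷ `∨ ∷ `¬ ∷ `x ∷ `# ∷ `# ∷ `x ∷ `# ∷ []
negative = `∧ ∷ `∨ ∷ `x ∷ `# ∷ `# ∷ `¬ ∷ `x ∷ `# ∷ []

-- The extra lowest digit makes the index `2 * c` or `1 + 2 * c`. The first two clauses force the
-- even bit to equal b. The last two concern the odd bit, if b is 1 only once the counter has
-- reached the first dimension, if b is 0 only once it has reached the second; before that the
-- register supplies the digit 0 and the clause repeats the one for the even bit. So every round
-- writes the same pattern.
clausesWord : List Bool → Bool → Bool → List Symbol
clausesWord c r₁ r₂ =
  clauseWord positive false c ++ clauseWord negative false c ++ clauseWord positive r₁ c ++ clauseWord negative r₂ c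

clauses : Machine 4
clauses = clause positive (λ _ _ → false) ⨟ clause negative (λ _ _ → false) ⨟
  clause positive (λ r₁ _ → r₁) ⨟ clause negative (λ _ r₂ → r₂)

clausesTime : ℕ → ℕ
clausesTime N = clauseTime 8 N + (clauseTime 8 N + (clauseTime 8 N + clauseTime 8 N))

clauses-run : ∀ c o r₁ r₂ {N} → length c ≤ N →
  clauses ⊢ ([] ⟨ digits c) ∷ (o ⟨ []) ∷ register r₁ ∷ register r₂ ∷ [] ⇓[ clausesTime N ]
    ([] ⟨ digits c) ∷ (o ⊲ clausesWord c r₁ r₂ ⟨ []) ∷ register r₁ ∷ register r₂ ∷ []
clauses-run c o r₁ r₂ {N} c≤N =
  subst (λ p → clauses ⊢ ([] ⟨ digits c) ∷ (o ⟨ []) ∷ register r₁ ∷ register r₂ ∷ [] ⇓[ clausesTime N ]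
      ([] ⟨ digits c) ∷ (p ⟨ []) ∷ register r₁ ∷ register r₂ ∷ []) (sym shape)
    (clause-run positive _ c o r₁ r₂ c≤N then clause-run negative _ c _ r₁ r₂ c≤N
      then clause-run positive _ c _ r₁ r₂ c≤N then clause-run negative _ c _ r₁ r₂ c≤N)
  where
  shape : o ⊲ clausesWord c r₁ r₂ ≡
          o ⊲ clauseWord positive false c ⊲ clauseWord negative false c ⊲ clauseWord positive r₁ c ⊲ clauseWord negative r₂ c
  shape = trans (⊲-++ o (clauseWord positive false c) _)
    (trans (⊲-++ _ (clauseWord negative false c) _) (⊲-++ _ (clauseWord positive r₁ c) _))

Counter : Set
Counter = List Bool × Bool × Bool

module _ (ds₁ ds₂ : List Bool) where

  advanceCounter : Counter → Counter
  advanceCounter (c , r₁ , r₂) = let c′ = increment true c in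
    c′ , r₁ ∨ eqDigits true c′ (digits ds₁) , r₂ ∨ eqDigits true c′ (digits ds₂)

  finalCounter : ℕ → Counter → Counter
  finalCounter zero    s = s
  finalCounter (suc k) s = finalCounter k (advanceCounter s)

  constraints : ℕ → Counter → List Symbol
  constraints zero    s                 = []
  constraints (suc k) s@(c , r₁ , r₂) = clausesWord c r₁ r₂ ++ constraints k (advanceCounter s)

writing : 4 ⊑ 7
writing = skip (skip (skip (use (use (use (use done))))))

ticking : 5 ⊑ 7
ticking = use (use (skip (use (skip (use (use done))))))

onFuel : 1 ⊑ 7
onFuel = skip (skip (use (skip (skip (skip (skip done))))))

round : Machine 7
round = lift writing clauses ⨟ lift ticking tick ⨟ lift onFuel (once λ _ → keep right ∷ [])

-- The fuel alone decides when to stop, so that the counter is never compared with s.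
rounds : Machine 7
rounds = while (λ { (_ ∷ _ ∷ e ∷ _) → is-just e }) round

tickTime roundTime : ℕ → ℕ
tickTime N = suc N + (1 + (N + 1))
roundTime N = clausesTime N + (tickTime N + 1)

rounds-run : ∀ l₁ ds₁ l₂ ds₂ k c r₁ r₂ l o {N} → length c ≤ N →
  let c′ , r₁′ , r₂′ = finalCounter ds₁ ds₂ k (c , r₁ , r₂) in
  rounds ⊢ (l₁ ⟨ digits ds₁) ∷ (l₂ ⟨ digits ds₂) ∷ (l ⟨ digits (zeros k)) ∷ ([] ⟨ digits c) ∷ (o ⟨ []) ∷ register r₁ ∷ register r₂ ∷ []
    ⇓[ k * roundTime N ]
    (l₁ ⟨ digits ds₁) ∷ (l₂ ⟨ digits ds₂) ∷ (digits (zeros k) ʳ++ l ⟨ []) ∷ ([] ⟨ digits c′) ∷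
    (o ⊲ constraints ds₁ ds₂ k (c , r₁ , r₂) ⟨ []) ∷ register r₁′ ∷ register r₂′ ∷ []
rounds-run l₁ ds₁ l₂ ds₂ zero    c r₁ r₂ l o c≤N = while-stop refl
rounds-run l₁ ds₁ l₂ ds₂ (suc k) c r₁ r₂ l o {N} c≤N =
  subst (λ p → rounds ⊢ (l₁ ⟨ digits ds₁) ∷ (l₂ ⟨ digits ds₂) ∷ (l ⟨ digits (zeros (suc k))) ∷ ([] ⟨ digits c) ∷ (o ⟨ []) ∷ register r₁ ∷ register r₂ ∷ []
      ⇓[ roundTime N + k * roundTime N ]
      (l₁ ⟨ digits ds₁) ∷ (l₂ ⟨ digits ds₂) ∷ (digits (zeros (suc k)) ʳ++ l ⟨ []) ∷ ([] ⟨ digits (proj₁ end)) ∷ (p ⟨ []) ∷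
      register (proj₁ (proj₂ end)) ∷ register (proj₂ (proj₂ end)) ∷ [])
    (sym (⊲-++ o (clausesWord c r₁ r₂) _))
    (while-next refl
      (lift-run writing _ (clauses-run c o r₁ r₂ c≤N)
        then lift-run ticking _
          (weaken (+-mono-≤ (s≤s c≤N) (s≤s (+-monoˡ-≤ 1 c≤N))) (tick-run c l₁ ds₁ l₂ ds₂ r₁ r₂))
        then lift-run onFuel _ (once-run _ _))
      (rounds-run l₁ ds₁ l₂ ds₂ k (increment true c) _ _ (dig false ∷ l) _
        (≤-trans (≤-reflexive (length-increment true c)) c≤N)))
  where end = finalCounter ds₁ ds₂ (suc k) (c , r₁ , r₂)

onesWord : ℕ → List Bool → List Symbol
onesWord zero    c = []
onesWord (suc n) c = map (λ _ → `1) c ++ (`# ∷ []) ++ onesWord n c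

ones : ℕ → Machine 2
ones zero    = stop
ones (suc n) = print (λ _ → `1) ⨟ lift (skip (use done)) (emit (`# ∷ [])) ⨟ ones n

ones-run : ∀ n c o {N} → length c ≤ N → ones n ⊢ ([] ⟨ digits c) ∷ (o ⟨ []) ∷ [] ⇓[ n * ((N + (2 + N)) + 1) ]
             ([] ⟨ digits c) ∷ (o ⊲ onesWord n c ⟨ []) ∷ []
ones-run zero    c o c≤N = halt refl
ones-run (suc n) c o {N} c≤N =
  subst (λ p → ones (suc n) ⊢ ([] ⟨ digits c) ∷ (o ⟨ []) ∷ [] ⇓[ suc n * ((N + (2 + N)) + 1) ] ([] ⟨ digits c) ∷ (p ⟨ []) ∷ [])
    (sym (⊲-++ o (map (λ _ → `1) c) _))
    (weaken (≤-reflexive (sym (+-assoc (N + (2 + N)) 1 _)))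
      (print-run _ c o c≤N then lift-run (skip (use done)) _ (emit-run (`# ∷ []) _) then ones-run n c _ c≤N))

units : ℕ → List Symbol
units zero    = []
units (suc n) = `1 ∷ `# ∷ units n

-- An instance with n dimensions, all 1, whose only witness is the bit b.
constant : Bool → ℕ → List⁺ Symbol
constant b n = `¬ List⁺.∷ (if b then `¬ ∷ [] else `¬ ∷ `¬ ∷ []) ++ `x ∷ `# ∷ `# ∷ units n

-- The word already written is not erased: one blank is left after it and the new word follows.
-- Serialisation starts at the right end and stops at that blank.
reset : Bool → ℕ → Machine 3
reset b n = lift (use (skip (skip done))) (once (λ _ → keep right ∷ []) ⨟ emit (toList (constant b n)))

replace : ℕ → Machine 3
replace n = branch (λ { (_ ∷ r₁ ∷ _) → value r₁ })
  (branch (λ { (_ ∷ _ ∷ r₂ ∷ _) → value r₂ }) stop (reset true n)) (reset false n)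

-- On encoded instances, a register that is still clear after s rounds means a dimension above s.
-- For f this excludes a unique witness, so the only possible answer is 0; for g it excludes a
-- unique counterexample, which leaves 1. If both are clear, the two promises contradict each other
-- and any word will do.
outcome : ℕ → Bool → Bool → List⁺ Symbol → List⁺ Symbol
outcome n r₁ r₂ σs = if r₁ then (if r₂ then σs else constant true n) else constant false n

replaceTime : ℕ → ℕ
replaceTime n = (1 + length (toList (constant true n))) + (1 + length (toList (constant false n)))

replace-run : ∀ n r₁ r₂ σs → ∃[ o ] hd o ≡ blank ×
  replace n ⊢ ([] ⊲ toList σs ⟨ []) ∷ register r₁ ∷ register r₂ ∷ [] ⇓[ replaceTime n ]
    (o ⊲ toList (outcome n r₁ r₂ σs) ⟨ []) ∷ register r₁ ∷ register r₂ ∷ []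
replace-run n false r₂ σs = blank ◂ ([] ⊲ toList σs) , hd-◂ blank ([] ⊲ toList σs) , branch-false refl
  (lift-run (use (skip (skip done))) _ (weaken (m≤n+m _ (1 + length (toList (constant true n)))) (once-run _ _ then emit-run (toList (constant false n)) _)))
replace-run n true false σs = blank ◂ ([] ⊲ toList σs) , hd-◂ blank ([] ⊲ toList σs) , branch-true refl (branch-false refl
  (lift-run (use (skip (skip done))) _ (weaken (m≤m+n _ (1 + length (toList (constant false n)))) (once-run _ _ then emit-run (toList (constant true n)) _))))
replace-run n true true σs = [] , refl , branch-true refl (branch-true refl (halt refl))

ser : List Symbol → List Bool
ser []       = []
ser (σ ∷ σs) = let a , b , c = bitsOf σ in a ∷ b ∷ c ∷ ser σs

ser⁺ : List⁺ Symbol → List⁺ Bool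
ser⁺ (σ List⁺.∷ σs) = let a , b , c = bitsOf σ in a List⁺.∷ b ∷ c ∷ ser σs

serialiser : Machine 2
serialiser = record
  { State = Maybe Bool ; finite = Maybe-finite Bool-finite ; start = nothing
  ; δ = λ where
      nothing      (_ ∷ ltr σ ∷ _) → just (just true  , write (dig (proj₂ (proj₂ (bitsOf σ)))) left ∷ keep stay ∷ [])
      (just true)  (_ ∷ ltr σ ∷ _) → just (just false , write (dig (proj₁ (proj₂ (bitsOf σ)))) left ∷ keep stay ∷ [])
      (just false) (_ ∷ ltr σ ∷ _) → just (nothing    , write (dig (proj₁ (bitsOf σ))) left ∷ keep left ∷ [])
      _            _               → nothing
  }

prepended : List Symbol → List Γ → List Γ
prepended []      u = u
prepended (σ ∷ ρ) u = let a , b , c = bitsOf σ in prepended ρ (dig a ∷ dig b ∷ dig c ∷ u)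

prepended-ser : ∀ σs ρ u → prepended (σs ʳ++ ρ) u ≡ prepended ρ (digits (ser σs) ++ u)
prepended-ser []       ρ u = refl
prepended-ser (σ ∷ σs) ρ u = prepended-ser σs (σ ∷ ρ) u

serialiser-run : ∀ ρ {o l g u s} → hd o ≡ blank → ∃[ l′ ] ∃[ g′ ] ∃[ O ]
  serialiser ⊢ (l ⟨ g ◂ u) ∷ standing (letters ρ ++ o) s ∷ [] ⇓[ length ρ * 3 ] (l′ ⟨ g′ ◂ prepended ρ u) ∷ O ∷ []
serialiser-run [] {o} {l} {g} {s = s} e =
  l , g , _ , halt (cong (λ h → δ serialiser nothing (_ ∷ h ∷ [])) (trans (hd-◂ (hd o) s) e))
serialiser-run (σ ∷ ρ) {o} {l} {g} {u} {s} e =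
  let a , b , c = bitsOf σ
      u₁ = dig c ∷ u
      u₂ = dig b ∷ u₁
      l₁ = tl l
      l₂ = tl l₁
      l′ , g′ , O , h = serialiser-run ρ {o} {tl l₂} {hd l₂} {dig a ∷ u₂} {ltr σ ∷ s} e
      U = (l′ ⟨ g′ ◂ prepended ρ (dig a ∷ u₂)) ∷ O ∷ []
      S = standing (letters (σ ∷ ρ) ++ o) s
  in l′ , g′ , O ,
     next refl (subst (λ v → serialiser ⊢ just true ▸ (l₁ ⟨ hd l ◂ dig c ∷ v) ∷ S ∷ [] ⇓[ 2 + length ρ * 3 ] U) (sym (tl-◂ g u))
       (next refl (subst (λ v → serialiser ⊢ just false ▸ (l₂ ⟨ hd l₁ ◂ dig b ∷ v) ∷ S ∷ [] ⇓[ 1 + length ρ * 3 ] U) (sym (tl-◂ (hd l) u₁))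
         (next refl (subst (λ v → serialiser ⊢ nothing ▸ (tl l₂ ⟨ hd l₂ ◂ dig a ∷ v) ∷ standing (letters ρ ++ o) (ltr σ ∷ s) ∷ [] ⇓[ length ρ * 3 ] U)
           (sym (tl-◂ (hd l₁) u₂)) h)))))

-- The output is laid down from right to left so that its last bit comes to stand just before
-- `rest`, which begins with a blank where this is applied. It overwrites the old word of the first
-- tape from its end, and whatever remains of that word lies behind the head.
deliver : Machine 2
deliver = once (λ _ → keep left ∷ keep left ∷ []) ⨟ serialiser ⨟ once (λ _ → keep right ∷ keep stay ∷ [])

deliver-run : ∀ σs {o l rest N} → hd o ≡ blank → length σs ≤ N → ∃[ l′ ] ∃[ O ]
  deliver ⊢ (l ⟨ rest) ∷ (o ⊲ σs ⟨ []) ∷ [] ⇓[ 1 + (N * 3 + 1) ] (l′ ⟨ digits (ser σs) ++ rest) ∷ O ∷ []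
deliver-run σs {o} {l} {rest} {N} e σs≤N with serialiser-run (σs ʳ++ []) {o} {tl l} {hd l} {rest} {[]} e
... | l′ , g , O , h rewrite prepended-ser σs [] rest =
  g ◂ l′ , O , subst₂ (λ p X → deliver ⊢ (l ⟨ rest) ∷ (p ⟨ []) ∷ [] ⇓[ 1 + (N * 3 + 1) ] X ∷ O ∷ []) shape right-shape
    (once-run _ _ then weaken (*-monoˡ-≤ 3 len) h then once-run _ _)
  where
  u = digits (ser σs) ++ rest
  len : length (σs ʳ++ []) ≤ N
  len = ≤-trans (≤-reflexive (trans (length-ʳ++ σs) (+-identityʳ _))) σs≤N
  shape : letters (σs ʳ++ []) ++ o ≡ o ⊲ σs
  shape = trans (cong (_++ o) (trans (map-ʳ++ _ σs) (trans (ʳ++-defn (letters σs)) (++-identityʳ _)))) (sym (ʳ++-defn (letters σs)))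
  right-shape : (hd (g ◂ u) ◂ l′ ⟨ tl (g ◂ u)) ≡ (g ◂ l′ ⟨ u)
  right-shape rewrite hd-◂ g u | tl-◂ g u = refl

-- Combining two instances

-- Tapes of the combining machine: the words of the two given machines, their symbols, the fuel of
-- the loop, the counter, the symbols written so far, and the registers.
pattern tapes₉ X Y S₁ S₂ E C O R₁ R₂ = X ∷ Y ∷ S₁ ∷ S₂ ∷ E ∷ C ∷ O ∷ R₁ ∷ R₂ ∷ []

chunk₁ chunk₂ : 4 ⊑ 9
chunk₁ = use (skip (use (skip (use (use (skip (skip (skip done))))))))
chunk₂ = skip (use (skip (use (use (use (skip (skip (skip done))))))))

onS₁ onS₂ onE onC onO : 1 ⊑ 9
onS₁ = skip (skip (use (skip (skip (skip (skip (skip (skip done))))))))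
onS₂ = skip (skip (skip (use (skip (skip (skip (skip (skip done))))))))
onE  = skip (skip (skip (skip (use (skip (skip (skip (skip done))))))))
onC  = skip (skip (skip (skip (skip (use (skip (skip (skip done))))))))
onO  = skip (skip (skip (skip (skip (skip (use (skip (skip done))))))))

onS₁O onS₂O onCO onXO : 2 ⊑ 9
onS₁O = skip (skip (use (skip (skip (skip (use (skip (skip done))))))))
onS₂O = skip (skip (skip (use (skip (skip (use (skip (skip done))))))))
onCO  = skip (skip (skip (skip (skip (use (use (skip (skip done))))))))
onXO  = use (skip (skip (skip (skip (skip (use (skip (skip done))))))))

looping : 7 ⊑ 9
looping = skip (skip (use (use (use (use (use (use (use done))))))))

replacing : 3 ⊑ 9
replacing = skip (skip (skip (skip (skip (skip (use (use (use done))))))))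

-- Around the two formulas and the constraints these spell `((b ∧ f) ∨ (¬ b ∧ ¬ g)) ∧ …`. The
-- symbols of ¬ ⊥ end the conjunction of constraints, and the final zero begins the next number:
-- continued by the digits of the counter, whose last value is s, it is the dimension `2 * s`.
open₁ open₂ close : List Symbol
open₁ = `∧ ∷ `∨ ∷ `∧ ∷ `x ∷ `# ∷ `# ∷ []
open₂ = `∧ ∷ `¬ ∷ `x ∷ `# ∷ `# ∷ `¬ ∷ []
close = `¬ ∷ `⊥ ∷ `0 ∷ []

module _ (n : ℕ) where

  load : Machine 9
  load = lift chunk₁ chunker ⨟ lift chunk₂ chunker ⨟ lift onS₁ (strip (suc n)) ⨟ lift onS₂ (strip (suc n)) ⨟
    lift onE home ⨟ lift onC home

  compose : Machine 9
  compose = lift onO (emit open₁) ⨟ lift onS₁O doubler ⨟ lift onO (emit open₂) ⨟ lift onS₂O doubler ⨟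
    lift looping rounds ⨟ lift onO (emit close) ⨟ lift onCO (print digitSymbol) ⨟ lift onO (emit (`# ∷ [])) ⨟
    lift onCO (ones n)

  combiner : Machine 9
  combiner = load ⨟ compose ⨟ lift replacing (replace (suc n)) ⨟ lift onXO deliver

  loadTime : ℕ → ℕ
  loadTime N = N + (N + ((1 + (suc n * N + (N + suc N))) + ((1 + (suc n * N + (N + suc N))) + ((2 + N) + (2 + N)))))

  composeTime : ℕ → ℕ
  composeTime N = 6 + (N * 2 + (6 + (N * 2 + (N * roundTime N + (3 + ((N + (2 + N)) + (1 + n * ((N + (2 + N)) + 1))))))))

digits-zeros : ∀ j k → (digits (zeros k) ʳ++ digits (zeros j) ʳ++ []) ʳ++ [] ≡ digits (zeros (j + k))
digits-zeros j k = trans (ʳ++-ʳ++ (digits (zeros k)))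
  (trans (ʳ++-ʳ++ (digits (zeros j)))
  (trans (cong (digits (zeros j) ++_) (++-identityʳ _)) (join j)))
  where
  join : ∀ j → digits (zeros j) ++ digits (zeros k) ≡ digits (zeros (j + k))
  join zero    = refl
  join (suc j) = cong (dig false ∷_) (join j)

length-chunk : ∀ w → length (chunk w) ≤ length w
length-chunk []              = z≤n
length-chunk (_ ∷ [])        = z≤n
length-chunk (_ ∷ _ ∷ [])    = z≤n
length-chunk (a ∷ b ∷ c ∷ w) = s≤s (m≤n⇒m≤1+n (m≤n⇒m≤1+n (length-chunk w)))

length-formulaPart : ∀ n σs → length (formulaPart n σs) ≤ length σs
length-formulaPart n σs = begin
  length (proj₁ (takeDigits ρ []) ʳ++ []) ≡⟨ trans (length-ʳ++ (proj₁ (takeDigits ρ []))) (+-identityʳ _) ⟩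
  length (proj₁ (takeDigits ρ []))        ≤⟨ length-takeDigits ρ [] ⟩
  length ρ                                ≤⟨ length-dropNumbers n (σs ʳ++ []) ⟩
  length (σs ʳ++ [])                      ≡⟨ trans (length-ʳ++ σs) (+-identityʳ _) ⟩
  length σs                               ∎
  where
  open ≤-Reasoning
  ρ = dropNumbers n (σs ʳ++ [])

counterAfter : ℕ → List Bool → List Bool → Counter
counterAfter s d₁ d₂ = finalCounter d₁ d₂ s (zeros s , false , false)

module _ (n s : ℕ) (f₁ f₂ : List Symbol) (d₁ d₂ : List Bool) where

  joined : List⁺ Symbol
  joined = let c = proj₁ (counterAfter s d₁ d₂) in
    `∧ List⁺.∷ `∨ ∷ `∧ ∷ `x ∷ `# ∷ `# ∷ double false f₁ ++ open₂ ++ double false f₂ ++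
    constraints d₁ d₂ s (zeros s , false , false) ++ close ++ map digitSymbol c ++ (`# ∷ []) ++ onesWord n c

  joinedOrConstant : List⁺ Symbol
  joinedOrConstant = let _ , r₁ , r₂ = counterAfter s d₁ d₂ in outcome (suc n) r₁ r₂ joined

module _ (n : ℕ) (σ₁ σ₂ : List Symbol) where

  size₂ : ℕ
  size₂ = length σ₁ + length σ₂

  F₁ F₂ : List Symbol
  F₁ = formulaPart (suc n) σ₁
  F₂ = formulaPart (suc n) σ₂

  D₁ D₂ : List Bool
  D₁ = firstDimension (suc n) σ₁
  D₂ = firstDimension (suc n) σ₂

  lastCounter : Counter
  lastCounter = counterAfter size₂ D₁ D₂

  mainWord : List⁺ Symbol
  mainWord = joined n size₂ F₁ F₂ D₁ D₂

  combinedWord : List⁺ Symbol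
  combinedWord = joinedOrConstant n size₂ F₁ F₂ D₁ D₂

combine : ℕ → List⁺ Bool → List⁺ Bool → List⁺ Bool
combine n w₁ w₂ = ser⁺ (combinedWord n (chunk (toList w₁)) (chunk (toList w₂)))

load-run : ∀ n w₁ w₂ {l₁ l₂ r₁ r₂ N} → hd r₁ ≡ blank → hd r₂ ≡ blank →
  let σ₁ = chunk w₁ ; σ₂ = chunk w₂ ; z = digits (zeros (length σ₁ + length σ₂)) in
  length w₁ ≤ N → length w₂ ≤ N → length σ₁ + length σ₂ ≤ N →
  load n ⊢ tapes₉ (l₁ ⟨ digits w₁ ++ r₁) (l₂ ⟨ digits w₂ ++ r₂) emptyBand emptyBand emptyBand emptyBand emptyBand emptyBand emptyBand
    ⇓[ loadTime n N ]
    tapes₉ (digits w₁ ʳ++ l₁ ⟨ r₁) (digits w₂ ʳ++ l₂ ⟨ r₂)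
      ([] ⟨ letters (F₁ n σ₁ σ₂) ++ digits (D₁ n σ₁ σ₂)) ([] ⟨ letters (F₂ n σ₁ σ₂) ++ digits (D₂ n σ₁ σ₂))
      ([] ⟨ z) ([] ⟨ z) emptyBand emptyBand emptyBand
load-run n w₁ w₂ {l₁} {l₂} {r₁} {r₂} {N} e₁ e₂ w₁≤N w₂≤N s≤N =
  subst (λ z → load n ⊢ tapes₉ (l₁ ⟨ digits w₁ ++ r₁) (l₂ ⟨ digits w₂ ++ r₂) emptyBand emptyBand emptyBand emptyBand emptyBand emptyBand emptyBand
    ⇓[ loadTime n N ]
    tapes₉ (digits w₁ ʳ++ l₁ ⟨ r₁) (digits w₂ ʳ++ l₂ ⟨ r₂)
      ([] ⟨ letters (F₁ n σ₁ σ₂) ++ digits (D₁ n σ₁ σ₂)) ([] ⟨ letters (F₂ n σ₁ σ₂) ++ digits (D₂ n σ₁ σ₂))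
      ([] ⟨ z) ([] ⟨ z) emptyBand emptyBand emptyBand) (digits-zeros (length σ₁) (length σ₂))
  (lift-run chunk₁ _ (weaken w₁≤N (chunker-run w₁ e₁))
    then lift-run chunk₂ _ (weaken w₂≤N (chunker-run w₂ e₂))
    then lift-run onS₁ _ (strip-run (suc n) σ₁ (≤-trans (m≤m+n _ _) s≤N))
    then lift-run onS₂ _ (strip-run (suc n) σ₂ (≤-trans (m≤n+m _ _) s≤N))
    then lift-run onE _ (weaken (s≤s (s≤s z≤N)) (home-run [] inked))
    then lift-run onC _ (weaken (s≤s (s≤s z≤N)) (home-run [] inked)))
  where
  σ₁ = chunk w₁
  σ₂ = chunk w₂
  z₁ = digits (zeros (length σ₁))
  z₂ = digits (zeros (length σ₂))
  inked : Inked (z₂ ʳ++ z₁ ʳ++ [])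
  inked = ʳ++-inked (digits-inked (zeros (length σ₂))) (ʳ++-inked (digits-inked (zeros (length σ₁))) [])
  count : ∀ k → length (digits (zeros k)) ≡ k
  count k = trans (length-map _ (zeros k)) (length-replicate k)
  z≤N : length (z₂ ʳ++ z₁ ʳ++ []) ≤ N
  z≤N = ≤-trans (≤-reflexive (trans (length-ʳ++ z₂) (trans (cong₂ _+_ (count (length σ₂)) (trans (length-ʳ++ z₁) (trans (+-identityʳ _) (count (length σ₁)))))
          (+-comm (length σ₂) (length σ₁))))) s≤N

length-finalCounter : ∀ ds₁ ds₂ k s → length (proj₁ (finalCounter ds₁ ds₂ k s)) ≡ length (proj₁ s)
length-finalCounter ds₁ ds₂ zero    s                 = refl
length-finalCounter ds₁ ds₂ (suc k) s@(c , r₁ , r₂) =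
  trans (length-finalCounter ds₁ ds₂ k (advanceCounter ds₁ ds₂ s)) (length-increment true c)

compose-run : ∀ n σ₁ σ₂ {X Y N} → length σ₁ + length σ₂ ≤ N →
  let z = digits (zeros (length σ₁ + length σ₂)) ; c , r₁ , r₂ = lastCounter n σ₁ σ₂ in ∃[ S₁ ] ∃[ S₂ ] ∃[ E ]
  compose n ⊢ tapes₉ X Y
      ([] ⟨ letters (F₁ n σ₁ σ₂) ++ digits (D₁ n σ₁ σ₂)) ([] ⟨ letters (F₂ n σ₁ σ₂) ++ digits (D₂ n σ₁ σ₂))
      ([] ⟨ z) ([] ⟨ z) emptyBand emptyBand emptyBand
    ⇓[ composeTime n N ]
    tapes₉ X Y S₁ S₂ E ([] ⟨ digits c) ([] ⊲ toList (mainWord n σ₁ σ₂) ⟨ []) (register r₁) (register r₂)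
compose-run n σ₁ σ₂ {X} {Y} {N} s≤N = S₁ , S₂ , E ,
  subst (λ o → compose n ⊢ tapes₉ X Y ([] ⟨ letters f₁ ++ digits d₁) ([] ⟨ letters f₂ ++ digits d₂) ([] ⟨ z) ([] ⟨ z) emptyBand emptyBand emptyBand
    ⇓[ composeTime n N ] tapes₉ X Y S₁ S₂ E ([] ⟨ digits c) (o ⟨ []) (register r₁) (register r₂)) (sym shape)
  (lift-run onO _ (emit-run open₁ [])
    then lift-run onS₁O _ (weaken (*-monoˡ-≤ 2 f₁≤N) (doubler-run f₁ d₁ [] _))
    then lift-run onO _ (emit-run open₂ _)
    then lift-run onS₂O _ (weaken (*-monoˡ-≤ 2 f₂≤N) (doubler-run f₂ d₂ [] _))
    then lift-run looping _ (weaken (*-monoˡ-≤ (roundTime N) s≤N) (rounds-run (letters f₁ ʳ++ []) d₁ (letters f₂ ʳ++ []) d₂ s (zeros s) false false [] _ z≤N))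
    then lift-run onO _ (emit-run close _)
    then lift-run onCO _ (print-run digitSymbol c _ c≤N)
    then lift-run onO _ (emit-run (`# ∷ []) _)
    then lift-run onCO _ (ones-run n c _ c≤N))
  where
  s  = size₂ n σ₁ σ₂
  z  = digits (zeros s)
  f₁ = F₁ n σ₁ σ₂
  f₂ = F₂ n σ₁ σ₂
  d₁ = D₁ n σ₁ σ₂
  d₂ = D₂ n σ₁ σ₂
  c  = proj₁ (lastCounter n σ₁ σ₂)
  r₁ = proj₁ (proj₂ (lastCounter n σ₁ σ₂))
  r₂ = proj₂ (proj₂ (lastCounter n σ₁ σ₂))
  S₁ = letters f₁ ʳ++ [] ⟨ digits d₁
  S₂ = letters f₂ ʳ++ [] ⟨ digits d₂
  E  = z ʳ++ [] ⟨ []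
  K  = constraints d₁ d₂ s (zeros s , false , false)
  f₁≤N : length f₁ ≤ N
  f₁≤N = ≤-trans (length-formulaPart (suc n) σ₁) (≤-trans (m≤m+n _ _) s≤N)
  f₂≤N : length f₂ ≤ N
  f₂≤N = ≤-trans (length-formulaPart (suc n) σ₂) (≤-trans (m≤n+m _ _) s≤N)
  z≤N : length (zeros s) ≤ N
  z≤N = ≤-trans (≤-reflexive (length-replicate s)) s≤N
  c≤N : length c ≤ N
  c≤N = ≤-trans (≤-reflexive (length-finalCounter d₁ d₂ s (zeros s , false , false))) z≤N
  shape : [] ⊲ toList (mainWord n σ₁ σ₂) ≡
    [] ⊲ open₁ ⊲ double false f₁ ⊲ open₂ ⊲ double false f₂ ⊲ K ⊲ close ⊲ map digitSymbol c ⊲ (`# ∷ []) ⊲ onesWord n c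
  shape = trans (⊲-++ ([] ⊲ open₁) (double false f₁) _) (trans (⊲-++ _ (double false f₂) _)
    (trans (⊲-++ _ K _) (⊲-++ _ (map digitSymbol c) _)))

buildTime combineTime : ℕ → ℕ → ℕ
buildTime n N = loadTime n N + (composeTime n N + replaceTime (suc n))
combineTime n N = loadTime n N + (composeTime n N + (replaceTime (suc n) + (1 + (2 * buildTime n N * 3 + 1))))

combiner-run : ∀ n w₁ w₂ {l₁ l₂ r₁ r₂ N} → hd r₁ ≡ blank → hd r₂ ≡ blank →
  length (toList w₁) ≤ N → length (toList w₂) ≤ N → length (toList w₁) + length (toList w₂) ≤ N → ∃[ l ] ∃[ Ts ]
  combiner n ⊢ tapes₉ (l₁ ⟨ digits (toList w₁) ++ r₁) (l₂ ⟨ digits (toList w₂) ++ r₂)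
      emptyBand emptyBand emptyBand emptyBand emptyBand emptyBand emptyBand
    ⇓[ combineTime n N ] (l ⟨ digits (toList (combine n w₁ w₂)) ++ r₁) ∷ Ts
combiner-run n w₁ w₂ {l₁} {l₂} {r₁} {r₂} {N} e₁ e₂ w₁≤N w₂≤N w≤N =
  _ , _ , (loading then composing then replacing-run then lift-run onXO _ (proj₂ (proj₂ delivery)))
  where
  σ₁ = chunk (toList w₁)
  σ₂ = chunk (toList w₂)
  s≤N = ≤-trans (+-mono-≤ (length-chunk (toList w₁)) (length-chunk (toList w₂))) w≤N
  word = toList (combinedWord n σ₁ σ₂)
  loading   = load-run n (toList w₁) (toList w₂) {l₁} {l₂} {r₁} {r₂} {N} e₁ e₂ w₁≤N w₂≤N s≤N
  composing = proj₂ (proj₂ (proj₂ (compose-run n σ₁ σ₂ {digits (toList w₁) ʳ++ l₁ ⟨ r₁} {digits (toList w₂) ʳ++ l₂ ⟨ r₂} {N} s≤N)))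
  replaced  = replace-run (suc n) (proj₁ (proj₂ (lastCounter n σ₁ σ₂))) (proj₂ (proj₂ (lastCounter n σ₁ σ₂))) (mainWord n σ₁ σ₂)
  o         = proj₁ replaced
  replacing-run = lift-run replacing (tapes₉ _ _ _ _ _ _ _ _ _) (proj₂ (proj₂ replaced))
  -- The symbol tape starts empty, so its final extent, and with it the length of the word, is at
  -- most twice the time spent so far; the length need not be worked out.
  word≤ : length word ≤ 2 * buildTime n N
  word≤ = begin
    length word                                 ≤⟨ m≤m+n _ _ ⟩
    length word + length o                      ≡⟨ cong (_+ length o) (length-map _ word) ⟨
    length (letters word) + length o            ≡⟨ length-ʳ++ (letters word) ⟨
    length (o ⊲ word)                           ≡⟨ +-identityʳ _ ⟨
    extent (o ⊲ word ⟨ [])                      ≤⟨ extent-run (loading then composing then replacing-run) (Fin.suc (Fin.suc (Fin.suc (Fin.suc (Fin.suc (Fin.suc Fin.zero)))))) ⟩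
    2 * buildTime n N                           ∎
    where open ≤-Reasoning
  delivery = deliver-run word {o} {digits (toList w₁) ʳ++ l₁} {r₁} (proj₁ (proj₂ replaced)) word≤

-- Machines computing the reductions

none : ∀ n → 0 ⊑ n
none zero    = done
none (suc n) = skip (none n)

all⊑ : ∀ n → n ⊑ n
all⊑ zero    = done
all⊑ (suc n) = use (all⊑ n)

left⊑ : ∀ m n → m ⊑ m + n
left⊑ zero    n = none n
left⊑ (suc m) n = use (left⊑ m n)

right⊑ : ∀ m n → n ⊑ m + n
right⊑ zero    n = all⊑ n
right⊑ (suc m) n = skip (right⊑ m n)

select-replicate : ∀ {A : Set} {m n} (θ : m ⊑ n) (x : A) → select θ (Vec.replicate n x) ≡ Vec.replicate m x
select-replicate done     x = refl
select-replicate (use θ)  x = cong (x ∷_) (select-replicate θ x)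
select-replicate (skip θ) x = select-replicate θ x

select-none : ∀ {A : Set} n (xs : Vec A n) → select (none n) xs ≡ []
select-none zero    []       = refl
select-none (suc n) (x ∷ xs) = select-none n xs

merge-none : ∀ {A : Set} n (ys : Vec A 0) xs → merge (none n) ys xs ≡ xs
merge-none zero    ys []       = refl
merge-none (suc n) ys (x ∷ xs) = cong (x ∷_) (merge-none n ys xs)

right-after-left : ∀ {A : Set} m n (ys : Vec A m) xs → select (right⊑ m n) (merge (left⊑ m n) ys xs) ≡ select (right⊑ m n) xs
right-after-left zero    n ys       xs       = cong (select (all⊑ n)) (merge-none n ys xs)
right-after-left (suc m) n (y ∷ ys) (x ∷ xs) = right-after-left m n ys xs

simulate : ∀ {μ} (P : PolyTime μ) → let M , a , k , _ = P in ∀ x → ∃[ l ] ∃[ rest ] ∃[ Us ] hd rest ≡ blank ×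
  embed M ⊢ ([] ⟨ digits (toList x)) ∷ Vec.replicate (TM.extraTapes M) emptyBand ⇓[ a * List⁺.length x ^ k ]
    (l ⟨ digits (toList (μ x)) ++ rest) ∷ Us
simulate (M , a , k , run) x with run x
... | t , (q , us) , t≤ , h , out with embed-run M h (Copies-init x (TM.extraTapes M))
... | (l ⟨ r) ∷ Us , h′ , (p ∷ ps) with ahead-output r (Copy.ahead≋ p)
... | rest , blank-rest , e = l , rest , Us , blank-rest ,
  subst (λ r → embed M ⊢ ([] ⟨ digits (toList x)) ∷ Vec.replicate (TM.extraTapes M) emptyBand ⇓[ a * List⁺.length x ^ k ] (l ⟨ r) ∷ Us)
    (trans e (cong (λ w → digits w ++ rest) out)) (weaken t≤ h′)

bounded : ∀ {k} {M : Machine (suc k)} {Ts : Vec Band k} {x l w rest Us b} → M ⊢ ([] ⟨ digits x) ∷ Ts ⇓[ b ] (l ⟨ digits w ++ rest) ∷ Us →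
          length w ≤ length x + 2 * b
bounded {x = x} {l} {w} {rest} {b = b} h = begin
  length w                          ≡⟨ length-map _ w ⟨
  length (digits w)                 ≤⟨ m≤m+n _ _ ⟩
  length (digits w) + length rest   ≡⟨ length-++ (digits w) ⟨
  length (digits w ++ rest)         ≤⟨ m≤n+m _ _ ⟩
  extent (l ⟨ digits w ++ rest)     ≤⟨ extent-run h Fin.zero ⟩
  length (digits x) + 2 * b         ≡⟨ cong (_+ 2 * b) (length-map _ x) ⟩
  length x + 2 * b                  ∎
  where open ≤-Reasoning

duplicate : Machine 2
duplicate = copy ⨟ lift (use (skip done)) home ⨟ lift (skip (use done)) home

duplicate-run : ∀ x → duplicate ⊢ ([] ⟨ digits x) ∷ emptyBand ∷ [] ⇓[ length x + ((2 + length x) + (2 + length x)) ]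
                  ([] ⟨ digits x) ∷ ([] ⟨ digits x) ∷ []
duplicate-run x =
  subst (λ r → duplicate ⊢ ([] ⟨ digits x) ∷ emptyBand ∷ [] ⇓[ length x + ((2 + length x) + (2 + length x)) ] ([] ⟨ r) ∷ ([] ⟨ r) ∷ [])
    (trans (ʳ++-ʳ++ (digits x)) (++-identityʳ _))
    (copy-run x [] [] then lift-run (use (skip done)) (_ ∷ _ ∷ []) homing then lift-run (skip (use done)) (_ ∷ _ ∷ []) homing)
  where
  homing : home ⊢ (digits x ʳ++ [] ⟨ []) ∷ [] ⇓[ 2 + length x ] ([] ⟨ (digits x ʳ++ []) ʳ++ []) ∷ []
  homing = subst (λ n → home ⊢ (digits x ʳ++ [] ⟨ []) ∷ [] ⇓[ 2 + n ] ([] ⟨ (digits x ʳ++ []) ʳ++ []) ∷ [])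
    (trans (length-ʳ++ (digits x)) (trans (+-identityʳ _) (length-map _ x)))
    (home-run [] (ʳ++-inked (digits-inked x) []))

module _ {μ ν} (P : PolyTime μ) (Q : PolyTime ν) (n : ℕ) where

  private
    M₁ = proj₁ P
    M₂ = proj₁ Q
    e₁ = TM.extraTapes M₁
    e₂ = TM.extraTapes M₂
    a₁ = proj₁ (proj₂ P)
    a₂ = proj₁ (proj₂ Q)
    k₁ = proj₁ (proj₂ (proj₂ P))
    k₂ = proj₁ (proj₂ (proj₂ Q))

    inputs : 2 ⊑ 9 + (e₁ + e₂)
    inputs = use (use (skip (skip (skip (skip (skip (skip (skip (none _)))))))))

    first : suc e₁ ⊑ 9 + (e₁ + e₂)
    first = use (skip (skip (skip (skip (skip (skip (skip (skip (left⊑ e₁ e₂)))))))))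

    second : suc e₂ ⊑ 9 + (e₁ + e₂)
    second = skip (use (skip (skip (skip (skip (skip (skip (skip (right⊑ e₁ e₂)))))))))

    work : 9 ⊑ 9 + (e₁ + e₂)
    work = use (use (use (use (use (use (use (use (use (none _)))))))))

    -- The two given machines work on separate copies of the input and leave their outputs on the
    -- first two of the nine tapes of `combiner`; their own extra tapes come last.
    reducer : Machine (9 + (e₁ + e₂))
    reducer = lift inputs duplicate ⨟ lift first (embed M₁) ⨟ lift second (embed M₂) ⨟ lift work (combiner n)

    t₁ t₂ N time : ℕ → ℕ
    t₁ L = a₁ * L ^ k₁
    t₂ L = a₂ * L ^ k₂
    N L = (L + 2 * t₁ L) + (L + 2 * t₂ L)
    time L = (L + ((2 + L) + (2 + L))) + (t₁ L + (t₂ L + combineTime n (N L)))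

    time-poly : Poly time
    time-poly = (poly-id ⊹ ((poly-const 2 ⊹ poly-id) ⊹ (poly-const 2 ⊹ poly-id))) ⊹ (pt₁ ⊹ (pt₂ ⊹
      (pload ⊹ (pcompose ⊹ (poly-const (replaceTime (suc n)) ⊹ (poly-const 1 ⊹ (poly-const 2 ⊗ (pload ⊹ (pcompose ⊹ poly-const (replaceTime (suc n)))) ⊗ poly-const 3 ⊹ poly-const 1)))))))
      where
      pt₁ : Poly t₁
      pt₁ = poly-^ a₁ k₁
      pt₂ : Poly t₂
      pt₂ = poly-^ a₂ k₂
      pN : Poly N
      pN = (poly-id ⊹ poly-const 2 ⊗ pt₁) ⊹ (poly-id ⊹ poly-const 2 ⊗ pt₂)
      pstrip : Poly (λ L → 1 + (suc n * N L + (N L + suc (N L))))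
      pstrip = poly-const 1 ⊹ (poly-const (suc n) ⊗ pN ⊹ (pN ⊹ (poly-const 1 ⊹ pN)))
      pload : Poly (loadTime n ∘ N)
      pload = pN ⊹ (pN ⊹ (pstrip ⊹ (pstrip ⊹ ((poly-const 2 ⊹ pN) ⊹ (poly-const 2 ⊹ pN)))))
      pprint : Poly (λ L → N L + (2 + N L))
      pprint = pN ⊹ (poly-const 2 ⊹ pN)
      pclause : Poly (clauseTime 8 ∘ N)
      pclause = poly-const 8 ⊹ (poly-const 1 ⊹ (pprint ⊹ poly-const 1))
      pround : Poly (roundTime ∘ N)
      pround = (pclause ⊹ (pclause ⊹ (pclause ⊹ pclause))) ⊹
        (((poly-const 1 ⊹ pN) ⊹ (poly-const 1 ⊹ (pN ⊹ poly-const 1))) ⊹ poly-const 1)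
      pcompose : Poly (composeTime n ∘ N)
      pcompose = poly-const 6 ⊹ (pN ⊗ poly-const 2 ⊹ (poly-const 6 ⊹ (pN ⊗ poly-const 2 ⊹ (pN ⊗ pround ⊹ (poly-const 3 ⊹
        (pprint ⊹ (poly-const 1 ⊹ poly-const n ⊗ (pprint ⊹ poly-const 1))))))))

    row : Band → Band → Vec Band (e₁ + e₂) → Vec Band (9 + (e₁ + e₂))
    row X Y Ts = X ∷ Y ∷ emptyBand ∷ emptyBand ∷ emptyBand ∷ emptyBand ∷ emptyBand ∷ emptyBand ∷ emptyBand ∷ Ts

    unused : Vec Band (e₁ + e₂)
    unused = Vec.replicate (e₁ + e₂) emptyBand

    duplicating : ∀ x → let X = [] ⟨ digits x in
      lift inputs duplicate ⊢ row X emptyBand unused ⇓[ length x + ((2 + length x) + (2 + length x)) ] row X X unused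
    duplicating x = subst (λ Ts → lift inputs duplicate ⊢ row X emptyBand unused ⇓[ b ] row X X Ts) (merge-none _ [] unused)
      (lift-run inputs (row X emptyBand unused)
        (subst (λ Ts → duplicate ⊢ X ∷ emptyBand ∷ Ts ⇓[ b ] X ∷ X ∷ []) (sym (select-none _ unused)) (duplicate-run x)))
      where
      X = [] ⟨ digits x
      b = length x + ((2 + length x) + (2 + length x))

    running₁ : ∀ {X X′ Y Us b} → embed M₁ ⊢ X ∷ Vec.replicate e₁ emptyBand ⇓[ b ] X′ ∷ Us →
      lift first (embed M₁) ⊢ row X Y unused ⇓[ b ] row X′ Y (merge (left⊑ e₁ e₂) Us unused)
    running₁ {X} {X′} {Y} {Us} {b} h = lift-run first (row X Y unused)
      (subst (λ Ts → embed M₁ ⊢ X ∷ Ts ⇓[ b ] X′ ∷ Us) (sym (select-replicate (left⊑ e₁ e₂) emptyBand)) h)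

    running₂ : ∀ {X Y Y′ Us Vs b} → embed M₂ ⊢ Y ∷ Vec.replicate e₂ emptyBand ⇓[ b ] Y′ ∷ Vs →
      let Ts = merge (left⊑ e₁ e₂) Us unused in
      lift second (embed M₂) ⊢ row X Y Ts ⇓[ b ] row X Y′ (merge (right⊑ e₁ e₂) Vs Ts)
    running₂ {X} {Y} {Y′} {Us} {Vs} {b} h = lift-run second (row X Y (merge (left⊑ e₁ e₂) Us unused))
      (subst (λ Ts → embed M₂ ⊢ Y ∷ Ts ⇓[ b ] Y′ ∷ Vs)
        (sym (trans (right-after-left e₁ e₂ Us unused) (select-replicate (right⊑ e₁ e₂) emptyBand))) h)

    working : ∀ {X Y X′ Us b} Ts →
      combiner n ⊢ tapes₉ X Y emptyBand emptyBand emptyBand emptyBand emptyBand emptyBand emptyBand ⇓[ b ] X′ ∷ Us →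
      ∃[ Vs ] lift work (combiner n) ⊢ row X Y Ts ⇓[ b ] X′ ∷ Vs
    working {X} {Y} {X′} {Us} {b} Ts h = _ , lift-run work (row X Y Ts)
      (subst (λ Ts → combiner n ⊢ X ∷ Y ∷ emptyBand ∷ emptyBand ∷ emptyBand ∷ emptyBand ∷ emptyBand ∷ emptyBand ∷ emptyBand ∷ Ts ⇓[ b ] X′ ∷ Us)
        (sym (select-none _ Ts)) h)

    computes : Computes reducer time (λ x → combine n (μ x) (ν x))
    computes x =
      let l₁ , r₁ , Us₁ , b₁ , h₁ = simulate P x
          l₂ , r₂ , Us₂ , b₂ , h₂ = simulate Q x
          L   = List⁺.length x
          w₁≤ = bounded {x = toList x} {w = toList (μ x)} {rest = r₁} h₁
          w₂≤ = bounded {x = toList x} {w = toList (ν x)} {rest = r₂} h₂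
          l , Ts , h = combiner-run n (μ x) (ν x) {l₁} {l₂} {r₁} {r₂} {N L} b₁ b₂
            (≤-trans w₁≤ (m≤m+n (L + 2 * t₁ L) _)) (≤-trans w₂≤ (m≤n+m (L + 2 * t₂ L) (L + 2 * t₁ L))) (+-mono-≤ w₁≤ w₂≤)
          Vs , h₃ = working (merge (right⊑ e₁ e₂) Us₂ (merge (left⊑ e₁ e₂) Us₁ unused)) h
      in l , r₁ , Vs , b₁ , (duplicating (toList x) then running₁ h₁ then running₂ {Us = Us₁} h₂ then h₃)

  combine-polyTime : PolyTime (λ x → combine n (μ x) (ν x))
  combine-polyTime = polyTime {M = reducer} time-poly computes

prepend : List Bool → Machine 1
prepend []       = stop
prepend (b ∷ bs) = prepend bs ⨟ once (λ _ → keep left ∷ []) ⨟ once (λ _ → write (dig b) stay ∷ [])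

prepend-run : ∀ bs l w rest → ∃[ l′ ] prepend bs ⊢ (l ⟨ digits w ++ rest) ∷ [] ⇓[ length bs * 2 ] (l′ ⟨ digits (bs ++ w) ++ rest) ∷ []
prepend-run []       l w rest = l , halt refl
prepend-run (b ∷ bs) l w rest with prepend-run bs l w rest
... | l′ , h = tl l′ , weaken (≤-reflexive (+-comm (length bs * 2) 2))
  (subst (λ r → prepend (b ∷ bs) ⊢ (l ⟨ digits w ++ rest) ∷ [] ⇓[ length bs * 2 + 2 ] (tl l′ ⟨ dig b ∷ r) ∷ []) (tl-◂ (hd l′) _)
    (h then once-run _ _ then once-run _ _))

infixr 5 _++⁺_
_++⁺_ : List Bool → List⁺ Bool → List⁺ Bool
[]       ++⁺ w = w
(b ∷ bs) ++⁺ w = b List⁺.∷ bs ++ toList w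

-- The simulated machine halts with its head on the first bit of the output, so a fixed prefix is
-- written leftwards from there in constant time.
prepend-polyTime : ∀ {μ} bs → PolyTime μ → PolyTime (λ x → bs ++⁺ μ x)
prepend-polyTime {μ} bs P@(M , a , k , _) =
  polyTime {M = embed M ⨟ lift (use (none _)) (prepend bs)} (poly-^ a k ⊹ poly-const (length bs * 2)) computes
  where
  toList-++⁺ : ∀ bs w → toList (bs ++⁺ w) ≡ bs ++ toList w
  toList-++⁺ []       w = refl
  toList-++⁺ (b ∷ bs) w = refl
  computes : Computes (embed M ⨟ lift (use (none _)) (prepend bs)) (λ L → a * L ^ k + length bs * 2) (λ x → bs ++⁺ μ x)
  computes x with simulate P x
  ... | l , rest , Us , b , h with prepend-run bs l (toList (μ x)) rest
  ...   | l′ , h′ = l′ , rest , _ , b ,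
    subst (λ w → embed M ⨟ lift (use (none _)) (prepend bs) ⊢ ([] ⟨ digits (toList x)) ∷ _ ⇓[ a * List⁺.length x ^ k + length bs * 2 ] (l′ ⟨ digits w ++ rest) ∷ _)
      (sym (toList-++⁺ bs (μ x)))
      (h then lift-run (use (none _)) _ (subst (λ Ts → prepend bs ⊢ (l ⟨ digits (toList (μ x)) ++ rest) ∷ Ts ⇓[ length bs * 2 ] (l′ ⟨ digits (bs ++ toList (μ x)) ++ rest) ∷ [])
        (sym (select-none _ Us)) h′))

-- Quantified Boolean functions

at : ∀ {n} → Bool → Vec Bool n → ℕ → Bool
at d x = nth d (Vec.toList x)

tab : (ℕ → Bool) → ∀ n → Vec Bool n
tab g zero    = []
tab g (suc n) = g 0 ∷ tab (g ∘ suc) n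

at-tab : ∀ d g {n j} → j < n → at d (tab g n) j ≡ g j
at-tab d g {suc n} {zero}  _         = refl
at-tab d g {suc n} {suc j} (s≤s j<n) = at-tab d (g ∘ suc) j<n

at-ext : ∀ {n d} (x y : Vec Bool n) → (∀ j → j < n → at d x j ≡ at d y j) → x ≡ y
at-ext []      []      e = refl
at-ext (a ∷ x) (b ∷ y) e = cong₂ _∷_ (e 0 z<s) (at-ext x y (λ j j<n → e (suc j) (s<s j<n)))

words-complete : ∀ {m} (x : Vec Bool m) → x ∈ˡ words m
words-complete []          = here refl
words-complete (false ∷ x) = ∈-++⁺ˡ (∈-map⁺ (false ∷_) (words-complete x))
words-complete (true ∷ x)  = ∈-++⁺ʳ _ (∈-map⁺ (true ∷_) (words-complete x))

words-unique : ∀ m → Unique (words m)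
words-unique zero    = [] ∷ []
words-unique (suc m) = Unique.++⁺ (Unique.map⁺ tail≡ (words-unique m)) (Unique.map⁺ tail≡ (words-unique m)) disjoint
  where
  tail≡ : ∀ {b} {x y : Vec Bool m} → b Vec.∷ x ≡ b ∷ y → x ≡ y
  tail≡ refl = refl
  disjoint : ∀ {v} → v ∈ˡ map (false ∷_) (words m) × v ∈ˡ map (true ∷_) (words m) → ⊥
  disjoint (p , q) with ∈-map⁻ (false ∷_) p | ∈-map⁻ (true ∷_) q
  ... | _ , _ , refl | _ , _ , ()

private
  bool-ext : ∀ {a b} → (T a → T b) → (T b → T a) → a ≡ b
  bool-ext {false} {false} _ _ = refl
  bool-ext {false} {true}  _ g = ⊥-elim (g _)
  bool-ext {true}  {false} f _ = ⊥-elim (f _)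
  bool-ext {true}  {true}  _ _ = refl

any-cong : ∀ {A : Set} {p q : A → Bool} xs → (∀ x → p x ≡ q x) → any p xs ≡ any q xs
any-cong xs e = cong or′ (map-cong e xs)

all-cong : ∀ {A : Set} {p q : A → Bool} xs → (∀ x → p x ≡ q x) → all p xs ≡ all q xs
all-cong xs e = cong and′ (map-cong e xs)

module _ {m m′} (r : Vec Bool m′ → Vec Bool m) (s : Vec Bool m → Vec Bool m′) (r∘s : ∀ x → r (s x) ≡ x) (p : Vec Bool m → Bool) where

  -- A quantifier only sees the range of `r`, which is everything because of the section `s`. With
  -- `odds` for `r`, this says that bits of a block that are not passed on do not affect the
  -- quantifier over it.
  any-surjection : any (p ∘ r) (words m′) ≡ any p (words m)
  any-surjection = bool-ext
    (λ t → let z , t′ = Any.satisfied (any⁻ (p ∘ r) (words m′) t) in any⁺ p (lose (words-complete (r z)) t′))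
    (λ t → let x , t′ = Any.satisfied (any⁻ p (words m) t) in
       any⁺ (p ∘ r) (lose (words-complete (s x)) (subst (T ∘ p) (sym (r∘s x)) t′)))

  all-surjection : all (p ∘ r) (words m′) ≡ all p (words m)
  all-surjection = bool-ext
    (λ t → all⁻ p {xs = words m} (All.tabulate λ {x} _ → subst (T ∘ p) (r∘s x) (All.lookup (all⁺ (p ∘ r) (words m′) t) (words-complete (s x)))))
    (λ t → all⁻ (p ∘ r) {xs = words m′} (All.tabulate λ {z} _ → All.lookup (all⁺ p (words m) t) (words-complete (r z))))

mutual
  SAT-cong : ∀ {n} {ms : Vec ℕ n} {f g : BoolFun ms} → (∀ ys → f ys ≡ g ys) → SAT f ≡ SAT g
  SAT-cong {ms = []}     e = e []
  SAT-cong {ms = m ∷ ms} e = any-cong (words m) (λ x → coSAT-cong (λ ys → e (x ∷ ys)))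

  coSAT-cong : ∀ {n} {ms : Vec ℕ n} {f g : BoolFun ms} → (∀ ys → f ys ≡ g ys) → coSAT f ≡ coSAT g
  coSAT-cong {ms = []}     e = e []
  coSAT-cong {ms = m ∷ ms} e = all-cong (words m) (λ x → SAT-cong (λ ys → e (x ∷ ys)))

mutual
  SAT-not : ∀ {n} {ms : Vec ℕ n} (f : BoolFun ms) → SAT (not ∘ f) ≡ not (coSAT f)
  SAT-not {ms = []}     f = refl
  SAT-not {ms = m ∷ ms} f = go (words m)
    where
    go : ∀ xs → any (λ x → coSAT (fix (not ∘ f) x)) xs ≡ not (all (λ x → SAT (fix f x)) xs)
    go []       = refl
    go (x ∷ xs) rewrite coSAT-not (fix f x) | go xs with SAT (fix f x)
    ... | true  = refl
    ... | false = refl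

  coSAT-not : ∀ {n} {ms : Vec ℕ n} (f : BoolFun ms) → coSAT (not ∘ f) ≡ not (SAT f)
  coSAT-not {ms = []}     f = refl
  coSAT-not {ms = m ∷ ms} f = go (words m)
    where
    go : ∀ xs → all (λ x → SAT (fix (not ∘ f) x)) xs ≡ not (any (λ x → coSAT (fix f x)) xs)
    go []       = refl
    go (x ∷ xs) rewrite SAT-not (fix f x) | go xs with coSAT (fix f x)
    ... | true  = refl
    ... | false = refl

mutual
  -- No quantifier is vacuous, since `words m` is inhabited even for `m = 0`.
  SAT-const : ∀ {n} (ms : Vec ℕ n) b → SAT {ms = ms} (λ _ → b) ≡ b
  SAT-const []       b = refl
  SAT-const (m ∷ ms) b = bool-ext
    (λ t → let _ , t′ = Any.satisfied (any⁻ _ (words m) t) in subst T (coSAT-const ms b) t′)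
    (λ t → any⁺ _ (lose (words-complete (tab (λ _ → false) m)) (subst T (sym (coSAT-const ms b)) t)))

  coSAT-const : ∀ {n} (ms : Vec ℕ n) b → coSAT {ms = ms} (λ _ → b) ≡ b
  coSAT-const []       b = refl
  coSAT-const (m ∷ ms) b = bool-ext
    (λ t → subst T (SAT-const ms b) (All.lookup (all⁺ _ (words m) t) (words-complete (tab (λ _ → false) m))))
    (λ t → all⁻ _ {xs = words m} (All.tabulate {xs = words m} λ _ → subst T (sym (SAT-const ms b)) t))

odds : ∀ {m m′} → Vec Bool m′ → Vec Bool m
odds z = tab (λ j → at false z (1 + 2 * j)) _

spread : Bool → (ℕ → Bool) → ℕ → Bool
spread b g zero          = b
spread b g (suc zero)    = g 0
spread b g (suc (suc i)) = spread b (g ∘ suc) i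

spread-even : ∀ b g k → spread b g (2 * k) ≡ b
spread-even b g zero    = refl
spread-even b g (suc k) rewrite +-suc k (k + 0) = spread-even b (g ∘ suc) k

spread-odd : ∀ b g k → spread b g (1 + 2 * k) ≡ g k
spread-odd b g zero    = refl
spread-odd b g (suc k) rewrite +-suc k (k + 0) = spread-odd b (g ∘ suc) k

-- The default in `at b x` puts b also at the odd positions beyond the end of `x`, so that this is
-- the vector which the constraints single out.
padded : ∀ {m m′} → Bool → Vec Bool m → Vec Bool m′
padded b x = tab (spread b (at b x)) _

1+2j<2m : ∀ {j m} → j < m → 1 + 2 * j < 2 * m
1+2j<2m {j} {m} j<m = begin
  2 + 2 * j  ≡⟨ *-suc 2 j ⟨
  2 * suc j  ≤⟨ *-monoʳ-≤ 2 j<m ⟩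
  2 * m      ∎
  where open ≤-Reasoning

odds-padded : ∀ {m m′} b → 2 * m ≤ m′ → (x : Vec Bool m) → odds (padded {m′ = m′} b x) ≡ x
odds-padded b 2m≤m′ x = at-ext {d = b} _ x λ j j<m → trans (at-tab b _ j<m)
  (trans (at-tab false _ (<-≤-trans (1+2j<2m j<m) 2m≤m′)) (spread-odd b (at b x) j))

Roomy : ∀ {n} → Vec ℕ n → Vec ℕ n → Set
Roomy = Pointwise (λ m m′ → 2 * m ≤ m′)

restrict : ∀ {n} {ms ms′ : Vec ℕ n} → Blocks ms′ → Blocks ms
restrict {ms = []}    {[]}    []       = []
restrict {ms = _ ∷ _} {_ ∷ _} (y ∷ ys) = odds y ∷ restrict ys

mutual
  SAT-restrict : ∀ {n} {ms ms′ : Vec ℕ n} → Roomy ms ms′ → (f : BoolFun ms) → SAT {ms = ms′} (f ∘ restrict) ≡ SAT f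
  SAT-restrict []       f = refl
  SAT-restrict {ms = m ∷ _} {m′ ∷ _} (p ∷ ps) f = trans (any-cong (words m′) (λ y → coSAT-restrict ps (fix f (odds y))))
    (any-surjection {m} {m′} odds (padded false) (odds-padded false p) (λ x → coSAT (fix f x)))

  coSAT-restrict : ∀ {n} {ms ms′ : Vec ℕ n} → Roomy ms ms′ → (f : BoolFun ms) → coSAT {ms = ms′} (f ∘ restrict) ≡ coSAT f
  coSAT-restrict []       f = refl
  coSAT-restrict {ms = m ∷ _} {m′ ∷ _} (p ∷ ps) f = trans (all-cong (words m′) (λ y → SAT-restrict ps (fix f (odds y))))
    (all-surjection {m} {m′} odds (padded false) (odds-padded false p) (λ x → SAT (fix f x)))

module _ {A : Set} (p : A → Bool) where

  any-filterᵇ : ∀ xs → any p xs ≡ not (null (filterᵇ p xs))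
  any-filterᵇ []       = refl
  any-filterᵇ (x ∷ xs) with p x
  ... | true  = refl
  ... | false = any-filterᵇ xs

  private
    ∈-filterᵇ⁺ : ∀ {x xs} → x ∈ˡ xs → p x ≡ true → x ∈ˡ filterᵇ p xs
    ∈-filterᵇ⁺ x∈ px = ∈-filter⁺ _ x∈ (Equivalence.from T-≡ px)

  filterᵇ-≤1 : ∀ {xs x y} → length (filterᵇ p xs) ≤ 1 → x ∈ˡ xs → y ∈ˡ xs → p x ≡ true → p y ≡ true → x ≡ y
  filterᵇ-≤1 {xs} ≤1 x∈ y∈ px py with filterᵇ p xs | ≤1 | ∈-filterᵇ⁺ x∈ px | ∈-filterᵇ⁺ y∈ py
  ... | _ ∷ []    | _          | here refl | here refl = refl
  ... | _ ∷ _ ∷ _ | s≤s ()     | _         | _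

  filterᵇ-singleton : ∀ {xs x} → Unique xs → x ∈ˡ xs → p x ≡ true → (∀ y → p y ≡ true → y ≡ x) → filterᵇ p xs ≡ x ∷ []
  filterᵇ-singleton {xs} {x} u x∈ px only with filterᵇ p xs | Unique.filter⁺ (T? ∘ p) u | ∈-filterᵇ⁺ x∈ px
    | All.tabulate {xs = filterᵇ p xs} (λ {y} y∈ → only y (Equivalence.to T-≡ (proj₂ (∈-filter⁻ (T? ∘ p) {xs = xs} y∈))))
  ... | _ ∷ []    | _            | _ | refl ∷ []       = refl
  ... | _ ∷ _ ∷ _ | (n ∷ _) ∷ _ | _ | refl ∷ refl ∷ _ = contradiction refl n

module _ {n m} {ms : Vec ℕ n} .{{_ : NonZero m}} (h : BoolFun (m ∷ ms)) where

  uval-unique : ∀ z → coSAT (fix h z) ≡ true → (∀ y → coSAT (fix h y) ≡ true → y ≡ z) → uval h ≡ ｛ π₁ z ｝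
  uval-unique z pz only with witnesses h | filterᵇ-singleton (λ x → coSAT (fix h x)) (words-unique m) (words-complete z) pz only
  ... | _ | refl = refl

filterᵇ-∧ : ∀ {A : Set} (p q : A → Bool) xs → filterᵇ (λ x → p x ∧ q x) xs ≡ filterᵇ p (filterᵇ q xs)
filterᵇ-∧ p q []       = refl
filterᵇ-∧ p q (x ∷ xs) with q x
... | false with p x
...   | false = filterᵇ-∧ p q xs
...   | true  = filterᵇ-∧ p q xs
filterᵇ-∧ p q (x ∷ xs) | true with p x
...   | false = filterᵇ-∧ p q xs
...   | true  = cong (x ∷_) (filterᵇ-∧ p q xs)

filterᵇ-cong : ∀ {A : Set} {p q : A → Bool} xs → (∀ x → p x ≡ q x) → filterᵇ p xs ≡ filterᵇ q xs
filterᵇ-cong []       e = refl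
filterᵇ-cong {p = p} {q} (x ∷ xs) e with p x | q x | e x
... | true  | _ | refl = cong (x ∷_) (filterᵇ-cong xs e)
... | false | _ | refl = filterᵇ-cong xs e

module _ {n m} {ms : Vec ℕ n} (f : BoolFun (m ∷ ms)) where

  usat-promise : ∀ {b} → usat f ≡ ｛ b ｝ → length (witnesses f) ≤ 1 × SAT f ≡ b
  usat-promise e with length (witnesses f) ≤ᵇ 1 in le | e
  ... | true | refl = ≤ᵇ⇒≤ _ _ (Equivalence.from T-≡ le) , refl

  cousat-promise : ∀ {b} → cousat f ≡ ｛ b ｝ → length (counterexamples f) ≤ 1 × coSAT f ≡ b
  cousat-promise e with length (counterexamples f) ≤ᵇ 1 in le | e
  ... | true | refl = ≤ᵇ⇒≤ _ _ (Equivalence.from T-≡ le) , refl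

UniqueWitness : ∀ {m} → (Vec Bool m → Bool) → Set
UniqueWitness p = ∃[ x ] p x ≡ true × (∀ y → p y ≡ true → y ≡ x)

unique-witness : ∀ {m} (p : Vec Bool m → Bool) → length (filterᵇ p (words m)) ≤ 1 → any p (words m) ≡ true → UniqueWitness p
unique-witness {m} p ≤1 e =
  let x , px = Any.satisfied (any⁻ p (words m) (Equivalence.from T-≡ e)) in
  x , Equivalence.to T-≡ px , λ y py → filterᵇ-≤1 p ≤1 (words-complete y) (words-complete x) py (Equivalence.to T-≡ px)

no-witness : ∀ {m} (p : Vec Bool m → Bool) → any p (words m) ≡ false → ∀ x → p x ≡ false
no-witness {m} p e x with p x in px
... | false = refl
... | true  = contradiction (trans (sym e) (Equivalence.to T-≡ (any⁺ p (lose (words-complete x) (Equivalence.from T-≡ px))))) λ ()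

all-not : ∀ {A : Set} (p : A → Bool) xs → not (all p xs) ≡ any (not ∘ p) xs
all-not p []       = refl
all-not p (x ∷ xs) with p x
... | true  = all-not p xs
... | false = refl

flip : ∀ {m} → ℕ → Vec Bool m → Vec Bool m
flip j       []      = []
flip zero    (b ∷ x) = not b ∷ x
flip (suc j) (b ∷ x) = b ∷ flip j x

at-flip : ∀ {m d} j k (x : Vec Bool m) → k ≢ j → at d (flip j x) k ≡ at d x k
at-flip j       k       []      _   = refl
at-flip zero    zero    (b ∷ x) k≢j = contradiction refl k≢j
at-flip zero    (suc k) (b ∷ x) k≢j = refl
at-flip (suc j) zero    (b ∷ x) k≢j = refl
at-flip (suc j) (suc k) (b ∷ x) k≢j = at-flip j k x (k≢j ∘ cong suc)

flip-≢ : ∀ {m j} (x : Vec Bool m) → j < m → flip j x ≢ x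
flip-≢ {j = zero}  (b ∷ x) _         e = not-¬ {b} refl (sym (cong Vec.head e))
flip-≢ {j = suc j} (b ∷ x) (s≤s j<m) e = flip-≢ x j<m (cong Vec.tail e)

-- If every index below `m` occurred in `js`, sending it to its position would inject `Fin m` into a
-- smaller set.
missing : ∀ {m} (js : List ℕ) → length js < m → ∃[ j ] j < m × ¬ (j ∈ˡ js)
missing {m} js js<m with Fin.any? {n = m} (λ i → ¬? (toℕ i ∈? js))
... | yes (i , i∉) = toℕ i , toℕ<n i , i∉
... | no ¬i∉ = ⊥-elim (clash (pigeonhole js<m (λ i → Any.index (found i))))
  where
  found : ∀ i → toℕ i ∈ˡ js
  found i = decidable-stable (toℕ i ∈? js) (λ i∉ → ¬i∉ (i , i∉))
  clash : ∃[ i ] ∃[ j ] i Fin.< j × Any.index (found i) ≡ Any.index (found j) → ⊥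
  clash (i , j , i<j , e) = <⇒≢ i<j (trans (lookup-index (found i))
    (trans (cong (List.lookup js) e) (sym (lookup-index (found j)))))

-- A bit on which p does not depend can be flipped.
all-bits-used : ∀ {m} (p : Vec Bool m → Bool) (js : List ℕ) →
  (∀ x y → (∀ j → j ∈ˡ js → at false x j ≡ at false y j) → p x ≡ p y) → UniqueWitness p → m ≤ length js
all-bits-used {m} p js depends (x , px , only) with m ≤? length js
... | yes m≤ = m≤
... | no m≰ with j , j<m , j∉ ← missing js (≰⇒> m≰) =
  contradiction (only (flip j x) (trans (depends (flip j x) x λ k k∈ → at-flip j k x λ { refl → j∉ k∈ }) px)) (flip-≢ x j<m)

-- An environment does not depend on the dimensions, so that a formula and its image under `odd` can
-- be compared although they are scoped in different blocks.
evalN : Formula → (ℕ → ℕ → Bool) → Bool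
evalN (var i j) e = e i j
evalN bot       e = false
evalN (neg φ)   e = not (evalN φ e)
evalN (and φ ψ) e = evalN φ e ∧ evalN ψ e
evalN (or φ ψ)  e = evalN φ e ∨ evalN ψ e

env : ∀ {n} {ms : Vec ℕ n} → Blocks ms → ℕ → ℕ → Bool
env []       _       _ = false
env (x ∷ xs) zero    j = at false x j
env (x ∷ xs) (suc i) j = env xs i j

eval-env : ∀ {n} {ms : Vec ℕ n} φ (sc : InScope ms φ) xs → eval φ sc xs ≡ evalN φ (env xs)
eval-env (var i j) (b , refl , j<m) xs = block xs b j<m
  where
  bit : ∀ {m j} (x : Vec Bool m) (j<m : j < m) → lookup x (fromℕ< j<m) ≡ at false x j
  bit {j = zero}  (b ∷ x) _         = refl
  bit {j = suc j} (b ∷ x) (s≤s j<m) = bit x j<m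
  block : ∀ {n} {ms : Vec ℕ n} (xs : Blocks ms) b {j} (j<m : j < lookup ms b) →
          lookup (lookup⁺ xs b) (fromℕ< j<m) ≡ env xs (toℕ b) j
  block (x ∷ xs) Fin.zero    j<m = bit x j<m
  block (x ∷ xs) (Fin.suc b) j<m = block xs b j<m
eval-env bot       sc        xs = refl
eval-env (neg φ)   sc        xs = cong not (eval-env φ sc xs)
eval-env (and φ ψ) (p , q)   xs = cong₂ _∧_ (eval-env φ p xs) (eval-env ψ q xs)
eval-env (or φ ψ)  (p , q)   xs = cong₂ _∨_ (eval-env φ p xs) (eval-env ψ q xs)

odd : Formula → Formula
odd (var i j) = var i (1 + 2 * j)
odd bot       = bot
odd (neg φ)   = neg (odd φ)
odd (and φ ψ) = and (odd φ) (odd ψ)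
odd (or φ ψ)  = or (odd φ) (odd ψ)

eval-odd : ∀ {n} {ms ms′ : Vec ℕ n} φ (sc : InScope ms φ) (ys : Blocks ms′) → evalN (odd φ) (env ys) ≡ eval φ sc (restrict ys)
eval-odd {ms = ms} φ sc ys = trans (go φ sc) (sym (eval-env φ sc (restrict ys)))
  where
  var-odd : ∀ {n} {ms ms′ : Vec ℕ n} b {j} → j < lookup ms b → (ys : Blocks ms′) →
            env ys (toℕ b) (1 + 2 * j) ≡ env (restrict {ms = ms} ys) (toℕ b) j
  var-odd {ms = _ ∷ _} Fin.zero    j<m (y ∷ ys) = sym (at-tab false _ j<m)
  var-odd {ms = _ ∷ ms} (Fin.suc b) j<m (y ∷ ys) = var-odd {ms = ms} b j<m ys
  go : ∀ φ → InScope ms φ → evalN (odd φ) (env ys) ≡ evalN φ (env (restrict {ms = ms} ys))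
  go (var i j) (b , refl , j<m) = var-odd {ms = ms} b j<m ys
  go bot       sc      = refl
  go (neg φ)   sc      = cong not (go φ sc)
  go (and φ ψ) (p , q) = cong₂ _∧_ (go φ p) (go ψ q)
  go (or φ ψ)  (p , q) = cong₂ _∨_ (go φ p) (go ψ q)

odd-scoped : ∀ {n} {ms ms′ : Vec ℕ n} → Roomy ms ms′ → ∀ φ → InScope ms φ → InScope ms′ (odd φ)
odd-scoped ps (var i j) (b , e , j<m) = b , e , room ps b j<m
  where
  room : ∀ {n} {ms ms′ : Vec ℕ n} → Roomy ms ms′ → ∀ b {j} → j < lookup ms b → 1 + 2 * j < lookup ms′ b
  room (p ∷ ps) Fin.zero    j<m = <-≤-trans (1+2j<2m j<m) p
  room (p ∷ ps) (Fin.suc b) j<m = room ps b j<m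
odd-scoped ps bot       sc      = sc
odd-scoped ps (neg φ)   sc      = odd-scoped ps φ sc
odd-scoped ps (and φ ψ) (p , q) = odd-scoped ps φ p , odd-scoped ps ψ q
odd-scoped ps (or φ ψ)  (p , q) = odd-scoped ps φ p , odd-scoped ps ψ q

-- The block numbers are forgotten: only the length of this list is to be bounded, by the number of
-- symbols, and it contains every bit used of the first block.
indices : Formula → List ℕ
indices (var i j) = j ∷ []
indices bot       = []
indices (neg φ)   = indices φ
indices (and φ ψ) = indices φ ++ indices ψ
indices (or φ ψ)  = indices φ ++ indices ψ

evalN-first-block : ∀ {n m} {ms : Vec ℕ n} φ (x y : Vec Bool m) (ys : Blocks ms) →
  (∀ j → j ∈ˡ indices φ → at false x j ≡ at false y j) → evalN φ (env (x ∷ ys)) ≡ evalN φ (env (y ∷ ys))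
evalN-first-block (var zero j)    x y ys e = e j (here refl)
evalN-first-block (var (suc i) j) x y ys e = refl
evalN-first-block bot       x y ys e = refl
evalN-first-block (neg φ)   x y ys e = cong not (evalN-first-block φ x y ys e)
evalN-first-block (and φ ψ) x y ys e = cong₂ _∧_ (evalN-first-block φ x y ys λ j j∈ → e j (∈-++⁺ˡ j∈)) (evalN-first-block ψ x y ys λ j j∈ → e j (∈-++⁺ʳ (indices φ) j∈))
evalN-first-block (or φ ψ)  x y ys e = cong₂ _∨_ (evalN-first-block φ x y ys λ j j∈ → e j (∈-++⁺ˡ j∈)) (evalN-first-block ψ x y ys λ j j∈ → e j (∈-++⁺ʳ (indices φ) j∈))

eval-first-block : ∀ {n m} {ms : Vec ℕ n} φ (sc : InScope (m ∷ ms) φ) (x y : Vec Bool m) ys →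
  (∀ j → j ∈ˡ indices φ → at false x j ≡ at false y j) → eval φ sc (x ∷ ys) ≡ eval φ sc (y ∷ ys)
eval-first-block φ sc x y ys e = trans (eval-env φ sc (x ∷ ys)) (trans (evalN-first-block φ x y ys e) (sym (eval-env φ sc (y ∷ ys))))

-- Words and instances

reads : List Symbol → List Item → Maybe (List Item)
reads []       st = just st
reads (σ ∷ σs) st = reads σs st >>= push σ

parse-chunk : ∀ w {st} → parse w ≡ just st → reads (chunk w) [] ≡ just st
parse-chunk []              e = e
parse-chunk (a ∷ b ∷ c ∷ w) e with parse w in e′
... | just st = trans (cong (_>>= push (symbol a b c)) (parse-chunk w e′)) e

parse-ser : ∀ σs → parse (ser σs) ≡ reads σs []
parse-ser []       = refl
parse-ser (σ ∷ σs) = cong₂ (λ σ st → st >>= push σ) (symbol-bitsOf σ) (parse-ser σs)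

val : List Bool → ℕ
val []          = 0
val (false ∷ ds) = 2 * val ds
val (true ∷ ds)  = 1 + 2 * val ds

numeral : List Bool → List Symbol
numeral ds = map digitSymbol ds ++ `# ∷ []

numeral-reads : ∀ ds τs {st} → reads τs [] ≡ just st → reads (map digitSymbol ds ++ `# ∷ τs) [] ≡ just (num (val ds) ∷ st)
numeral-reads []           τs e rewrite e = refl
numeral-reads (false ∷ ds) τs e rewrite numeral-reads ds τs e = refl
numeral-reads (true ∷ ds)  τs e rewrite numeral-reads ds τs e = refl

-- A relation rather than a printing function: a number has many numerals, with zeros at the high
-- end, and the machine works on the digits actually present.
data Fml : List Symbol → Formula → Set where
  var : ∀ ds es → Fml (`x ∷ numeral ds ++ numeral es) (var (val ds) (val es))
  bot : Fml (`⊥ ∷ []) bot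
  neg : ∀ {u φ} → Fml u φ → Fml (`¬ ∷ u) (neg φ)
  and : ∀ {u v φ ψ} → Fml u φ → Fml v ψ → Fml (`∧ ∷ u ++ v) (and φ ψ)
  or  : ∀ {u v φ ψ} → Fml u φ → Fml v ψ → Fml (`∨ ∷ u ++ v) (or φ ψ)

numeral-++ : ∀ ds τs → numeral ds ++ τs ≡ map digitSymbol ds ++ `# ∷ τs
numeral-++ ds τs = ++-assoc (map digitSymbol ds) _ τs

fml-reads : ∀ {u φ} → Fml u φ → ∀ τs {st} → reads τs [] ≡ just st → reads (u ++ τs) [] ≡ just (fml φ ∷ st)
fml-reads (var ds es) τs e
  rewrite ++-assoc (numeral ds) (numeral es) τs | numeral-++ es τs | numeral-++ ds (map digitSymbol es ++ `# ∷ τs)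
        | numeral-reads ds (map digitSymbol es ++ `# ∷ τs) (numeral-reads es τs e) = refl
fml-reads bot         τs e rewrite e = refl
fml-reads (neg p)     τs e rewrite fml-reads p τs e = refl
fml-reads (and {u} {v} p q) τs e rewrite ++-assoc u v τs | fml-reads p (v ++ τs) (fml-reads q τs e) = refl
fml-reads (or {u} {v} p q)  τs e rewrite ++-assoc u v τs | fml-reads p (v ++ τs) (fml-reads q τs e) = refl

data Stack : List Symbol → List Item → Set where
  []  : Stack [] []
  num : ∀ {v st} ds → Stack v st → Stack (numeral ds ++ v) (num (val ds) ∷ st)
  fml : ∀ {u φ v st} → Fml u φ → Stack v st → Stack (u ++ v) (fml φ ∷ st)

push-sound : ∀ σ {σs st st′} → Stack σs st → push σ st ≡ just st′ → Stack (σ ∷ σs) st′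
push-sound `# p                       refl = num [] p
push-sound `0 (num ds p)              refl = num (false ∷ ds) p
push-sound `1 (num ds p)              refl = num (true ∷ ds) p
push-sound `x (num ds (num {v} es p)) refl =
  subst (λ u → Stack (`x ∷ u) _) (++-assoc (numeral ds) (numeral es) v) (fml (var ds es) p)
push-sound `⊥ p                       refl = fml bot p
push-sound `¬ (fml f p)               refl = fml (neg f) p
push-sound `∧ (fml {u} f (fml {u′} {v = v} g p)) refl =
  subst (λ u → Stack (`∧ ∷ u) _) (++-assoc u u′ v) (fml (and f g) p)
push-sound `∨ (fml {u} f (fml {u′} {v = v} g p)) refl =
  subst (λ u → Stack (`∨ ∷ u) _) (++-assoc u u′ v) (fml (or f g) p)

reads-sound : ∀ σs {st} → reads σs [] ≡ just st → Stack σs st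
reads-sound []       refl = []
reads-sound (σ ∷ σs) e with reads σs [] in e′
... | just st = push-sound σ (reads-sound σs e′) e

data Nums : ∀ {n} → List Symbol → Vec ℕ n → Set where
  []  : Nums [] []
  _∷_ : ∀ {n v} {ks : Vec ℕ n} ds → Nums v ks → Nums (numeral ds ++ v) (val ds ∷ ks)

record Spelling {n} (σs : List Symbol) (I : Instance n) : Set where
  constructor spelling
  field
    {fs ns} : List Symbol
    split   : σs ≡ fs ++ ns
    fml-fs  : Fml fs (Instance.formula I)
    nums-ns : Nums ns (Instance.dims I)

numbers-sound : ∀ n {v st ks} → Stack v st → numbers n st ≡ just ks → Nums v ks
numbers-sound zero    []         refl = []
numbers-sound (suc n) (num {st = st} ds p) e with numbers n st in e′ | e
... | just ks | refl = ds ∷ numbers-sound n p e′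

build-sound : ∀ {n} φ (ms : Vec ℕ n) {I} → build φ ms ≡ just I → Instance.dims I ≡ ms × Instance.formula I ≡ φ
build-sound φ ms e with VAll.all? nonZero? ms | inScope? ms φ | e
... | yes _ | yes _ | refl = refl , refl
... | yes _ | no _  | ()
... | no _  | _     | ()

decode-parse : ∀ n w {I} → decode n w ≡ just I →
  ∃[ st ] parse (toList w) ≡ just (fml (Instance.formula I) ∷ st) × numbers n st ≡ just (Instance.dims I)
decode-parse n w e with parse (toList w)
... | just (fml φ ∷ st) with numbers n st in e₂
...   | just ms with refl , refl ← build-sound φ ms e = st , refl , e₂

decode-spelling : ∀ n w {I} → decode n w ≡ just I → Spelling (chunk (toList w)) I
decode-spelling n w {I} e with st , e₁ , e₂ ← decode-parse n w e = go (reads-sound _ (parse-chunk (toList w) e₁))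
  where
  go : ∀ {σs} → Stack σs (fml (Instance.formula I) ∷ st) → Spelling σs I
  go (fml f p) = spelling refl f (numbers-sound n p e₂)

-- `build` takes its proofs from the decision procedures, so an instance comes back with proofs
-- other than those supplied. For this reason later statements about the formula are made for every
-- `sc`.
record Decoded {n} (φ : Formula) (ms : Vec ℕ n) (J : Maybe (Instance n)) : Set where
  constructor decoded
  field
    pos : VAll.All NonZero ms
    sc  : InScope ms φ
    eq  : J ≡ just record { dims = ms ; positive = pos ; formula = φ ; scoped = sc }

build-complete : ∀ {n} φ {ms : Vec ℕ n} → VAll.All NonZero ms → InScope ms φ → Decoded φ ms (build φ ms)
build-complete φ {ms} pos sc with VAll.all? nonZero? ms | inScope? ms φ
... | yes pos′ | yes sc′ = decoded pos′ sc′ refl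
... | yes _    | no ¬sc  = contradiction sc ¬sc
... | no ¬pos  | _       = contradiction pos ¬pos

nums : ∀ {n} → Vec ℕ n → List Item
nums []       = []
nums (k ∷ ks) = num k ∷ nums ks

numbers-nums : ∀ {n} (ks : Vec ℕ n) → numbers n (nums ks) ≡ just ks
numbers-nums []       = refl
numbers-nums (k ∷ ks) rewrite numbers-nums ks = refl

assemble-complete : ∀ {n} φ {ms : Vec ℕ n} {J} → J ≡ just (fml φ ∷ nums ms) → VAll.All NonZero ms → InScope ms φ →
                    Decoded φ ms (J >>= assemble n)
assemble-complete φ {ms} refl pos sc rewrite numbers-nums ms = build-complete φ pos sc

toList-ser⁺ : ∀ σs → toList (ser⁺ σs) ≡ ser (toList σs)
toList-ser⁺ (σ List⁺.∷ σs) = refl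

decode-complete : ∀ {n} σs φ {ms : Vec ℕ n} → reads (toList σs) [] ≡ just (fml φ ∷ nums ms) →
                  VAll.All NonZero ms → InScope ms φ → Decoded φ ms (decode n (ser⁺ σs))
decode-complete σs φ e pos sc = assemble-complete φ (trans (cong parse (toList-ser⁺ σs)) (trans (parse-ser (toList σs)) e)) pos sc

Fml-length : ∀ {u φ} → Fml u φ → length (indices φ) ≤ length u
Fml-length (var ds es) = s≤s z≤n
Fml-length bot         = z≤n
Fml-length (neg p)     = m≤n⇒m≤1+n (Fml-length p)
Fml-length (and {u} {v} {φ} {ψ} p q) = m≤n⇒m≤1+n (≤-trans (≤-reflexive (length-++ (indices φ)))
  (≤-trans (+-mono-≤ (Fml-length p) (Fml-length q)) (≤-reflexive (sym (length-++ u)))))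
Fml-length (or {u} {v} {φ} {ψ} p q) = m≤n⇒m≤1+n (≤-trans (≤-reflexive (length-++ (indices φ)))
  (≤-trans (+-mono-≤ (Fml-length p) (Fml-length q)) (≤-reflexive (sym (length-++ u)))))

double-numeral₁ : ∀ ds τs → double false (numeral ds ++ τs) ≡ numeral ds ++ `1 ∷ double true τs
double-numeral₁ []           τs = refl
double-numeral₁ (false ∷ ds) τs = cong (`0 ∷_) (double-numeral₁ ds τs)
double-numeral₁ (true ∷ ds)  τs = cong (`1 ∷_) (double-numeral₁ ds τs)

double-numeral₂ : ∀ ds τs → double true (numeral ds ++ τs) ≡ numeral ds ++ double false τs
double-numeral₂ []           τs = refl
double-numeral₂ (false ∷ ds) τs = cong (`0 ∷_) (double-numeral₂ ds τs)
double-numeral₂ (true ∷ ds)  τs = cong (`1 ∷_) (double-numeral₂ ds τs)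

-- Each variable has two numbers, so the flag is down again at the end of a formula, whatever
-- follows. The arbitrary continuation `τs` is what lets the induction pass from the first
-- subformula to the second.
double-fml : ∀ {u φ} → Fml u φ → ∃[ u′ ] Fml u′ (odd φ) × (∀ τs → double false (u ++ τs) ≡ u′ ++ double false τs)
double-fml (var ds es) = _ , var ds (true ∷ es) , λ τs → cong (`x ∷_) (begin
  double false ((numeral ds ++ numeral es) ++ τs)        ≡⟨ cong (double false) (++-assoc (numeral ds) _ τs) ⟩
  double false (numeral ds ++ numeral es ++ τs)          ≡⟨ double-numeral₁ ds _ ⟩
  numeral ds ++ `1 ∷ double true (numeral es ++ τs)      ≡⟨ cong (λ u → numeral ds ++ `1 ∷ u) (double-numeral₂ es τs) ⟩
  numeral ds ++ numeral (true ∷ es) ++ double false τs   ≡⟨ ++-assoc (numeral ds) _ _ ⟨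
  (numeral ds ++ numeral (true ∷ es)) ++ double false τs ∎)
  where open ≡-Reasoning
double-fml bot     = _ , bot , λ τs → refl
double-fml (neg p) = let _ , q , e = double-fml p in _ , neg q , λ τs → cong (`¬ ∷_) (e τs)
double-fml (and {u} {v} p q) = let u′ , p′ , e = double-fml p ; v′ , q′ , f = double-fml q in _ , and p′ q′ , λ τs →
  cong (`∧ ∷_) (trans (cong (double false) (++-assoc u v τs)) (trans (e (v ++ τs)) (trans (cong (u′ ++_) (f τs)) (sym (++-assoc u′ v′ _)))))
double-fml (or {u} {v} p q) = let u′ , p′ , e = double-fml p ; v′ , q′ , f = double-fml q in _ , or p′ q′ , λ τs →
  cong (`∨ ∷_) (trans (cong (double false) (++-assoc u v τs)) (trans (e (v ++ τs)) (trans (cong (u′ ++_) (f τs)) (sym (++-assoc u′ v′ _)))))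

Fml-double : ∀ {u φ} → Fml u φ → Fml (double false u) (odd φ)
Fml-double {u} p = let u′ , q , e = double-fml p in
  subst (λ v → Fml v _) (sym (trans (cong (double false) (sym (++-identityʳ u))) (trans (e []) (++-identityʳ u′)))) q

private
  numeral-ʳ++ : ∀ ds ρ → numeral ds ʳ++ ρ ≡ `# ∷ (map digitSymbol ds ʳ++ ρ)
  numeral-ʳ++ ds ρ = ++-ʳ++ (map digitSymbol ds)

  dropNumber-digits : ∀ ds ρ → dropNumber (map digitSymbol ds ʳ++ ρ) ≡ dropNumber ρ
  dropNumber-digits []           ρ = refl
  dropNumber-digits (false ∷ ds) ρ = dropNumber-digits ds (`0 ∷ ρ)
  dropNumber-digits (true ∷ ds)  ρ = dropNumber-digits ds (`1 ∷ ρ)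

  dropNumbers-nums : ∀ {k v} {ks : Vec ℕ k} → Nums v ks → ∀ ρ → dropNumbers (suc k) (v ʳ++ `# ∷ ρ) ≡ ρ
  dropNumbers-nums [] ρ = refl
  dropNumbers-nums {suc k} (_∷_ {v = v} ds p) ρ = trans (cong (dropNumber ∘ dropNumbers (suc k)) (trans (++-ʳ++ (numeral ds)) (cong (v ʳ++_) (numeral-ʳ++ ds (`# ∷ ρ)))))
    (trans (cong dropNumber (dropNumbers-nums p (map digitSymbol ds ʳ++ `# ∷ ρ))) (dropNumber-digits ds (`# ∷ ρ)))

  takeDigits-digits : ∀ ds ρ acc → takeDigits (map digitSymbol ds ʳ++ ρ) acc ≡ takeDigits ρ (ds ++ acc)
  takeDigits-digits []           ρ acc = refl
  takeDigits-digits (false ∷ ds) ρ acc = takeDigits-digits ds (`0 ∷ ρ) acc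
  takeDigits-digits (true ∷ ds)  ρ acc = takeDigits-digits ds (`1 ∷ ρ) acc

  -- The last symbol of a formula is a hash or ⊥, never a digit, so the digits of the first
  -- dimension end where the formula does.
  takeDigits-fml : ∀ {u φ} → Fml u φ → ∀ ρ acc → takeDigits (u ʳ++ ρ) acc ≡ (u ʳ++ ρ , acc)
  takeDigits-fml (var ds es) ρ acc rewrite ++-ʳ++ (numeral ds) {numeral es} {`x ∷ ρ} | numeral-ʳ++ es (numeral ds ʳ++ `x ∷ ρ) = refl
  takeDigits-fml bot         ρ acc = refl
  takeDigits-fml (neg p)     ρ acc = takeDigits-fml p (`¬ ∷ ρ) acc
  takeDigits-fml (and {u} {v} p q) ρ acc rewrite ++-ʳ++ u {v} {`∧ ∷ ρ} = takeDigits-fml q _ acc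
  takeDigits-fml (or {u} {v} p q)  ρ acc rewrite ++-ʳ++ u {v} {`∨ ∷ ρ} = takeDigits-fml q _ acc

  taken : ∀ {n u φ ds v} {ks : Vec ℕ n} → Fml u φ → Nums v ks →
          takeDigits (dropNumbers (suc n) ((u ++ numeral ds ++ v) ʳ++ [])) [] ≡ (u ʳ++ [] , ds)
  taken {n} {u} {ds = ds} {v} p q = begin
    takeDigits (dropNumbers (suc n) ((u ++ numeral ds ++ v) ʳ++ [])) []       ≡⟨ cong split (++-ʳ++ u) ⟩
    split ((numeral ds ++ v) ʳ++ u ʳ++ [])                                     ≡⟨ cong split (++-ʳ++ (numeral ds)) ⟩
    split (v ʳ++ numeral ds ʳ++ u ʳ++ [])                                      ≡⟨ cong (λ ρ → split (v ʳ++ ρ)) (numeral-ʳ++ ds _) ⟩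
    split (v ʳ++ `# ∷ (map digitSymbol ds ʳ++ u ʳ++ []))                       ≡⟨ cong (λ ρ → takeDigits ρ []) (dropNumbers-nums q _) ⟩
    takeDigits (map digitSymbol ds ʳ++ u ʳ++ []) []                            ≡⟨ takeDigits-digits ds _ [] ⟩
    takeDigits (u ʳ++ []) (ds ++ [])                                           ≡⟨ takeDigits-fml p [] _ ⟩
    (u ʳ++ [] , ds ++ [])                                                      ≡⟨ cong (u ʳ++ [] ,_) (++-identityʳ ds) ⟩
    (u ʳ++ [] , ds)                                                            ∎
    where
    open ≡-Reasoning
    split : List Symbol → List Symbol × List Bool
    split ρ = takeDigits (dropNumbers (suc n) ρ) []

formulaPart-spelling : ∀ {n u φ v} {ks : Vec ℕ n} ds → Fml u φ → Nums v ks → formulaPart (suc n) (u ++ numeral ds ++ v) ≡ u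
formulaPart-spelling {u = u} ds p q rewrite taken {ds = ds} p q = trans (ʳ++-ʳ++ u) (++-identityʳ u)

firstDimension-spelling : ∀ {n u φ v} {ks : Vec ℕ n} ds → Fml u φ → Nums v ks → firstDimension (suc n) (u ++ numeral ds ++ v) ≡ ds
firstDimension-spelling ds p q rewrite taken {ds = ds} p q = refl

-- The constraints

val-zeros : ∀ k → val (zeros k) ≡ 0
val-zeros zero    = refl
val-zeros (suc k) = cong (2 *_) (val-zeros k)

increment-false : ∀ c → increment false c ≡ c
increment-false []          = refl
increment-false (true ∷ c)  = cong (true ∷_) (increment-false c)
increment-false (false ∷ c) = cong (false ∷_) (increment-false c)

val-increment : ∀ c → suc (val c) < 2 ^ length c → val (increment true c) ≡ suc (val c)
val-increment []          (s≤s ())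
val-increment (false ∷ c) _  = cong (λ c → 1 + 2 * val c) (increment-false c)
val-increment (true ∷ c)  lt = trans (cong (2 *_) (val-increment c (*-cancelˡ-< 2 _ _ (≤-<-trans (≤-reflexive (*-suc 2 (val c))) lt))))
  (*-suc 2 (val c))

-- Hence a counter with s digits can reach s without overflow.
n<2^n : ∀ n → n < 2 ^ n
n<2^n zero    = s≤s z≤n
n<2^n (suc n) = begin-strict
  suc n          <⟨ s≤s (n<2^n n) ⟩
  1 + 2 ^ n      ≤⟨ +-monoˡ-≤ (2 ^ n) (m^n>0 2 n) ⟩
  2 ^ n + 2 ^ n  ≡⟨ cong (2 ^ n +_) (+-identityʳ (2 ^ n)) ⟨
  2 * 2 ^ n      ∎
  where open ≤-Reasoning

val<2^length : ∀ ds → val ds < 2 ^ length ds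
val<2^length []           = s≤s z≤n
val<2^length (false ∷ ds) = *-monoʳ-< 2 (val<2^length ds)
val<2^length (true ∷ ds)  = 1+2j<2m (val<2^length ds)

allOnes : List Bool → List Bool
allOnes = map (λ _ → true)

suc-val-allOnes : ∀ c → suc (val (allOnes c)) ≡ 2 ^ length c
suc-val-allOnes []      = refl
suc-val-allOnes (_ ∷ c) = trans (sym (*-suc 2 (val (allOnes c)))) (cong (2 *_) (suc-val-allOnes c))

-- Twice a number of d digits is below the power of 2 with exponent d + 1, while a numeral of ones
-- falls short by 1 of the power given by its length. So a row of ones is a large enough dimension
-- without any arithmetic on `ds`.
val-roomy : ∀ ds c → length ds < length c → 2 * val ds ≤ val (allOnes c)
val-roomy ds c lt = s≤s⁻¹ (begin
  suc (2 * val ds)        <⟨ 1+2j<2m (val<2^length ds) ⟩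
  2 * 2 ^ length ds       ≤⟨ ^-monoʳ-≤ 2 lt ⟩
  2 ^ length c            ≡⟨ suc-val-allOnes c ⟨
  suc (val (allOnes c))   ∎)
  where
  open ≤-Reasoning

digit-unique : ∀ x y {a b} → val (x ∷ []) + 2 * a ≡ val (y ∷ []) + 2 * b → x ≡ y × a ≡ b
digit-unique false false e = refl , *-cancelˡ-≡ _ _ 2 e
digit-unique false true  {a} {b} e = contradiction e (even≢odd a b)
digit-unique true  false {a} {b} e = contradiction (sym e) (even≢odd b a)
digit-unique true  true  e = refl , *-cancelˡ-≡ _ _ 2 (suc-injective e)

val-∷ : ∀ x c → val (x ∷ c) ≡ val (x ∷ []) + 2 * val c
val-∷ false c = refl
val-∷ true  c = refl

lowDigit : List Bool → Bool
lowDigit []      = false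
lowDigit (d ∷ _) = d

highDigits : List Bool → List Bool
highDigits []       = []
highDigits (_ ∷ ds) = ds

val-lowDigit-highDigits : ∀ ds → val ds ≡ val (lowDigit ds ∷ []) + 2 * val (highDigits ds)
val-lowDigit-highDigits []       = refl
val-lowDigit-highDigits (d ∷ ds) = val-∷ d ds

eqDigits-step : ∀ e x c ds → eqDigits e (x ∷ c) (digits ds) ≡ eqDigits (e ∧ not (x xor lowDigit ds)) c (digits (highDigits ds))
eqDigits-step e x c []       = refl
eqDigits-step e x c (d ∷ ds) = refl

private
  agree : ∀ e x d → e ∧ not (x xor d) ≡ true → e ≡ true × x ≡ d
  agree true false false _ = refl , refl
  agree true true  true  _ = refl , refl

  agree⁻ : ∀ x → not (x xor x) ≡ true
  agree⁻ false = refl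
  agree⁻ true  = refl

  length-highDigits : ∀ {ds k} → length ds ≤ suc k → length (highDigits ds) ≤ k
  length-highDigits {[]}     _       = z≤n
  length-highDigits {_ ∷ ds} (s≤s p) = p

eqDigits-sound : ∀ {e} c ds → length ds ≤ length c → eqDigits e c (digits ds) ≡ true → e ≡ true × val c ≡ val ds
eqDigits-sound []      []  _  q = q , refl
eqDigits-sound {e} (x ∷ c) ds le q with eqDigits-sound c (highDigits ds) (length-highDigits {ds} le) (trans (sym (eqDigits-step e x c ds)) q)
... | q′ , eq with agree e x (lowDigit ds) q′
...   | p , refl = p , trans (val-∷ x c) (trans (cong (λ v → val (x ∷ []) + 2 * v) eq) (sym (val-lowDigit-highDigits ds)))

eqDigits-complete : ∀ c ds → length ds ≤ length c → val c ≡ val ds → eqDigits true c (digits ds) ≡ true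
eqDigits-complete []      []  _  _  = refl
eqDigits-complete (x ∷ c) ds le eq
  with refl , eq′ ← digit-unique x (lowDigit ds) {val c} {val (highDigits ds)} (trans (sym (val-∷ x c)) (trans eq (val-lowDigit-highDigits ds)))
  = trans (eqDigits-step true (lowDigit ds) c ds) (trans (cong (λ e → eqDigits e c (digits (highDigits ds))) (agree⁻ (lowDigit ds)))
      (eqDigits-complete c (highDigits ds) (length-highDigits {ds} le) eq′))

record Flag (m k : ℕ) (r : Bool) : Set where
  constructor flag
  field
    to   : r ≡ true → m ≤ k
    from : m ≤ k → r ≡ true

-- `val ds ≤ suc k` splits into `val ds ≤ k`, which the flag records already, and `val ds ≡ suc k`,
-- which is the test just made; the bound on the length makes that test exact.
flag-step : ∀ ds {k c r} → Flag (val ds) k r → length ds ≤ length c → val c ≡ suc k →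
            Flag (val ds) (suc k) (r ∨ eqDigits true c (digits ds))
flag-step ds {k} {c} {r} (flag to from) le eq = flag (to′ r to) from′
  where
  to′ : ∀ r → (r ≡ true → val ds ≤ k) → r ∨ eqDigits true c (digits ds) ≡ true → val ds ≤ suc k
  to′ true  to p = m≤n⇒m≤1+n (to refl)
  to′ false to p = ≤-reflexive (trans (sym (proj₂ (eqDigits-sound c ds le p))) eq)
  from′ : val ds ≤ suc k → r ∨ eqDigits true c (digits ds) ≡ true
  from′ p with m≤n⇒m<n∨m≡n p
  ... | inj₁ (s≤s q) rewrite from q = refl
  ... | inj₂ q rewrite eqDigits-complete c ds le (trans eq (sym q)) = ∨-zeroʳ r

imp⁺ imp⁻ : ℕ → Formula
imp⁺ k = or (neg (var 0 0)) (var 0 k)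
imp⁻ k = or (var 0 0) (neg (var 0 k))

positive-reads : ∀ d c τs {ψ st} → reads τs [] ≡ just (fml ψ ∷ st) →
  reads (clauseWord positive d c ++ τs) [] ≡ just (fml (and (imp⁺ (val (d ∷ c))) ψ) ∷ st)
positive-reads d c τs e rewrite ++-assoc (map digitSymbol c) (`# ∷ []) τs | numeral-reads (d ∷ c) τs e = refl

negative-reads : ∀ d c τs {ψ st} → reads τs [] ≡ just (fml ψ ∷ st) →
  reads (clauseWord negative d c ++ τs) [] ≡ just (fml (and (imp⁻ (val (d ∷ c))) ψ) ∷ st)
negative-reads d c τs e rewrite ++-assoc (map digitSymbol c) (`# ∷ []) τs | numeral-reads (d ∷ c) τs e = refl

module Chain (ds₁ ds₂ : List Bool) (s : ℕ) (ds₁≤s : length ds₁ ≤ s) (ds₂≤s : length ds₂ ≤ s) where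

  chain : ℕ → Counter → Formula
  chain zero    _                     = neg bot
  chain (suc k) st@(c , r₁ , r₂) =
    and (imp⁺ (val (false ∷ c))) (and (imp⁻ (val (false ∷ c))) (and (imp⁺ (val (r₁ ∷ c))) (and (imp⁻ (val (r₂ ∷ c)))
      (chain k (advanceCounter ds₁ ds₂ st)))))

  chain-reads : ∀ k st τs {xs} → reads τs [] ≡ just (fml (neg bot) ∷ xs) →
                reads (constraints ds₁ ds₂ k st ++ τs) [] ≡ just (fml (chain k st) ∷ xs)
  chain-reads zero    st                τs e = e
  chain-reads (suc k) st@(c , r₁ , r₂) τs {xs} e = trans (cong (λ u → reads u []) shape)
    (positive-reads false c _ (negative-reads false c _ (positive-reads r₁ c _ (negative-reads r₂ c _
      (chain-reads k (advanceCounter ds₁ ds₂ st) τs e)))))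
    where
    A = clauseWord positive false c
    B = clauseWord negative false c
    C = clauseWord positive r₁ c
    D = clauseWord negative r₂ c
    K = constraints ds₁ ds₂ k (advanceCounter ds₁ ds₂ st)
    shape : ((A ++ B ++ C ++ D) ++ K) ++ τs ≡ A ++ B ++ C ++ D ++ K ++ τs
    shape = trans (++-assoc (A ++ B ++ C ++ D) K τs) (trans (++-assoc A (B ++ C ++ D) _)
      (cong (A ++_) (trans (++-assoc B (C ++ D) _) (cong (B ++_) (++-assoc C D _)))))

  record Inv (k : ℕ) (st : Counter) : Set where
    constructor inv
    field
      len   : length (proj₁ st) ≡ s
      val≡  : val (proj₁ st) ≡ k
      flag₁ : Flag (val ds₁) k (proj₁ (proj₂ st))
      flag₂ : Flag (val ds₂) k (proj₂ (proj₂ st))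

  inv-step : ∀ {k st} → k < s → Inv k st → Inv (suc k) (advanceCounter ds₁ ds₂ st)
  inv-step {k} {c , r₁ , r₂} k<s (inv len v f₁ f₂) = inv len′ v′
    (flag-step ds₁ {c = increment true c} f₁ (≤-trans ds₁≤s (≤-reflexive (sym len′))) v′) (flag-step ds₂ {c = increment true c} f₂ (≤-trans ds₂≤s (≤-reflexive (sym len′))) v′)
    where
    len′ = trans (length-increment true c) len
    v′ : val (increment true c) ≡ suc k
    v′ = trans (val-increment c (subst₂ (λ v l → suc v < 2 ^ l) (sym v) (sym len) (≤-<-trans k<s (n<2^n s)))) (cong suc v)

  inv-final : ∀ k {j st} → j + k ≤ s → Inv j st → Inv (j + k) (finalCounter ds₁ ds₂ k st)
  inv-final zero    {j} {st} le i = subst (λ j → Inv j st) (sym (+-identityʳ j)) i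
  inv-final (suc k) {j} {st} le i rewrite +-suc j k =
    inv-final k le (inv-step (≤-trans (s≤s (m≤m+n j k)) le) i)

  module _ (m₁>0 : 0 < val ds₁) (m₂>0 : 0 < val ds₂) where

    inv-start : Inv 0 (zeros s , false , false)
    inv-start = inv (length-replicate s) (val-zeros s)
      -- Both registers are rightly clear at counter value 0, because dimensions are positive.
      (flag (λ ()) (λ le → contradiction m₁>0 (≤⇒≯ le))) (flag (λ ()) (λ le → contradiction m₂>0 (≤⇒≯ le)))

  limit : Bool → ℕ
  limit b = if b then val ds₁ else val ds₂

  -- What round `j` forces: bit 0 plays the role of b, and an odd bit is forced only if it lies
  -- beyond the block of the instance that b selects.
  Settled : (ℕ → Bool) → ℕ → Set
  Settled e j = e (2 * j) ≡ e 0 × (limit (e 0) ≤ j → e (1 + 2 * j) ≡ e 0)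

  private
    clausesHold : (b x₀ x₁ x₂ r : Bool) → Bool
    clausesHold b x₀ x₁ x₂ r = (not b ∨ x₀) ∧ ((b ∨ not x₀) ∧ ((not b ∨ x₁) ∧ ((b ∨ not x₂) ∧ r)))

    split : ∀ b x₀ x₁ x₂ r → clausesHold b x₀ x₁ x₂ r ≡ true → x₀ ≡ b × (if b then x₁ else x₂) ≡ b × r ≡ true
    split true  true  true  _     true _ = refl , refl , refl
    split false false _     false true _ = refl , refl , refl

    join : ∀ b x₀ x₁ x₂ r → x₀ ≡ b → (if b then x₁ else x₂) ≡ b → r ≡ true → clausesHold b x₀ x₁ x₂ r ≡ true
    join true  _ _ _ _ refl refl refl = refl
    join false _ _ _ _ refl refl refl = refl

  chain-sound : ∀ k {j₀ st} e → j₀ + k ≤ s → Inv j₀ st → evalN (chain k st) (λ _ → e) ≡ true →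
                ∀ {j} → j₀ ≤ j → j < j₀ + k → Settled e j
  chain-sound zero    {j₀} e le i p {j} lo hi = contradiction (≤-trans hi (≤-reflexive (+-identityʳ j₀))) (≤⇒≯ lo)
  chain-sound (suc k) {j₀} {st@(c , r₁ , r₂)} e le i@(inv len v f₁ f₂) p {j} lo hi
    with split (e 0) (e (val (false ∷ c))) (e (val (r₁ ∷ c))) (e (val (r₂ ∷ c))) _ p | m≤n⇒m<n∨m≡n lo
  ... | _ , _ , p′ | inj₁ lt = chain-sound k e (≤-trans (≤-reflexive (sym (+-suc j₀ k))) le)
    (inv-step (≤-trans (s≤s (m≤m+n j₀ k)) (≤-trans (≤-reflexive (sym (+-suc j₀ k))) le)) i) p′ lt (≤-trans hi (≤-reflexive (+-suc j₀ k)))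
  ... | x₀ , x₁₂ , _ | inj₂ refl with refl ← v = x₀ , odd-bit (e 0) refl x₁₂
    where
    odd-bit : ∀ b → b ≡ e 0 → (if b then e (val (r₁ ∷ c)) else e (val (r₂ ∷ c))) ≡ b → limit b ≤ val c → e (1 + 2 * val c) ≡ b
    odd-bit true  _ q l with refl ← Flag.from f₁ l = q
    odd-bit false _ q l with refl ← Flag.from f₂ l = q

  chain-complete : ∀ k {j₀ st} e → j₀ + k ≤ s → Inv j₀ st → (∀ {j} → j₀ ≤ j → j < j₀ + k → Settled e j) →
                   evalN (chain k st) (λ _ → e) ≡ true
  chain-complete zero    e le i settled = refl
  chain-complete (suc k) {j₀} {st@(c , r₁ , r₂)} e le i@(inv len v f₁ f₂) settled with refl ← v =
    join (e 0) (e (val (false ∷ c))) (e (val (r₁ ∷ c))) (e (val (r₂ ∷ c))) _ (proj₁ now) (odd-bit (e 0) (proj₁ now) (proj₂ now))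
      (chain-complete k e le′ (inv-step (≤-trans (s≤s (m≤m+n j₀ k)) le′) i)
        (λ lo hi → settled (≤-trans (n≤1+n _) lo) (≤-trans hi (≤-reflexive (sym (+-suc j₀ k))))))
    where
    le′ = ≤-trans (≤-reflexive (sym (+-suc j₀ k))) le
    now = settled ≤-refl (m<m+n j₀ z<s)
    -- A set register makes the clause speak of the odd bit, which is then beyond the limit; a clear
    -- one makes it speak of the even bit once more.
    pick : ∀ {m r b} → Flag m (val c) r → e (2 * val c) ≡ b → (m ≤ val c → e (1 + 2 * val c) ≡ b) → e (val (r ∷ c)) ≡ b
    pick {r = true}  f q₀ q₁ = q₁ (Flag.to f refl)
    pick {r = false} f q₀ q₁ = q₀
    odd-bit : ∀ b → e (2 * val c) ≡ b → (limit b ≤ val c → e (1 + 2 * val c) ≡ b) → (if b then e (val (r₁ ∷ c)) else e (val (r₂ ∷ c))) ≡ b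
    odd-bit true  q₀ q₁ = pick f₁ q₀ q₁
    odd-bit false q₀ q₁ = pick f₂ q₀ q₁

  chain-scoped : ∀ k {j₀ st n} {ms : Vec ℕ n} → j₀ + k ≤ s → Inv j₀ st → 0 < s → InScope (2 * s ∷ ms) (chain k st)
  chain-scoped zero    le i s>0 = tt
  chain-scoped (suc k) {j₀} {st@(c , r₁ , r₂)} {ms = ms} le i@(inv len v f₁ f₂) s>0 with refl ← v =
    (b , small false) , (b , small false) , (b , small r₁) , (b , small r₂) ,
    chain-scoped k le′ (inv-step c<s i) s>0
    where
    le′ = ≤-trans (≤-reflexive (sym (+-suc j₀ k))) le
    c<s : val c < s
    c<s = ≤-trans (s≤s (m≤m+n j₀ k)) le′
    b : ∃[ b ] toℕ b ≡ 0 × 0 < Vec.lookup (2 * s ∷ ms) b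
    b = Fin.zero , refl , *-monoʳ-< 2 s>0
    small : ∀ r → ∃[ b ] toℕ b ≡ 0 × val (r ∷ c) < Vec.lookup (2 * s ∷ ms) b
    small false = Fin.zero , refl , *-monoʳ-< 2 c<s
    small true  = Fin.zero , refl , 1+2j<2m c<s

  -- The constraints mention block 0 only, so they stay constant under the quantifiers over the
  -- other blocks.
  chain-cong : ∀ k st {e e′ : ℕ → ℕ → Bool} → (∀ j → e 0 j ≡ e′ 0 j) → evalN (chain k st) e ≡ evalN (chain k st) e′
  chain-cong zero    st                q = refl
  chain-cong (suc k) st@(c , r₁ , r₂) {e} {e′} q
    rewrite q 0 | q (val (false ∷ c)) | q (val (r₁ ∷ c)) | q (val (r₂ ∷ c)) | chain-cong k (advanceCounter ds₁ ds₂ st) {e} {e′} q = refl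

-- The combined instance

at-beyond : ∀ {m d} (x : Vec Bool m) {j} → m ≤ j → at d x j ≡ d
at-beyond []      _         = refl
at-beyond (b ∷ x) (s≤s m≤j) = at-beyond x m≤j

parity : ∀ i → ∃[ j ] (i ≡ 2 * j ⊎ i ≡ 1 + 2 * j)
parity zero = 0 , inj₁ refl
parity (suc i) with parity i
... | j , inj₁ e = j , inj₂ (cong suc e)
... | j , inj₂ e = suc j , inj₁ (trans (cong suc e) (sym (*-suc 2 j)))

-- Even positions and odd positions beyond the end of `x` are settled to b; the remaining odd
-- positions are the bits of `odds y`, hence those of `x`.
padded-unique : ∀ b {m s} (x : Vec Bool m) (y : Vec Bool (2 * s)) → odds y ≡ x →
  (∀ {j} → j < s → at false y (2 * j) ≡ b × (m ≤ j → at false y (1 + 2 * j) ≡ b)) → y ≡ padded b x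
padded-unique b {m} {s} x y e settled = at-ext y (padded b x) bits
  where
  bits : ∀ i → i < 2 * s → at false y i ≡ at false (padded {m′ = 2 * s} b x) i
  bits i i<2s with parity i
  ... | j , inj₁ refl = trans (proj₁ (settled (*-cancelˡ-< 2 j s i<2s))) (sym (trans (at-tab false _ i<2s) (spread-even b (at b x) j)))
  ... | j , inj₂ refl = trans odd-bit (sym (trans (at-tab false _ i<2s) (spread-odd b (at b x) j)))
    where
    odd-bit : at false y (1 + 2 * j) ≡ at b x j
    odd-bit with m ≤? j
    ... | yes m≤j = trans (proj₂ (settled (*-cancelˡ-< 2 j s (≤-trans (n≤1+n _) i<2s))) m≤j) (sym (at-beyond x m≤j))
    ... | no  m≰j = trans (sym (at-tab b _ (≰⇒> m≰j))) (cong (λ x → at b x j) e)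

UniqueStarting : ∀ {m} → Bool → (Vec Bool m → Bool) → Set
UniqueStarting b p = ∃[ z ] p z ≡ true × at false z 0 ≡ b × (∀ y → p y ≡ true → y ≡ z)

uval-decoded : ∀ {n φ m} {ms : Vec ℕ n} {J b} → Decoded φ (m ∷ ms) J →
  (∀ sc → UniqueStarting b (λ z → coSAT (fix (eval {ms = m ∷ ms} φ sc) z))) → onInstances uvalI J ≡ ｛ b ｝
uval-decoded {φ = φ} {suc m} (decoded (_ ∷ _) sc refl) unique with unique sc
... | (_ ∷ _) , pz , refl , only = uval-unique (eval φ sc) _ pz only

-- The double negation in front gives both words the same first symbol, so that `constant` is
-- visibly nonempty before `b` is known.
constantFormula : Bool → Formula
constantFormula true  = neg (neg (var 0 0))
constantFormula false = neg (neg (neg (var 0 0)))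

units-reads : ∀ n → reads (units n) [] ≡ just (nums (Vec.replicate n 1))
units-reads zero = refl
units-reads (suc n) rewrite units-reads n = refl

constant-reads : ∀ b n → reads (toList (constant b n)) [] ≡ just (fml (constantFormula b) ∷ nums (Vec.replicate n 1))
constant-reads true  n rewrite units-reads n = refl
constant-reads false n rewrite units-reads n = refl

UVAL-constant : ∀ b n → UVAL (suc n) (ser⁺ (constant b (suc n))) ≡ ｛ b ｝
UVAL-constant b n = uval-decoded {φ = constantFormula b}
  (decode-complete (constant b (suc n)) (constantFormula b) (constant-reads b (suc n)) (allNonZero (suc n)) (scoped b))
  (λ sc → (b ∷ []) , trans (coSAT-iff b sc b) (iff-refl b) , refl , only b sc)
  where
  allNonZero : ∀ n → VAll.All NonZero (Vec.replicate n 1)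
  allNonZero zero    = []
  allNonZero (suc n) = nonZero ∷ allNonZero n
  scoped : ∀ b → InScope (Vec.replicate (suc n) 1) (constantFormula b)
  scoped true  = Fin.zero , refl , s≤s z≤n
  scoped false = Fin.zero , refl , s≤s z≤n
  iff : Bool → Bool → Bool
  iff true  a = a
  iff false a = not a
  iff-refl : ∀ b → iff b b ≡ true
  iff-refl true  = refl
  iff-refl false = refl
  evaluate : ∀ b e → evalN (constantFormula b) e ≡ iff b (e 0 0)
  evaluate true  e = not-involutive (e 0 0)
  evaluate false e = not-involutive (not (e 0 0))
  coSAT-iff : ∀ b sc a → coSAT {ms = Vec.replicate n 1} (fix (eval {ms = Vec.replicate (suc n) 1} (constantFormula b) sc) (a ∷ [])) ≡ iff b a
  coSAT-iff b sc a = trans (coSAT-cong (λ ys → trans (eval-env (constantFormula b) sc ((a ∷ []) ∷ ys)) (evaluate b _))) (coSAT-const (Vec.replicate n 1) (iff b a))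
  only : ∀ b sc y → coSAT (fix (eval {ms = Vec.replicate (suc n) 1} (constantFormula b) sc) y) ≡ true → y ≡ b ∷ []
  only b sc (a ∷ []) e = cong (_∷ []) (iff-true b a (trans (sym (coSAT-iff b sc a)) e))
    where
    iff-true : ∀ b a → iff b a ≡ true → a ≡ b
    iff-true true  a     e = e
    iff-true false false e = refl

onesWord-reads : ∀ n c → reads (onesWord n c) [] ≡ just (nums (Vec.replicate n (val (allOnes c))))
onesWord-reads zero    c = refl
onesWord-reads (suc n) c = trans (cong (λ u → reads (u ++ `# ∷ onesWord n c) []) (map-∘ c))
  (numeral-reads (allOnes c) (onesWord n c) (onesWord-reads n c))

length-numeral : ∀ ds → length (numeral ds) ≡ suc (length ds)
length-numeral ds = trans (length-++ (map digitSymbol ds)) (trans (+-comm _ 1) (cong suc (length-map digitSymbol ds)))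

-- Its hash makes a numeral longer than its row of digits; this provides the strict inequality that
-- `val-roomy` asks for.
nums-roomy : ∀ {n v} {ks : Vec ℕ n} {c} → Nums v ks → length v ≤ length c → Roomy ks (Vec.replicate n (val (allOnes c)))
nums-roomy []                           le = []
nums-roomy {c = c} (_∷_ {v = v} ds p) le =
  val-roomy ds c (≤-trans (≤-trans (m≤m+n _ (length v)) (≤-reflexive len)) le) ∷ nums-roomy {c = c} p (≤-trans (≤-trans (m≤n+m _ _) (≤-reflexive len)) le)
  where
  len : suc (length ds) + length v ≡ length (numeral ds ++ v)
  len = sym (trans (length-++ (numeral ds)) (cong (_+ length v) (length-numeral ds)))

-- The left sides of `bound₁` and `bound₂` count the symbols of the two instances: the formula, the
-- first dimension with its hash, and the remaining dimensions.
module Combined {n u₁ φ₁ v₁ u₂ φ₂ v₂} {ms₁ ms₂ : Vec ℕ n} (ds₁ ds₂ : List Bool)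
  (p₁ : Fml u₁ φ₁) (p₂ : Fml u₂ φ₂) (q₁ : Nums v₁ ms₁) (q₂ : Nums v₂ ms₂)
  (m₁>0 : 0 < val ds₁) (m₂>0 : 0 < val ds₂)
  (sc₁ : InScope (val ds₁ ∷ ms₁) φ₁) (sc₂ : InScope (val ds₂ ∷ ms₂) φ₂)
  (s : ℕ) (bound₁ : length u₁ + suc (length ds₁ + length v₁) ≤ s) (bound₂ : length u₂ + suc (length ds₂ + length v₂) ≤ s) where

  private
    part : ∀ {u d v} → u + suc (d + v) ≤ s → u ≤ s × d ≤ s × v ≤ s
    part {u} {d} {v} le = ≤-trans (m≤m+n u _) le , ≤-trans (m≤m+n d v) dv , ≤-trans (m≤n+m v d) dv
      where
      dv : d + v ≤ s
      dv = ≤-trans (n≤1+n _) (≤-trans (m≤n+m _ u) le)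

    s>0 : 0 < s
    s>0 = ≤-trans (s≤s z≤n) (≤-trans (m≤n+m _ (length u₁)) bound₁)

  open Chain ds₁ ds₂ s (proj₁ (proj₂ (part {length u₁} bound₁))) (proj₁ (proj₂ (part {length u₂} bound₂)))

  private
    counter₀ : Counter
    counter₀ = zeros s , false , false
    c  = proj₁ (counterAfter s ds₁ ds₂)
    r₁ = proj₁ (proj₂ (counterAfter s ds₁ ds₂))
    r₂ = proj₂ (proj₂ (counterAfter s ds₁ ds₂))

    inv₀ : Inv 0 counter₀
    inv₀ = inv-start m₁>0 m₂>0

    invₛ : Inv s (c , r₁ , r₂)
    invₛ = inv-final s ≤-refl inv₀

    b₀ : Formula
    b₀ = var 0 0

    φ : Formula
    φ = and (or (and b₀ (odd φ₁)) (and (neg b₀) (neg (odd φ₂)))) (chain s counter₀)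

    Ms : Vec ℕ n
    Ms = Vec.replicate n (val (allOnes c))

    f : BoolFun (val ds₁ ∷ ms₁)
    f = eval φ₁ sc₁

    g : BoolFun (val ds₂ ∷ ms₂)
    g = eval φ₂ sc₂

  W₁ : Vec Bool (val ds₁) → Bool
  W₁ x = coSAT (fix f x)

  W₂ : Vec Bool (val ds₂) → Bool
  W₂ x = not (SAT (fix g x))

  private
    joined-reads : reads (toList (joined n s u₁ u₂ ds₁ ds₂)) [] ≡ just (fml φ ∷ nums (2 * s ∷ Ms))
    -- The word is read from its right end, and the nested pushes are those of `open₁`, `open₂` and
    -- `close`. The first dimension comes out as twice the value of the final counter, which the
    -- invariant identifies with s.
    joined-reads = subst (λ k → reads (toList (joined n s u₁ u₂ ds₁ ds₂)) [] ≡ just (fml φ ∷ num (2 * k) ∷ nums Ms)) (Inv.val≡ invₛ)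
      (cong (λ J → (((((J >>= push `#) >>= push `#) >>= push `x) >>= push `∧) >>= push `∨) >>= push `∧)
        (fml-reads (Fml-double p₁) _
          (cong (λ J → (((((J >>= push `¬) >>= push `#) >>= push `#) >>= push `x) >>= push `¬) >>= push `∧)
            (fml-reads (Fml-double p₂) _
              (chain-reads s counter₀ _
                (cong (λ J → (J >>= push `⊥) >>= push `¬)
                  (numeral-reads (false ∷ c) (onesWord n c) (onesWord-reads n c))))))))

    tailRoomy₁ : Roomy ms₁ Ms
    tailRoomy₁ = nums-roomy {c = c} q₁ (≤-trans (proj₂ (proj₂ (part {length u₁} bound₁))) (≤-reflexive (sym (Inv.len invₛ))))

    tailRoomy₂ : Roomy ms₂ Ms
    tailRoomy₂ = nums-roomy {c = c} q₂ (≤-trans (proj₂ (proj₂ (part {length u₂} bound₂))) (≤-reflexive (sym (Inv.len invₛ))))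

    allNonZero : VAll.All NonZero (2 * s ∷ Ms)
    allNonZero = >-nonZero (*-monoʳ-< 2 s>0) ∷ dims-nonZero n
      where
      1≤ : ∀ c → 0 < length c → 0 < val (allOnes c)
      1≤ (_ ∷ _) _ = s≤s z≤n
      dims-nonZero : ∀ n → VAll.All NonZero (Vec.replicate n (val (allOnes c)))
      dims-nonZero zero    = []
      dims-nonZero (suc n) = >-nonZero (1≤ c (subst (0 <_) (sym (Inv.len invₛ)) s>0)) ∷ dims-nonZero n

  module _ (m₁≤s : val ds₁ ≤ s) (m₂≤s : val ds₂ ≤ s) where

    private
      scoped : InScope (2 * s ∷ Ms) φ
      scoped = ((bit , odd-scoped (*-monoʳ-≤ 2 m₁≤s ∷ tailRoomy₁) φ₁ sc₁) , (bit , odd-scoped (*-monoʳ-≤ 2 m₂≤s ∷ tailRoomy₂) φ₂ sc₂))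
        , chain-scoped s ≤-refl inv₀ s>0
        where
        bit : InScope (2 * s ∷ Ms) b₀
        bit = Fin.zero , refl , *-monoʳ-< 2 s>0

      K : Vec Bool (2 * s) → Bool
      K z = evalN (chain s counter₀) (λ _ → at false z)

      module _ (sc : InScope (2 * s ∷ Ms) φ) where

        p : Vec Bool (2 * s) → Bool
        p z = coSAT (fix (eval φ sc) z)

        -- The constraints and b depend on the first block only and so come out of the remaining
        -- quantifiers. What is left is f or ¬ g on restricted blocks, and negation exchanges `SAT`
        -- and `coSAT`: witnesses starting with 0 correspond to counterexamples of g.
        p-spec : ∀ z → p z ≡ K z ∧ (if at false z 0 then W₁ (odds z) else W₂ (odds z))
        p-spec z = trans (coSAT-cong chosen) (cases (K z) (at false z 0))
          where
          if-form : ∀ b {x y} → (b ∧ x) ∨ (not b ∧ not y) ≡ (if b then x else not y)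
          if-form true  = ∨-identityʳ _
          if-form false = refl
          choice : Bool → Bool → BoolFun Ms
          choice k b ys = (if b then f (odds z ∷ restrict ys) else not (g (odds z ∷ restrict ys))) ∧ k
          chosen : ∀ ys → eval φ sc (z ∷ ys) ≡ choice (K z) (at false z 0) ys
          chosen ys = trans (eval-env φ sc (z ∷ ys)) (cong₂ _∧_
            (trans (if-form (at false z 0)) (cong₂ (λ x y → if at false z 0 then x else not y) (eval-odd φ₁ sc₁ (z ∷ ys)) (eval-odd φ₂ sc₂ (z ∷ ys))))
            (chain-cong s counter₀ (λ _ → refl)))
          cases : ∀ k b → coSAT (choice k b) ≡ k ∧ (if b then W₁ (odds z) else W₂ (odds z))
          cases false b     = trans (coSAT-cong {ms = Ms} {choice false b} {λ _ → false} (λ ys → ∧-zeroʳ _)) (coSAT-const Ms false)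
          cases true  true  = trans (coSAT-cong {ms = Ms} {choice true true} {fix f (odds z) ∘ restrict} (λ ys → ∧-identityʳ _)) (coSAT-restrict tailRoomy₁ (fix f (odds z)))
          cases true  false = trans (coSAT-cong {ms = Ms} {choice true false} {not ∘ fix g (odds z) ∘ restrict} (λ ys → ∧-identityʳ _))
            (trans (coSAT-restrict tailRoomy₂ (not ∘ fix g (odds z))) (coSAT-not (fix g (odds z))))

        -- Serves both values of b: `this` describes the witnesses that start with b through `W`,
        -- and `other` excludes those that start with the opposite bit.
        unique : ∀ b {m} (W : Vec Bool m → Bool) → limit b ≡ m → m ≤ s → UniqueWitness W →
          (∀ z → at false z 0 ≡ b → p z ≡ K z ∧ W (odds z)) → (∀ z → at false z 0 ≡ not b → p z ≡ false) → UniqueStarting b p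
        unique b {m} W refl m≤s (x , Wx , only) this other = z , trans (this z z₀) (cong₂ _∧_ Kz (trans (cong W odds-z) Wx)) , z₀ , only-z
          where
          z : Vec Bool (2 * s)
          z = padded b x
          at-z : ∀ {i} → i < 2 * s → at false z i ≡ spread b (at b x) i
          at-z = at-tab false _
          z₀ : at false z 0 ≡ b
          z₀ = at-z (*-monoʳ-< 2 s>0)
          odds-z : odds z ≡ x
          odds-z = odds-padded b (*-monoʳ-≤ 2 m≤s) x
          Kz : K z ≡ true
          Kz = chain-complete s (at false z) ≤-refl inv₀ λ {j} _ j<s →
            trans (at-z (*-monoʳ-< 2 j<s)) (trans (spread-even b _ j) (sym z₀)) ,
            λ le → trans (at-z (1+2j<2m j<s)) (trans (spread-odd b _ j) (trans (at-beyond x (subst (λ b → limit b ≤ j) z₀ le)) (sym z₀)))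
          only-z : ∀ y → p y ≡ true → y ≡ z
          only-z y py with at false y 0 Bool.≟ b
          ... | no  y₀≢b = contradiction (trans (sym py) (other y (¬-not y₀≢b))) λ ()
          ... | yes y₀≡b with K y in Ky | trans (sym (this y y₀≡b)) py
          ...   | true | Wy = padded-unique b x y (only (odds y) Wy) λ {j} j<s →
            let settled = chain-sound s (at false y) ≤-refl inv₀ Ky z≤n j<s in
            trans (proj₁ settled) y₀≡b , λ m≤j → trans (proj₂ settled (subst (λ b → limit b ≤ j) (sym y₀≡b) m≤j)) y₀≡b

        unique₁ : UniqueWitness W₁ → (∀ x → W₂ x ≡ false) → UniqueStarting true p
        unique₁ uw none = unique true W₁ refl m₁≤s uw
          (λ z e → trans (p-spec z) (cong (λ b → K z ∧ (if b then W₁ (odds z) else W₂ (odds z))) e))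
          (λ z e → trans (p-spec z) (trans (cong (λ b → K z ∧ (if b then W₁ (odds z) else W₂ (odds z))) e)
            (trans (cong (K z ∧_) (none (odds z))) (∧-zeroʳ (K z)))))

        unique₂ : UniqueWitness W₂ → (∀ x → W₁ x ≡ false) → UniqueStarting false p
        unique₂ uw none = unique false W₂ refl m₂≤s uw
          (λ z e → trans (p-spec z) (cong (λ b → K z ∧ (if b then W₁ (odds z) else W₂ (odds z))) e))
          (λ z e → trans (p-spec z) (trans (cong (λ b → K z ∧ (if b then W₁ (odds z) else W₂ (odds z))) e)
            (trans (cong (K z ∧_) (none (odds z))) (∧-zeroʳ (K z)))))

    UVAL-joined : ∀ b → (if b then UniqueWitness W₁ × (∀ x → W₂ x ≡ false) else UniqueWitness W₂ × (∀ x → W₁ x ≡ false)) →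
                  UVAL (suc n) (ser⁺ (joined n s u₁ u₂ ds₁ ds₂)) ≡ ｛ b ｝
    UVAL-joined b h = uval-decoded {φ = φ} (decode-complete (joined n s u₁ u₂ ds₁ ds₂) φ joined-reads allNonZero scoped)
      (λ sc → by b h sc)
      where
      by : ∀ b → (if b then UniqueWitness W₁ × (∀ x → W₂ x ≡ false) else UniqueWitness W₂ × (∀ x → W₁ x ≡ false)) →
           ∀ sc → UniqueStarting b (p sc)
      by true  (uw , none) sc = unique₁ sc uw none
      by false (uw , none) sc = unique₂ sc uw none

  private
    small₁ : UniqueWitness W₁ → val ds₁ ≤ s
    small₁ uw = ≤-trans (all-bits-used W₁ (indices φ₁) (λ x y e → coSAT-cong (λ ys → eval-first-block φ₁ sc₁ x y ys e)) uw)
      (≤-trans (Fml-length p₁) (proj₁ (part {length u₁} {length ds₁} bound₁)))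

    small₂ : UniqueWitness W₂ → val ds₂ ≤ s
    small₂ uw = ≤-trans (all-bits-used W₂ (indices φ₂) (λ x y e → cong not (SAT-cong (λ ys → eval-first-block φ₂ sc₂ x y ys e))) uw)
      (≤-trans (Fml-length p₂) (proj₁ (part {length u₂} {length ds₂} bound₂)))

  UVAL-combined : ∀ b → (if b then UniqueWitness W₁ × (∀ x → W₂ x ≡ false) else UniqueWitness W₂ × (∀ x → W₁ x ≡ false)) →
                  UVAL (suc n) (ser⁺ (joinedOrConstant n s u₁ u₂ ds₁ ds₂)) ≡ ｛ b ｝
  UVAL-combined b h = by r₁ r₂ b (Inv.flag₁ invₛ) (Inv.flag₂ invₛ) h
    where
    by : ∀ r₁ r₂ b → Flag (val ds₁) s r₁ → Flag (val ds₂) s r₂ →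
      (if b then UniqueWitness W₁ × (∀ x → W₂ x ≡ false) else UniqueWitness W₂ × (∀ x → W₁ x ≡ false)) →
      UVAL (suc n) (ser⁺ (outcome (suc n) r₁ r₂ (joined n s u₁ u₂ ds₁ ds₂))) ≡ ｛ b ｝
    by true  true  b     f₁ f₂ h = UVAL-joined (Flag.to f₁ refl) (Flag.to f₂ refl) b h
    -- The second dimension exceeds s. With answer 1 the constant is right; answer 0 would come with
    -- a unique counterexample of g, which bounds that dimension by s.
    by true  false true  f₁ f₂ h = UVAL-constant true n
    by true  false false f₁ f₂ (uw , _) = contradiction (Flag.from f₂ (small₂ uw)) λ ()
    by false r₂    true  f₁ f₂ (uw , _) = contradiction (Flag.from f₁ (small₁ uw)) λ ()
    by false r₂    false f₁ f₂ h = UVAL-constant false n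

-- The reductions

witnessConjunction : List Bool
witnessConjunction = ser (`∧ ∷ `x ∷ `# ∷ `# ∷ [])

counterexampleDisjunction : List Bool
counterexampleDisjunction = ser (`∨ ∷ `x ∷ `# ∷ `# ∷ `¬ ∷ [])

module _ {n m} {ms : Vec ℕ n} .{{_ : NonZero m}} (f : BoolFun (m ∷ ms)) where

  private
    bit₀ : Vec Bool m → Bool
    bit₀ x = at false x 0

    π₁-at : (x : Vec Bool m) → π₁ x ≡ bit₀ x
    π₁-at (b ∷ x) = refl

  -- Unless f has a single witness x, `uval f` is full. Otherwise x is the only candidate for a
  -- witness of g, so the promise holds, and it is one exactly when its first bit is 1.
  uval⊇usat : (g : BoolFun (m ∷ ms)) → (∀ x ys → g (x ∷ ys) ≡ bit₀ x ∧ f (x ∷ ys)) → uval f ⊇ usat g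
  uval⊇usat g e b b∈ = goal (witnesses f) refl
    where
    spec : ∀ x → coSAT (fix g x) ≡ bit₀ x ∧ coSAT (fix f x)
    spec x = trans (coSAT-cong (e x)) (cases (bit₀ x))
      where
      cases : ∀ b → coSAT (λ ys → b ∧ fix f x ys) ≡ b ∧ coSAT (fix f x)
      cases true  = refl
      cases false = coSAT-const ms false
    ws : witnesses g ≡ filterᵇ bit₀ (witnesses f)
    ws = trans (filterᵇ-cong (words m) spec) (filterᵇ-∧ bit₀ (λ x → coSAT (fix f x)) (words m))
    sat : SAT g ≡ not (null (witnesses g))
    sat = any-filterᵇ (λ x → coSAT (fix g x)) (words m)
    form : ∀ {us} → witnesses g ≡ us → b ∈ (if length us ≤ᵇ 1 then ｛ not (null us) ｝ else full)
    form refl = subst (λ v → b ∈ (if length (witnesses g) ≤ᵇ 1 then ｛ v ｝ else full)) sat b∈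
    single : ∀ x → b ∈ (if length (filterᵇ bit₀ (x ∷ [])) ≤ᵇ 1 then ｛ not (null (filterᵇ bit₀ (x ∷ []))) ｝ else full) → b ≡ bit₀ x
    single x p with bit₀ x
    ... | true  = p
    ... | false = p
    goal : ∀ us → witnesses f ≡ us → b ∈ uval f
    goal us eq with witnesses f | ws
    goal [] refl | _ | _ = tt
    goal (x ∷ []) refl | _ | ws′ = trans (single x (form ws′)) (sym (π₁-at x))
    goal (_ ∷ _ ∷ _) refl | _ | _ = tt

  -- The counterexamples of g are the witnesses of f whose first bit is 0. For a single witness x
  -- there is thus at most one, and `coSAT g`, the absence of any, is the first bit of x.
  uval⊇cousat : (g : BoolFun (m ∷ ms)) → (∀ x ys → g (x ∷ ys) ≡ bit₀ x ∨ not (f (x ∷ ys))) → uval f ⊇ cousat g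
  uval⊇cousat g e b b∈ = goal (witnesses f) refl
    where
    spec : ∀ x → not (SAT (fix g x)) ≡ not (bit₀ x) ∧ coSAT (fix f x)
    spec x = trans (cong not (SAT-cong (e x))) (cases (bit₀ x))
      where
      cases : ∀ b → not (SAT (λ ys → b ∨ not (fix f x ys))) ≡ not b ∧ coSAT (fix f x)
      cases true  = cong not (SAT-const ms true)
      cases false = trans (cong not (SAT-not (fix f x))) (not-involutive _)
    ws : counterexamples g ≡ filterᵇ (not ∘ bit₀) (witnesses f)
    ws = trans (filterᵇ-cong (words m) spec) (filterᵇ-∧ (not ∘ bit₀) (λ x → coSAT (fix f x)) (words m))
    cosat : coSAT g ≡ null (counterexamples g)
    cosat = trans (sym (not-involutive _)) (trans (cong not (trans (all-not (λ x → SAT (fix g x)) (words m))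
      (any-filterᵇ (λ x → not (SAT (fix g x))) (words m)))) (not-involutive _))
    form : ∀ {us} → counterexamples g ≡ us → b ∈ (if length us ≤ᵇ 1 then ｛ null us ｝ else full)
    form refl = subst (λ v → b ∈ (if length (counterexamples g) ≤ᵇ 1 then ｛ v ｝ else full)) cosat b∈
    single : ∀ x → b ∈ (if length (filterᵇ (not ∘ bit₀) (x ∷ [])) ≤ᵇ 1 then ｛ null (filterᵇ (not ∘ bit₀) (x ∷ [])) ｝ else full) → b ≡ bit₀ x
    single x p with bit₀ x
    ... | true  = p
    ... | false = p
    goal : ∀ us → witnesses f ≡ us → b ∈ uval f
    goal us eq with witnesses f | ws
    goal [] refl | _ | _ = tt
    goal (x ∷ []) refl | _ | ws′ = trans (single x (form ws′)) (sym (π₁-at x))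
    goal (_ ∷ _ ∷ _) refl | _ | _ = tt

bit₀-scoped : ∀ {n m} {ms : Vec ℕ n} → NonZero m → InScope (m ∷ ms) (var 0 0)
bit₀-scoped {m = m} m≢0 = Fin.zero , refl , >-nonZero⁻¹ m {{m≢0}}

UVAL⊇USAT : ∀ n w → UVAL (suc n) w ⊇ USAT (suc n) (witnessConjunction ++⁺ w)
UVAL⊇USAT n w b b∈ with decode (suc n) w in e
... | nothing = tt
... | just record { dims = m ∷ ms ; positive = m≢0 ∷ ≢0 ; formula = φ ; scoped = sc }
  with st , e₁ , e₂ ← decode-parse (suc n) w e
  -- The parse of the prefixed word computes down to that of `w`, so this abstraction also makes the
  -- type of `b∈` reduce.
  with parse (toList w) | e₁
... | _ | refl with numbers (suc n) st | e₂
... | _ | refl with build-complete (and (var 0 0) φ) (m≢0 ∷ ≢0) (bit₀-scoped {ms = ms} m≢0 , sc)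
... | decoded pos sc′ eq =
  uval⊇usat {{m≢0}} (eval φ sc) (eval (and (var 0 0) φ) sc′)
    (λ x ys → trans (eval-env (and (var 0 0) φ) sc′ (x ∷ ys)) (cong (at false x 0 ∧_) (sym (eval-env φ sc (x ∷ ys))))) b
    (subst (λ J → b ∈ onInstances usatI J) eq b∈)

UVAL⊇coUSAT : ∀ n w → UVAL (suc n) w ⊇ coUSAT (suc n) (counterexampleDisjunction ++⁺ w)
UVAL⊇coUSAT n w b b∈ with decode (suc n) w in e
... | nothing = tt
... | just record { dims = m ∷ ms ; positive = m≢0 ∷ ≢0 ; formula = φ ; scoped = sc }
  with st , e₁ , e₂ ← decode-parse (suc n) w e
  with parse (toList w) | e₁
... | _ | refl with numbers (suc n) st | e₂
... | _ | refl with build-complete (or (var 0 0) (neg φ)) (m≢0 ∷ ≢0) (bit₀-scoped {ms = ms} m≢0 , sc)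
... | decoded pos sc′ eq =
  uval⊇cousat {{m≢0}} (eval φ sc) (eval (or (var 0 0) (neg φ)) sc′)
    (λ x ys → trans (eval-env (or (var 0 0) (neg φ)) sc′ (x ∷ ys)) (cong (λ v → at false x 0 ∨ not v) (sym (eval-env φ sc (x ∷ ys))))) b
    (subst (λ J → b ∈ onInstances cousatI J) eq b∈)

onInstances-just : ∀ {n} (F : Instance n → ℙ₊) J {b} → onInstances F J ≡ ｛ b ｝ → ∃[ I ] J ≡ just I × F I ≡ ｛ b ｝
onInstances-just F (just I) e = I , refl , e

UVAL-combine : ∀ n w₁ w₂ {b} → USAT (suc n) w₁ ≡ ｛ b ｝ → coUSAT (suc n) w₂ ≡ ｛ b ｝ → UVAL (suc n) (combine n w₁ w₂) ≡ ｛ b ｝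
UVAL-combine n w₁ w₂ {b} e₁ e₂
  with I₁ , j₁ , h₁ ← onInstances-just usatI (decode (suc n) w₁) e₁
  with I₂ , j₂ , h₂ ← onInstances-just cousatI (decode (suc n) w₂) e₂
  = go (decode-spelling (suc n) w₁ j₁) (decode-spelling (suc n) w₂ j₂) h₁ h₂
  where
  length-split : ∀ (u : List Symbol) ds v → length u + suc (length ds + length v) ≡ length (u ++ numeral ds ++ v)
  length-split u ds v = sym (trans (length-++ u) (cong (length u +_) (trans (length-++ (numeral ds)) (cong (_+ length v) (length-numeral ds)))))
  go : ∀ {σ₁ σ₂} {I₁ I₂ : Instance (suc n)} → Spelling σ₁ I₁ → Spelling σ₂ I₂ → usatI I₁ ≡ ｛ b ｝ → cousatI I₂ ≡ ｛ b ｝ →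
       UVAL (suc n) (ser⁺ (combinedWord n σ₁ σ₂)) ≡ ｛ b ｝
  go {I₁ = record { positive = m₁≢0 ∷ _ ; formula = φ₁ ; scoped = sc₁ }} {record { positive = m₂≢0 ∷ _ ; formula = φ₂ ; scoped = sc₂ }}
     (spelling {u₁} refl p₁ (_∷_ {v = v₁} {ks₁} ds₁ q₁)) (spelling {u₂} refl p₂ (_∷_ {v = v₂} {ks₂} ds₂ q₂)) h₁ h₂
    rewrite formulaPart-spelling ds₁ p₁ q₁ | formulaPart-spelling ds₂ p₂ q₂
          | firstDimension-spelling ds₁ p₁ q₁ | firstDimension-spelling ds₂ p₂ q₂ =
    UVAL-combined b (by b (usat-promise f h₁) (cousat-promise g h₂))
    where
    f : BoolFun (val ds₁ ∷ ks₁)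
    f = eval φ₁ sc₁
    g : BoolFun (val ds₂ ∷ ks₂)
    g = eval φ₂ sc₂
    open Combined ds₁ ds₂ p₁ p₂ q₁ q₂ (>-nonZero⁻¹ _ {{m₁≢0}}) (>-nonZero⁻¹ _ {{m₂≢0}}) sc₁ sc₂
      (length (u₁ ++ numeral ds₁ ++ v₁) + length (u₂ ++ numeral ds₂ ++ v₂))
      (≤-trans (≤-reflexive (length-split u₁ ds₁ v₁)) (m≤m+n _ _)) (≤-trans (≤-reflexive (length-split u₂ ds₂ v₂)) (m≤n+m _ (length (u₁ ++ numeral ds₁ ++ v₁))))
    counter-any : ∀ {b} → coSAT g ≡ b → any W₂ (words (val ds₂)) ≡ not b
    counter-any e = trans (sym (all-not (λ x → SAT (fix g x)) (words (val ds₂)))) (cong not e)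
    by : ∀ b → length (witnesses f) ≤ 1 × SAT f ≡ b → length (counterexamples g) ≤ 1 × coSAT g ≡ b →
         if b then UniqueWitness W₁ × (∀ x → W₂ x ≡ false) else UniqueWitness W₂ × (∀ x → W₁ x ≡ false)
    -- With answer 1 uniqueness comes from the promise on f, with answer 0 from the promise on g;
    -- the other instance contributes that it has nothing to find.
    by true  (≤1 , sat) (_ , cosat)  = unique-witness W₁ ≤1 sat , no-witness W₂ (counter-any cosat)
    by false (_ , sat)  (≤1 , cosat) = unique-witness W₂ ≤1 (counter-any cosat) , no-witness W₁ sat

-- Every `ℙ₊` is nonempty, so a part of a singleton is that singleton. Where the given problem has a
-- definite answer b, this makes both instances definite with the same b.
⊆-singleton : ∀ {A b} → (∀ c → c ∈ A → c ≡ b) → A ≡ ｛ b ｝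
⊆-singleton {｛ c ｝} p = cong ｛_｝ (p c refl)
⊆-singleton {full}   p = contradiction (trans (p true tt) (sym (p false tt))) λ ()

theorem10 : (n : ℕ) .{{_ : NonZero n}} → [ UVAL n ] ≐ [ USAT n ] ∩ [ coUSAT n ]
theorem10 (suc n) = to , from
  where
  to : ∀ {φ} → φ ∝ UVAL (suc n) → φ ∝ USAT (suc n) × φ ∝ coUSAT (suc n)
  to (μ , poly , p) =
    ((λ x → witnessConjunction ++⁺ μ x) , prepend-polyTime witnessConjunction poly , λ x b → p x b ∘ UVAL⊇USAT n (μ x) b) ,
    ((λ x → counterexampleDisjunction ++⁺ μ x) , prepend-polyTime counterexampleDisjunction poly , λ x b → p x b ∘ UVAL⊇coUSAT n (μ x) b)
  from : ∀ {φ} → φ ∝ USAT (suc n) × φ ∝ coUSAT (suc n) → φ ∝ UVAL (suc n)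
  from {φ} ((μ , poly , p) , (ν , poly′ , q)) = (λ x → combine n (μ x) (ν x)) , combine-polyTime poly poly′ n , covers
    where
    covers : ∀ x → φ x ⊇ UVAL (suc n) (combine n (μ x) (ν x))
    covers x c c∈ with φ x | p x | q x
    ... | full   | _ | _ = tt
    ... | ｛ b ｝ | p′ | q′ = subst (c ∈_) (UVAL-combine n (μ x) (ν x) (⊆-singleton p′) (⊆-singleton q′)) c∈
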